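{- Let $q=p^e$ with $p$ prime, and let $m\ge4$ be an integer with $(m,q)\neq(4,2)$ and $2\mid em$. Let $\gamma$ be a primitive element of $\mathbb{F}_{q^m}$. Let $N\neq1$ be a proper divisor of $q^m-1$ such that $p^{\ell_1}\equiv-1\pmod N$ for some positive integer $\ell_1$; choose $\ell_1$ minimal and write $em=2\ell_1t$. Let $J\subsetneq\mathbb{Z}_N$ be a proper subset of size $u$. If $q$ is odd, assume further that $N\mid\frac{q^m-1}{2}$ and $J+\frac{q^m-1}{2}\equiv J\pmod N$. For $0\le i\le N-1$ let $C_i=\{\gamma^{jN+i}:0\le j\le\frac{q^m-1}{N}-1\}$, and let $D=\bigcup_{j\in J}C_j$. If $J$ is invariant under the map $\rho:j\mapsto j+\frac{q^m-1}{q-1}\pmod N$ and one of the following holds: (1) $t$ is odd, $u\neq\dfrac{\sqrt{q^m}\,N}{\sqrt{q^m}+1}$ and $u>\dfrac{N}{\sqrt{q^m}+1}$; (2) $t$ is even and $u>\dfrac{(q-1)\sqrt{q^m}\,N}{(\sqrt{q^m}+q)(\sqrt{q^m}-1)}$; then the code $\mathcal C(M_D)$ is a minimal linear code.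
   Context: $\mathrm{Tr}=\mathrm{Tr}_{\mathbb{F}_{q^m}/\mathbb{F}_q}$. Code: fix an ordering $x_1,\dots,x_{q^m-1}$ of $\mathbb{F}_{q^m}^*$, let $f_D$ be the characteristic function of $D$ ($1$ on $D$, $0$ elsewhere, in $\mathbb{F}_q$), and for $(u',v)\in\mathbb{F}_q\times\mathbb{F}_{q^m}$ let $c(u',v)=(u'f_D(x_i)+\mathrm{Tr}(vx_i))_{1\le i\le q^m-1}$; $\mathcal C(M_D)=\{c(u',v)\}$. A linear code is minimal if whenever codewords $c,c'$ satisfy $\mathrm{supp}(c')\subseteq\mathrm{supp}(c)$ (supports = sets of nonzero coordinates), $c'=\lambda c$ for some $\lambda\in\mathbb{F}_q$. -}

module Defs where

open import Level using (0ℓ)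
open import Data.Nat using (ℕ; zero; suc; NonZero; _/_) renaming (_+_ to _+ℕ_; _*_ to _*ℕ_; _^_ to _^ℕ_; _∸_ to _∸ℕ_)
open import Data.Fin as Fin using (Fin; toℕ) renaming (_≟_ to _≟F_)
open import Data.Fin.Subset using (Subset)
open import Data.Fin.Subset.Properties using (_∈?_)
open import Data.Bool using (Bool; true; false; _∧_; _∨_; if_then_else_)
open import Data.Product using (Σ; _×_; _,_)
open import Relation.Binary.PropositionalEquality using (_≡_)
open import Relation.Nullary using (¬_)
open import Relation.Nullary.Decidable using (⌊_⌋)
open import Algebra.Core using (Op₁; Op₂)
open import Algebra.Structures using (IsCommutativeRing)
open import Function.Bundles using (_↔_; Inverse)

record FiniteField (n : ℕ) : Set₁ where
  infixl 6 _+_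
  infixl 7 _*_
  field
    Carrier : Set
    _+_ _*_ : Op₂ Carrier
    -_ : Op₁ Carrier
    0# 1# : Carrier
    isCommutativeRing : IsCommutativeRing _≡_ _+_ _*_ -_ 0# 1#
    0≢1 : ¬ (0# ≡ 1#)
    inverse : ∀ x → ¬ (x ≡ 0#) → Σ Carrier (λ y → x * y ≡ 1#)
    enum : Fin n ↔ Carrier

  infixr 8 _^_
  _^_ : Carrier → ℕ → Carrier
  x ^ zero = 1#
  x ^ suc k = x * (x ^ k)

  sumTo : ℕ → (ℕ → Carrier) → Carrier
  sumTo zero f = 0#
  sumTo (suc k) f = sumTo k f + f k

  eqb : Carrier → Carrier → Bool
  eqb x y = ⌊ Inverse.from enum x ≟F Inverse.from enum y ⌋

  IsPrimitive : Carrier → Set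
  IsPrimitive γ = ∀ x → ¬ (x ≡ 0#) → Σ ℕ (λ k → x ≡ γ ^ k)

  InSubfield : ℕ → Carrier → Set
  InSubfield q x = x ^ q ≡ x

  Tr : ℕ → ℕ → Carrier → Carrier
  Tr q m x = sumTo m (λ i → x ^ (q ^ℕ i))

anyBelow : ℕ → (ℕ → Bool) → Bool
anyBelow zero f = false
anyBelow (suc k) f = anyBelow k f ∨ f k

anyFin : (k : ℕ) → (Fin k → Bool) → Bool
anyFin k f = anyBelow' k f
  where
    anyBelow' : (k : ℕ) → (Fin k → Bool) → Bool
    anyBelow' zero f = false
    anyBelow' (suc k) f = f Fin.zero ∨ anyBelow' k (λ j → f (Fin.suc j))

module _ {n : ℕ} (F : FiniteField n) where
  open FiniteField F

  inD : (γ : Carrier) (N : ℕ) .{{_ : NonZero N}} (J : Subset N) → Carrier → Bool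
  inD γ N J x =
    anyFin N (λ j → ⌊ j ∈? J ⌋ ∧
      anyBelow ((n ∸ℕ 1) / N) (λ k → eqb x (γ ^ (k *ℕ N +ℕ toℕ j))))

  fD : (γ : Carrier) (N : ℕ) .{{_ : NonZero N}} (J : Subset N) → Carrier → Carrier
  fD γ N J x = if inD γ N J x then 1# else 0#

  -- the codeword c(u',v), as a function of the coordinate x ∈ F_{q^m}^*
  -- (coordinates are the nonzero x; the ordering is irrelevant)
  codeword : (q m : ℕ) (γ : Carrier) (N : ℕ) .{{_ : NonZero N}} (J : Subset N) →
             Carrier → Carrier → Carrier → Carrier
  codeword q m γ N J u' v x = u' * fD γ N J x + Tr q m (v * x)

  -- C(M_D) = { c(u',v) : u' ∈ F_q, v ∈ F_{q^m} } is a minimal code: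
  -- supp(c') ⊆ supp(c)  ⇒  c' = λ c for some λ ∈ F_q.
  IsMinimalCodeMD : (q m : ℕ) (γ : Carrier) (N : ℕ) .{{_ : NonZero N}} (J : Subset N) → Set
  IsMinimalCodeMD q m γ N J =
    ∀ (u₁ v₁ u₂ v₂ : Carrier) → InSubfield q u₁ → InSubfield q u₂ →
    (∀ x → ¬ (x ≡ 0#) → ¬ (codeword q m γ N J u₂ v₂ x ≡ 0#) →
                         ¬ (codeword q m γ N J u₁ v₁ x ≡ 0#)) →
    Σ Carrier (λ λ' → InSubfield q λ' ×
      (∀ x → ¬ (x ≡ 0#) → codeword q m γ N J u₂ v₂ x ≡ λ' * codeword q m γ N J u₁ v₁ x))

{-# OPTIONS --safe #-}
-- The zero set of a codeword is governed by the numbers |D ∩ H| for the hyperplanes H : Tr(v x) = 0, and these take only two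
-- values.  Put P = p^ℓ₁ and K = P + 1, so that N ∣ K ∣ q^m - 1 and D is closed under multiplication by K-th powers.  The map
-- x ↦ tr(v x^K) to 𝔽p is a quadratic form whose radical { z : v z + v^P z^(P²) = 0 } is trivial or has P² elements; counting the
-- pairs on which the form agrees gives S(v)² = q^m or q^m P² for S(v) = ∑ₓ ψ(v x^K), and the signs follow from S(v) ≡ 1 mod K:
-- with τ = (-1)^t s, S(v) = τ, or S(v) = -τ P for v in one special coset of the K-th powers.  Averaging over K-th powers and over
-- 𝔽q* turns this into N q |D ∩ H| = u (τ - 1)(τ + q) - N (q - 1) τ ε with ε ∈ {0, 1}.
--
-- If supp c₂ ⊆ supp c₁ but c₂ is not a multiple of c₁, then D or its complement lies in a hyperplane, or D misses a hyperplane,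
-- or |D ∩ H| - |D ∩ H′| = q^(m-2) (q - 1) for some H and H′, or (for q = 2) D is partitioned by its intersections with three
-- hyperplanes; each of these contradicts the formula.
module Submission where

open import Defs
open import Level using (0ℓ)
open import Data.Nat using (ℕ; zero; suc; NonZero; _+_; _*_; _∸_; _^_; _≤_; _<_; _/_; _%_; z≤n; s≤s; _!)
import Data.Nat as ℕ
import Data.Nat.Properties as ℕₚ
open import Data.Nat.DivMod using (_mod_)
import Data.Nat.DivMod as DivMod
open import Data.Nat.Divisibility using (_∣_; divides)
import Data.Nat.Divisibility as Div
open import Data.Nat.Primality using (Prime)
import Data.Nat.Primality as Primality
open import Data.Nat.Combinatorics using (_C_)
import Data.Nat.Combinatorics as Comb
open import Data.Integer using (ℤ; 0ℤ; 1ℤ) renaming (_+_ to _+ᶻ_; _*_ to _*ᶻ_; _-_ to _-ᶻ_; -_ to -ᶻ_; +_ to pos)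
import Data.Integer as ℤ
import Data.Integer.Properties as ℤₚ
open import Data.Integer.Tactic.RingSolver using (solve-∀)
open import Data.Bool using (Bool; true; false; _∧_; _∨_; if_then_else_)
import Data.Bool.Properties as Boolₚ
open import Data.Fin as Fin using (Fin; toℕ; fromℕ<)
import Data.Fin.Properties as Finₚ
open import Data.Fin.Permutation using (Permutation)
open import Data.Fin.Subset using (Subset; _∈_; ∣_∣; ⊤)
open import Data.Fin.Subset.Properties using (_∈?_)
import Data.Fin.Subset.Properties as Subsetₚ
open import Data.Vec using ([]; _∷_; here; there)
open import Data.Product using (Σ; ∃; _×_; _,_; proj₁; proj₂)
open import Data.Sum as Sum using (_⊎_; inj₁; inj₂)
open import Data.Empty using (⊥; ⊥-elim)
open import Relation.Binary.PropositionalEquality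
open import Relation.Binary.Definitions using (DecidableEquality; tri<; tri≈; tri>)
open import Relation.Nullary using (¬_; Dec; yes; no; does)
open import Relation.Nullary.Decidable using (map′; dec-true; dec-false; ⌊_⌋; toSum; ¬?; _×-dec_; decidable-stable)
open import Relation.Unary using (Decidable)
open import Function using (_∘_; _⇔_; Inverse; mk↔ₛ′)
open import Algebra.Bundles using (CommutativeRing)
import Algebra.Properties.Ring as RingProperties
import Algebra.Properties.CommutativeSemiring.Binomial as Binomial
import Algebra.Properties.Semiring.Sum as SemiringSum
import Algebra.Properties.Semiring.Mult as SemiringMult
import Algebra.Properties.Semiring.Exp as SemiringExp
open ≡-Reasoning

-- No complex numbers occur. The nonzero fibres of the forms in question have equal size, so their
-- character sums are integers, and the argument is pure counting in ℤ. As ℤ has no division,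
-- identities stay multiplied by p - 1, `K`, `M`, `N` or q and are cancelled afterwards. The sign of
-- S(v), usually the delicate point of semiprimitive Gauss sums, needs no separate evaluation: `K` ≥
-- 3 does not divide 2, so x and -x cannot both be 1 modulo `K`. The special coset is never located.
-- Summing S(v) over all v gives n by orthogonality, which forces the number of special v to be M /
-- K. Any two special v differ by a `K`-th power factor, so a set closed under multiplication by
-- `K`-th powers contains all x with v x special or none of them; this dichotomy is the bit ε. The
-- sums are computed for `K`-th powers rather than `N`-th powers because the exponent P + 1 makes
-- the form quadratic; nothing is lost, since `N` divides `K`.

private
  module ∑ᶻ = SemiringSum (CommutativeRing.semiring ℤₚ.+-*-commutativeRing)

-- Integer sums over initial segments of ℕ.

range : ℕ → (ℕ → ℤ) → ℤ
range zero    f = 0ℤ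
range (suc k) f = f 0 +ᶻ range k (f ∘ suc)

range-cong : ∀ k {f g : ℕ → ℤ} → (∀ i → i < k → f i ≡ g i) → range k f ≡ range k g
range-cong zero    e = refl
range-cong (suc k) e = cong₂ _+ᶻ_ (e 0 (s≤s z≤n)) (range-cong k (λ i i<k → e (suc i) (s≤s i<k)))

range-0 : ∀ k → range k (λ _ → 0ℤ) ≡ 0ℤ
range-0 zero    = refl
range-0 (suc k) = trans (ℤₚ.+-identityˡ _) (range-0 k)

range-+ : ∀ a b f → range (a + b) f ≡ range a f +ᶻ range b (λ i → f (a + i))
range-+ zero    b f = sym (ℤₚ.+-identityˡ _)
range-+ (suc a) b f = trans (cong (f 0 +ᶻ_) (range-+ a b (f ∘ suc))) (sym (ℤₚ.+-assoc (f 0) _ _))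

range-periodic : ∀ h r f → (∀ i → f (h + i) ≡ f i) → range (r * h) f ≡ pos r *ᶻ range h f
range-periodic h zero    f per = refl
range-periodic h (suc r) f per = begin
  range (h + r * h) f ≡⟨ range-+ h (r * h) f ⟩
  range h f +ᶻ range (r * h) (λ i → f (h + i)) ≡⟨ cong (range h f +ᶻ_) (range-cong (r * h) (λ i _ → per i)) ⟩
  range h f +ᶻ range (r * h) f ≡⟨ cong (range h f +ᶻ_) (range-periodic h r f per) ⟩
  range h f +ᶻ pos r *ᶻ range h f ≡⟨ lem (range h f) (pos r) ⟩
  pos (suc r) *ᶻ range h f ∎
  where
  lem : ∀ x y → x +ᶻ y *ᶻ x ≡ (pos 1 +ᶻ y) *ᶻ x
  lem = solve-∀

range-sum : ∀ k f → ∑ᶻ.sum {k} (λ i → f (toℕ i)) ≡ range k f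
range-sum zero    f = refl
range-sum (suc k) f = cong (f 0 +ᶻ_) (range-sum k (f ∘ suc))

⟦_⟧ : {A : Set} → Dec A → ℤ
⟦ d ⟧ = if does d then 1ℤ else 0ℤ

⟦⟧-yes : {A : Set} (d : Dec A) → A → ⟦ d ⟧ ≡ 1ℤ
⟦⟧-yes d a rewrite dec-true d a = refl

⟦⟧-no : {A : Set} (d : Dec A) → ¬ A → ⟦ d ⟧ ≡ 0ℤ
⟦⟧-no d ¬a rewrite dec-false d ¬a = refl

-- Field arithmetic, and integer-valued sums over all field elements.

module FieldProperties {n : ℕ} (F : FiniteField n) where
  open FiniteField F public
    renaming (_+_ to _+ᶠ_; _*_ to _*ᶠ_; -_ to -ᶠ_; _^_ to _^ᶠ_)

  commutativeRing : CommutativeRing 0ℓ 0ℓ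
  commutativeRing = record { isCommutativeRing = isCommutativeRing }

  module R = CommutativeRing commutativeRing
  module Rₚ = RingProperties R.ring
  module Expᶠ = SemiringExp R.semiring
  module Multᶠ = SemiringMult R.semiring
  module ∑ᶠ = SemiringSum R.semiring

  infixl 6 _-ᶠ_
  _-ᶠ_ : Carrier → Carrier → Carrier
  x -ᶠ y = x +ᶠ -ᶠ y

  private
    to   = Inverse.to enum
    from = Inverse.from enum

    to∘from : ∀ x → to (from x) ≡ x
    to∘from = Inverse.strictlyInverseˡ enum

    from∘to : ∀ i → from (to i) ≡ i
    from∘to = Inverse.strictlyInverseʳ enum

  from-injective : ∀ {x y} → from x ≡ from y → x ≡ y
  from-injective {x} {y} e = trans (sym (to∘from x)) (trans (cong to e) (to∘from y))

  infix 4 _≟ᶠ_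
  _≟ᶠ_ : DecidableEquality Carrier
  x ≟ᶠ y = map′ from-injective (cong from) (from x Finₚ.≟ from y)

  search : {P : Carrier → Set} → Decidable P → Dec (∃ P)
  search {P} P? = map′ (λ (i , p) → to i , p) (λ (x , p) → from x , subst P (sym (to∘from x)) p)
    (Finₚ.any? (λ i → P? (to i)))

  FrobeniusAdditive : ℕ → Set
  FrobeniusAdditive q = ∀ x y → (x +ᶠ y) ^ᶠ q ≡ x ^ᶠ q +ᶠ y ^ᶠ q

  -ᶠ-0 : ∀ x → x -ᶠ 0# ≡ x
  -ᶠ-0 x = trans (cong (x +ᶠ_) Rₚ.-0#≈0#) (R.+-identityʳ x)

  x-y≡0⇒x≡y : ∀ {x y} → x -ᶠ y ≡ 0# → x ≡ y
  x-y≡0⇒x≡y {x} {y} e = Rₚ.x∙y⁻¹≈ε⇒x≈y x y e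

  x-y+y : ∀ x y → (x -ᶠ y) +ᶠ y ≡ x
  x-y+y x y = trans (R.+-assoc x _ y) (trans (cong (x +ᶠ_) (R.-‿inverseˡ y)) (R.+-identityʳ x))

  x+y-y : ∀ x y → (x +ᶠ y) -ᶠ y ≡ x
  x+y-y x y = trans (R.+-assoc x y _) (trans (cong (x +ᶠ_) (R.-‿inverseʳ y)) (R.+-identityʳ x))

  *-cancelˡ : ∀ {x y z} → ¬ x ≡ 0# → x *ᶠ y ≡ x *ᶠ z → y ≡ z
  *-cancelˡ {x} {y} {z} x≢0 e = trans (sym (undo y)) (trans (cong (x⁻¹ *ᶠ_) e) (undo z))
    where
    x⁻¹ = proj₁ (inverse x x≢0)
    undo : ∀ w → x⁻¹ *ᶠ (x *ᶠ w) ≡ w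
    undo w = trans (sym (R.*-assoc x⁻¹ x w)) (trans
      (cong (_*ᶠ w) (trans (R.*-comm x⁻¹ x) (proj₂ (inverse x x≢0)))) (R.*-identityˡ w))

  x*y≡0⇒y≡0 : ∀ {x y} → ¬ x ≡ 0# → x *ᶠ y ≡ 0# → y ≡ 0#
  x*y≡0⇒y≡0 {x} x≢0 e = *-cancelˡ x≢0 (trans e (sym (R.zeroʳ x)))

  *-≢0 : ∀ {x y} → ¬ x ≡ 0# → ¬ y ≡ 0# → ¬ x *ᶠ y ≡ 0#
  *-≢0 x≢0 y≢0 e = y≢0 (x*y≡0⇒y≡0 x≢0 e)

  *-≢0ʳ : ∀ {x y} → ¬ x *ᶠ y ≡ 0# → ¬ y ≡ 0#
  *-≢0ʳ {x} {y} xy≢0 refl = xy≢0 (R.zeroʳ x)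

  1≢0 : ¬ 1# ≡ 0#
  1≢0 e = 0≢1 (sym e)

  ^ᶠ≡exp : ∀ x k → x ^ᶠ k ≡ x Expᶠ.^ k
  ^ᶠ≡exp x zero    = refl
  ^ᶠ≡exp x (suc k) = cong (x *ᶠ_) (^ᶠ≡exp x k)

  ^-+ : ∀ x a b → x ^ᶠ (a + b) ≡ x ^ᶠ a *ᶠ x ^ᶠ b
  ^-+ x zero    b = sym (R.*-identityˡ _)
  ^-+ x (suc a) b = trans (cong (x *ᶠ_) (^-+ x a b)) (sym (R.*-assoc x _ _))

  ^-* : ∀ x a b → x ^ᶠ (a * b) ≡ (x ^ᶠ a) ^ᶠ b
  ^-* x a zero    = cong (x ^ᶠ_) (ℕₚ.*-zeroʳ a)
  ^-* x a (suc b) = trans (cong (x ^ᶠ_) (ℕₚ.*-suc a b)) (trans (^-+ x a (a * b)) (cong (x ^ᶠ a *ᶠ_) (^-* x a b)))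

  ^-*′ : ∀ x a b → x ^ᶠ (a * b) ≡ (x ^ᶠ b) ^ᶠ a
  ^-*′ x a b = trans (cong (x ^ᶠ_) (ℕₚ.*-comm a b)) (^-* x b a)

  ^-comm : ∀ x a b → (x ^ᶠ a) ^ᶠ b ≡ (x ^ᶠ b) ^ᶠ a
  ^-comm x a b = trans (sym (^-* x a b)) (^-*′ x a b)

  *-interchange : ∀ a b c d → (a *ᶠ b) *ᶠ (c *ᶠ d) ≡ (a *ᶠ c) *ᶠ (b *ᶠ d)
  *-interchange a b c d = begin
    (a *ᶠ b) *ᶠ (c *ᶠ d) ≡⟨ R.*-assoc a b _ ⟩
    a *ᶠ (b *ᶠ (c *ᶠ d)) ≡⟨ cong (a *ᶠ_) (R.*-assoc b c d) ⟨
    a *ᶠ ((b *ᶠ c) *ᶠ d) ≡⟨ cong (λ z → a *ᶠ (z *ᶠ d)) (R.*-comm b c) ⟩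
    a *ᶠ ((c *ᶠ b) *ᶠ d) ≡⟨ cong (a *ᶠ_) (R.*-assoc c b d) ⟩
    a *ᶠ (c *ᶠ (b *ᶠ d)) ≡⟨ R.*-assoc a c _ ⟨
    (a *ᶠ c) *ᶠ (b *ᶠ d) ∎

  *-swapˡ : ∀ a b c → a *ᶠ (b *ᶠ c) ≡ b *ᶠ (a *ᶠ c)
  *-swapˡ a b c = trans (sym (R.*-assoc a b c)) (trans (cong (_*ᶠ c) (R.*-comm a b)) (R.*-assoc b a c))

  *-^ : ∀ x y k → (x *ᶠ y) ^ᶠ k ≡ x ^ᶠ k *ᶠ y ^ᶠ k
  *-^ x y zero    = sym (R.*-identityˡ 1#)
  *-^ x y (suc k) = trans (cong (x *ᶠ y *ᶠ_) (*-^ x y k)) (*-interchange x y _ _)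

  1^ : ∀ k → 1# ^ᶠ k ≡ 1#
  1^ zero    = refl
  1^ (suc k) = trans (R.*-identityˡ _) (1^ k)

  0^ : ∀ {k} → 1 ≤ k → 0# ^ᶠ k ≡ 0#
  0^ {suc k} _ = R.zeroˡ _

  ^-≢0 : ∀ {x} k → ¬ x ≡ 0# → ¬ x ^ᶠ k ≡ 0#
  ^-≢0 zero    x≢0 = 1≢0
  ^-≢0 (suc k) x≢0 = *-≢0 x≢0 (^-≢0 k x≢0)

  opaque
    δ : Carrier → ℤ
    δ x = if does (x ≟ᶠ 0#) then 1ℤ else 0ℤ

    δ-≡0 : ∀ {x} → x ≡ 0# → δ x ≡ 1ℤ
    δ-≡0 {x} e rewrite dec-true (x ≟ᶠ 0#) e = refl

    δ-≢0 : ∀ {x} → ¬ x ≡ 0# → δ x ≡ 0ℤ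
    δ-≢0 {x} e rewrite dec-false (x ≟ᶠ 0#) e = refl

  δ-cong : ∀ {x y} → (x ≡ 0# → y ≡ 0#) → (y ≡ 0# → x ≡ 0#) → δ x ≡ δ y
  δ-cong {x} {y} f g with toSum (x ≟ᶠ 0#)
  ... | inj₁ e  = trans (δ-≡0 e) (sym (δ-≡0 (f e)))
  ... | inj₂ ne = trans (δ-≢0 ne) (sym (δ-≢0 (ne ∘ g)))

  δ-*ˡ : ∀ {a} x → ¬ a ≡ 0# → δ (a *ᶠ x) ≡ δ x
  δ-*ˡ {a} x a≢0 = δ-cong (x*y≡0⇒y≡0 a≢0) (λ { refl → R.zeroʳ a })

  δ-sym : ∀ x y → δ (x -ᶠ y) ≡ δ (y -ᶠ x)
  δ-sym x y = δ-cong (λ e → trans (cong (λ z → y -ᶠ z) (x-y≡0⇒x≡y e)) (R.-‿inverseʳ y))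
                     (λ e → trans (cong (λ z → x -ᶠ z) (x-y≡0⇒x≡y e)) (R.-‿inverseʳ x))

  δ-*-cong : ∀ x {a b} → (x ≡ 0# → a ≡ b) → δ x *ᶻ a ≡ δ x *ᶻ b
  δ-*-cong x {a} {b} f with toSum (x ≟ᶠ 0#)
  ... | inj₁ e  = cong (δ x *ᶻ_) (f e)
  ... | inj₂ ne rewrite δ-≢0 ne = refl

  opaque
    ∑ : (Carrier → ℤ) → ℤ
    ∑ g = ∑ᶻ.sum (g ∘ to)

    ∑-cong : ∀ {g h} → (∀ x → g x ≡ h x) → ∑ g ≡ ∑ h
    ∑-cong e = ∑ᶻ.sum-cong-≗ (e ∘ to)

    ∑-+ : ∀ g h → ∑ (λ x → g x +ᶻ h x) ≡ ∑ g +ᶻ ∑ h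
    ∑-+ g h = ∑ᶻ.∑-distrib-+ (g ∘ to) (h ∘ to)

    ∑-*ˡ : ∀ c g → ∑ (λ x → c *ᶻ g x) ≡ c *ᶻ ∑ g
    ∑-*ˡ c g = sym (∑ᶻ.*-distribˡ-sum c (g ∘ to))

    ∑-*ʳ : ∀ c g → ∑ (λ x → g x *ᶻ c) ≡ ∑ g *ᶻ c
    ∑-*ʳ c g = sym (∑ᶻ.*-distribʳ-sum c (g ∘ to))

    ∑-swap : ∀ (g : Carrier → Carrier → ℤ) → ∑ (λ x → ∑ (g x)) ≡ ∑ (λ y → ∑ (λ x → g x y))
    ∑-swap g = ∑ᶻ.∑-comm (λ i j → g (to i) (to j))

  ∑-- : ∀ g h → ∑ (λ x → g x -ᶻ h x) ≡ ∑ g -ᶻ ∑ h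
  ∑-- g h = begin
    ∑ (λ x → g x -ᶻ h x) ≡⟨ ∑-cong (λ x → neg (g x) (h x)) ⟩
    ∑ (λ x → g x +ᶻ (-ᶻ 1ℤ) *ᶻ h x) ≡⟨ ∑-+ g _ ⟩
    ∑ g +ᶻ ∑ (λ x → (-ᶻ 1ℤ) *ᶻ h x) ≡⟨ cong (∑ g +ᶻ_) (∑-*ˡ (-ᶻ 1ℤ) h) ⟩
    ∑ g +ᶻ (-ᶻ 1ℤ) *ᶻ ∑ h ≡⟨ neg (∑ g) (∑ h) ⟨
    ∑ g -ᶻ ∑ h ∎
    where
    neg : ∀ a b → a -ᶻ b ≡ a +ᶻ (-ᶻ 1ℤ) *ᶻ b
    neg = solve-∀

  opaque
    unfolding ∑

    ∑-const : ∀ c → ∑ (λ _ → c) ≡ pos n *ᶻ c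
    ∑-const c = go n
      where
      go : ∀ k → ∑ᶻ.sum {k} (λ _ → c) ≡ pos k *ᶻ c
      go zero    = refl
      go (suc k) = trans (cong (c +ᶻ_) (go k)) (lem c (pos k))
        where
        lem : ∀ c k → c +ᶻ k *ᶻ c ≡ (1ℤ +ᶻ k) *ᶻ c
        lem = solve-∀

  ∑-1 : ∑ (λ _ → 1ℤ) ≡ pos n
  ∑-1 = trans (∑-const 1ℤ) (ℤₚ.*-identityʳ (pos n))

  permutation : (φ ψ : Carrier → Carrier) → (∀ x → φ (ψ x) ≡ x) → (∀ x → ψ (φ x) ≡ x) → Permutation n n
  permutation φ ψ φψ ψφ = mk↔ₛ′ (from ∘ φ ∘ to) (from ∘ ψ ∘ to) (inv φ ψ φψ) (inv ψ φ ψφ)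
    where
    inv : ∀ φ ψ → (∀ x → φ (ψ x) ≡ x) → ∀ i → from (φ (to (from (ψ (to i))))) ≡ i
    inv φ ψ φψ i = trans (cong (from ∘ φ) (to∘from _)) (trans (cong from (φψ (to i))) (from∘to i))

  opaque
    unfolding ∑

    ∑-bij : ∀ (φ ψ : Carrier → Carrier) → (∀ x → φ (ψ x) ≡ x) → (∀ x → ψ (φ x) ≡ x) →
            ∀ g → ∑ (g ∘ φ) ≡ ∑ g
    ∑-bij φ ψ φψ ψφ g = sym (trans (∑ᶻ.sum-permute (g ∘ to) (permutation φ ψ φψ ψφ))
      (∑ᶻ.sum-cong-≗ (λ i → cong g (to∘from (φ (to i))))))

  ∑-shift : ∀ c g → ∑ (λ x → g (x +ᶠ c)) ≡ ∑ g
  ∑-shift c g = ∑-bij (_+ᶠ c) (_-ᶠ c) (λ x → x-y+y x c) (λ x → x+y-y x c) g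

  ∑-scale : ∀ {c} → ¬ c ≡ 0# → ∀ g → ∑ (λ x → g (c *ᶠ x)) ≡ ∑ g
  ∑-scale {c} c≢0 g = ∑-bij (c *ᶠ_) (c⁻¹ *ᶠ_) cc⁻¹
    (λ x → *-cancelˡ c≢0 (cc⁻¹ (c *ᶠ x))) g
    where
    c⁻¹ = proj₁ (inverse c c≢0)
    cc⁻¹ : ∀ x → c *ᶠ (c⁻¹ *ᶠ x) ≡ x
    cc⁻¹ x = trans (sym (R.*-assoc c c⁻¹ x)) (trans (cong (_*ᶠ x) (proj₂ (inverse c c≢0))) (R.*-identityˡ x))

  opaque
    unfolding δ ∑

    ∑-δ : ∑ δ ≡ 1ℤ
    ∑-δ = trans (∑ᶻ.sum-cong-≗ (λ i → cong (λ k → if does (k Finₚ.≟ from 0#) then 1ℤ else 0ℤ) (from∘to i)))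
                (go n (from 0#))
      where
      go : ∀ k (j : Fin k) → ∑ᶻ.sum (λ i → if does (i Finₚ.≟ j) then 1ℤ else 0ℤ) ≡ 1ℤ
      go (suc k) Fin.zero    = cong (1ℤ +ᶻ_) (trans (range-sum k (λ _ → 0ℤ)) (range-0 k))
      go (suc k) (Fin.suc j) = trans (ℤₚ.+-identityˡ _) (go k j)

  ∑-δ-0 : ∀ g → ∑ (λ x → δ x *ᶻ g x) ≡ g 0#
  ∑-δ-0 g = begin
    ∑ (λ x → δ x *ᶻ g x) ≡⟨ ∑-cong (λ x → δ-*-cong x (cong g)) ⟩
    ∑ (λ x → δ x *ᶻ g 0#) ≡⟨ ∑-*ʳ (g 0#) δ ⟩
    ∑ δ *ᶻ g 0# ≡⟨ cong (_*ᶻ g 0#) ∑-δ ⟩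
    1ℤ *ᶻ g 0# ≡⟨ ℤₚ.*-identityˡ (g 0#) ⟩
    g 0# ∎

  ∑-δ-at : ∀ c g → ∑ (λ x → δ (x -ᶠ c) *ᶻ g x) ≡ g c
  ∑-δ-at c g = begin
    ∑ (λ x → δ (x -ᶠ c) *ᶻ g x) ≡⟨ ∑-shift c _ ⟨
    ∑ (λ x → δ (x +ᶠ c -ᶠ c) *ᶻ g (x +ᶠ c)) ≡⟨ ∑-cong (λ x → cong (λ z → δ z *ᶻ g (x +ᶠ c)) (x+y-y x c)) ⟩
    ∑ (λ x → δ x *ᶻ g (x +ᶠ c)) ≡⟨ ∑-δ-0 (λ x → g (x +ᶠ c)) ⟩
    g (0# +ᶠ c) ≡⟨ cong g (R.+-identityˡ c) ⟩
    g c ∎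

  -- Translation by 1 permutes the field, so the sum of all elements equals itself plus `n` copies
  -- of 1.
  n×1≡0 : n Multᶠ.× 1# ≡ 0#
  n×1≡0 = Rₚ.+-identityʳ-unique (∑ᶠ.sum to) _ (sym (begin
    ∑ᶠ.sum to ≡⟨ ∑ᶠ.sum-permute to (permutation (_+ᶠ 1#) (_-ᶠ 1#) (λ x → x-y+y x 1#) (λ x → x+y-y x 1#)) ⟩
    ∑ᶠ.sum (λ i → to (from (to i +ᶠ 1#))) ≡⟨ ∑ᶠ.sum-cong-≗ (λ i → to∘from (to i +ᶠ 1#)) ⟩
    ∑ᶠ.sum (λ i → to i +ᶠ 1#) ≡⟨ ∑ᶠ.∑-distrib-+ to (λ _ → 1#) ⟩
    ∑ᶠ.sum to +ᶠ ∑ᶠ.sum {n} (λ _ → 1#) ≡⟨ cong (∑ᶠ.sum to +ᶠ_) (∑ᶠ.sum-replicate n) ⟩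
    ∑ᶠ.sum to +ᶠ n Multᶠ.× 1# ∎))

  card≤ : ∀ {k} (f : Carrier → Fin k) → (∀ x y → f x ≡ f y → x ≡ y) → n ≤ k
  card≤ f inj = Finₚ.injective⇒≤ {f = f ∘ to} (λ {i} {j} e →
    trans (sym (from∘to i)) (trans (cong from (inj _ _ e)) (from∘to j)))

  collision : ∀ {k} → n < k → (g : Fin k → Carrier) → ∃ λ i → ∃ λ j → i Fin.< j × g i ≡ g j
  collision n<k g with Finₚ.pigeonhole n<k (from ∘ g)
  ... | i , j , i<j , e = i , j , i<j , from-injective e

  opaque
    unfolding ∑

    ∑-reindex : ∀ {k} (g : Fin k → Carrier) (f : Carrier → Fin k) → (∀ x → g (f x) ≡ x) → (∀ i → f (g i) ≡ i) →
                ∀ h → ∑ h ≡ ∑ᶻ.sum (h ∘ g)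
    ∑-reindex g f gf fg h = trans (∑ᶻ.sum-permute (h ∘ to)
        (mk↔ₛ′ (from ∘ g) (f ∘ to) (λ i → trans (cong from (gf (to i))) (from∘to i))
                                    (λ i → trans (cong f (to∘from (g i))) (fg i))))
      (∑ᶻ.sum-cong-≗ (λ i → cong h (to∘from (g i))))

-- The order of the generator and discrete logarithms.

module PrimitiveElement {n : ℕ} (F : FiniteField n) (M : ℕ) (n≡1+M : n ≡ suc M) (2≤M : 2 ≤ M)
                        (γ : FiniteField.Carrier F) (γ-generates : FiniteField.IsPrimitive F γ) where
  open FieldProperties F

  private instance
    M-nonZero : NonZero M
    M-nonZero = ℕ.>-nonZero (ℕₚ.≤-trans (s≤s z≤n) 2≤M)

  -- Among the powers of 0 only the zeroth is nonzero, so a vanishing generator would leave just the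
  -- elements 0 and 1, against `2 ≤ M`.
  γ≢0 : ¬ γ ≡ 0#
  γ≢0 refl = ℕₚ.<⇒≱ (s≤s 2≤M) (subst (_≤ 2) n≡1+M (card≤ f inj))
    where
    nonzero⇒1 : ∀ x → ¬ x ≡ 0# → x ≡ 1#
    nonzero⇒1 x x≢0 with γ-generates x x≢0
    ... | zero  , e = e
    ... | suc k , e = ⊥-elim (x≢0 (trans e (R.zeroˡ _)))
    f : Carrier → Fin 2
    f x = if does (x ≟ᶠ 0#) then Fin.zero else Fin.suc Fin.zero
    f-0 : ∀ {x} → x ≡ 0# → f x ≡ Fin.zero
    f-0 {x} e rewrite dec-true (x ≟ᶠ 0#) e = refl
    f-1 : ∀ {x} → ¬ x ≡ 0# → f x ≡ Fin.suc Fin.zero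
    f-1 {x} ne rewrite dec-false (x ≟ᶠ 0#) ne = refl
    inj : ∀ x y → f x ≡ f y → x ≡ y
    inj x y e with toSum (x ≟ᶠ 0#) | toSum (y ≟ᶠ 0#)
    ... | inj₁ x≡0 | inj₁ y≡0 = trans x≡0 (sym y≡0)
    ... | inj₁ x≡0 | inj₂ y≢0 with () ← trans (sym (f-0 x≡0)) (trans e (f-1 y≢0))
    ... | inj₂ x≢0 | inj₁ y≡0 with () ← trans (sym (f-1 x≢0)) (trans e (f-0 y≡0))
    ... | inj₂ x≢0 | inj₂ y≢0 = trans (nonzero⇒1 x x≢0) (sym (nonzero⇒1 y y≢0))

  γ^≢0 : ∀ k → ¬ γ ^ᶠ k ≡ 0#
  γ^≢0 k = ^-≢0 k γ≢0

  γ^-mod : ∀ d .{{_ : NonZero d}} → γ ^ᶠ d ≡ 1# → ∀ k → γ ^ᶠ (k % d) ≡ γ ^ᶠ k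
  γ^-mod d e k = sym (begin
    γ ^ᶠ k ≡⟨ cong (γ ^ᶠ_) (DivMod.m≡m%n+[m/n]*n k d) ⟩
    γ ^ᶠ (k % d + k / d * d) ≡⟨ ^-+ γ (k % d) _ ⟩
    γ ^ᶠ (k % d) *ᶠ γ ^ᶠ (k / d * d)
      ≡⟨ cong (γ ^ᶠ (k % d) *ᶠ_) (trans (^-*′ γ (k / d) d) (trans (cong (_^ᶠ (k / d)) e) (1^ (k / d)))) ⟩
    γ ^ᶠ (k % d) *ᶠ 1# ≡⟨ R.*-identityʳ _ ⟩
    γ ^ᶠ (k % d) ∎)

  -- If the powers repeat after `d` steps, then 0 together with the first `d` powers already
  -- exhausts the field, so it has at most d + 1 elements.
  order≥M : ∀ d .{{_ : NonZero d}} → γ ^ᶠ d ≡ 1# → M ≤ d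
  order≥M d e = ℕ.s≤s⁻¹ (subst (_≤ suc d) n≡1+M (card≤ f λ x y eq → trans (sym (gf x)) (trans (cong g eq) (gf y))))
    where
    g : Fin (suc d) → Carrier
    g Fin.zero    = 0#
    g (Fin.suc i) = γ ^ᶠ toℕ i
    f′ : ∀ x → x ≡ 0# ⊎ ¬ x ≡ 0# → Σ (Fin (suc d)) (λ i → g i ≡ x)
    f′ x (inj₁ x≡0) = Fin.zero , sym x≡0
    f′ x (inj₂ x≢0) with γ-generates x x≢0
    ... | k , x≡γ^k = Fin.suc (k mod d) , trans (cong (γ ^ᶠ_) (Finₚ.toℕ-fromℕ< (DivMod.m%n<n k d))) (trans (γ^-mod d e k) (sym x≡γ^k))
    f : Carrier → Fin (suc d)
    f x = proj₁ (f′ x (toSum (x ≟ᶠ 0#)))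
    gf : ∀ x → g (f x) ≡ x
    gf x = proj₂ (f′ x (toSum (x ≟ᶠ 0#)))

  γ^-∸ : ∀ {i j} → i ≤ j → γ ^ᶠ i ≡ γ ^ᶠ j → γ ^ᶠ (j ∸ i) ≡ 1#
  γ^-∸ {i} {j} i≤j e = *-cancelˡ (γ^≢0 i) (begin
    γ ^ᶠ i *ᶠ γ ^ᶠ (j ∸ i) ≡⟨ ^-+ γ i (j ∸ i) ⟨
    γ ^ᶠ (i + (j ∸ i)) ≡⟨ cong (γ ^ᶠ_) (ℕₚ.m+[n∸m]≡n i≤j) ⟩
    γ ^ᶠ j ≡⟨ e ⟨
    γ ^ᶠ i ≡⟨ R.*-identityʳ _ ⟨
    γ ^ᶠ i *ᶠ 1# ∎)

  -- Pigeonhole among 0 and the first `n` powers yields an exponent `d` between 1 and `M` with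
  -- trivial power; `order≥M` leaves only d = M.
  γ^M≡1 : γ ^ᶠ M ≡ 1#
  γ^M≡1 with collision (ℕₚ.n<1+n n) g
    where
    g : Fin (suc n) → Carrier
    g Fin.zero    = 0#
    g (Fin.suc i) = γ ^ᶠ toℕ i
  ... | Fin.zero  , Fin.suc j , _   , e = ⊥-elim (γ^≢0 (toℕ j) (sym e))
  ... | Fin.suc i , Fin.suc j , s≤s i<j , e =
    subst (λ d → γ ^ᶠ d ≡ 1#) (ℕₚ.≤-antisym d≤M (order≥M d {{ℕ.>-nonZero 0<d}} γ^d≡1)) γ^d≡1
    where
    d = toℕ j ∸ toℕ i
    0<d : 0 < d
    0<d = ℕₚ.m<n⇒0<n∸m i<j
    γ^d≡1 : γ ^ᶠ d ≡ 1#
    γ^d≡1 = γ^-∸ (ℕₚ.<⇒≤ i<j) e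
    d≤M : d ≤ M
    d≤M = ℕₚ.≤-trans (ℕₚ.m∸n≤m (toℕ j) (toℕ i)) (ℕ.s≤s⁻¹ (subst (toℕ j <_) n≡1+M (Finₚ.toℕ<n j)))

  γ^-≡1⇒M∣ : ∀ k → γ ^ᶠ k ≡ 1# → M ∣ k
  γ^-≡1⇒M∣ k e = Div.m%n≡0⇒n∣m k M (go (k % M) refl)
    where
    go : ∀ r → r ≡ k % M → k % M ≡ 0
    go zero    eq = sym eq
    go (suc r) eq = ⊥-elim (ℕₚ.<⇒≱ (subst (_< M) (sym eq) (DivMod.m%n<n k M))
      (order≥M (suc r) (trans (cong (γ ^ᶠ_) eq) (trans (γ^-mod M γ^M≡1 k) e))))

  γ^-injective : ∀ {i j} → i < M → j < M → γ ^ᶠ i ≡ γ ^ᶠ j → i ≡ j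
  γ^-injective {i} {j} i<M j<M e with ℕₚ.≤-total i j
  ... | inj₁ i≤j = lem i≤j j<M e
    where
    lem : ∀ {i j} → i ≤ j → j < M → γ ^ᶠ i ≡ γ ^ᶠ j → i ≡ j
    lem {i} {j} i≤j j<M e with ℕₚ.m≤n⇒m<n∨m≡n i≤j
    ... | inj₂ i≡j = i≡j
    ... | inj₁ i<j = ⊥-elim (ℕₚ.<⇒≱ (ℕₚ.≤-<-trans (ℕₚ.m∸n≤m j i) j<M)
                       (order≥M (j ∸ i) {{ℕ.>-nonZero (ℕₚ.m<n⇒0<n∸m i<j)}} (γ^-∸ i≤j e)))
  ... | inj₂ j≤i with ℕₚ.m≤n⇒m<n∨m≡n j≤i
  ...   | inj₂ j≡i = sym j≡i
  ...   | inj₁ j<i = ⊥-elim (ℕₚ.<⇒≱ (ℕₚ.≤-<-trans (ℕₚ.m∸n≤m i j) i<M)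
                       (order≥M (i ∸ j) {{ℕ.>-nonZero (ℕₚ.m<n⇒0<n∸m j<i)}} (γ^-∸ j≤i (sym e))))

  log : ∀ {x} → ¬ x ≡ 0# → Σ ℕ (λ i → i < M × x ≡ γ ^ᶠ i)
  log {x} x≢0 with γ-generates x x≢0
  ... | k , e = k % M , DivMod.m%n<n k M , trans e (sym (γ^-mod M γ^M≡1 k))

  x^M≡1 : ∀ {x} → ¬ x ≡ 0# → x ^ᶠ M ≡ 1#
  x^M≡1 x≢0 with log x≢0
  ... | i , _ , refl = trans (^-comm γ i M) (trans (cong (_^ᶠ i) γ^M≡1) (1^ i))

  x^n≡x : ∀ x → x ^ᶠ n ≡ x
  x^n≡x x = trans (cong (x ^ᶠ_) n≡1+M) (go (toSum (x ≟ᶠ 0#)))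
    where
    go : x ≡ 0# ⊎ ¬ x ≡ 0# → x ^ᶠ suc M ≡ x
    go (inj₁ refl) = R.zeroˡ _
    go (inj₂ x≢0)  = trans (cong (x *ᶠ_) (x^M≡1 x≢0)) (R.*-identityʳ x)

  ∑-log : ∀ g → ∑ g ≡ g 0# +ᶻ range M (λ i → g (γ ^ᶠ i))
  ∑-log g = trans (∑-reindex power index power∘index index∘power g)
                  (cong (g 0# +ᶻ_) (range-sum M (λ i → g (γ ^ᶠ i))))
    where
    power : Fin (suc M) → Carrier
    power Fin.zero    = 0#
    power (Fin.suc i) = γ ^ᶠ toℕ i
    index′ : ∀ x → x ≡ 0# ⊎ ¬ x ≡ 0# → Σ (Fin (suc M)) (λ i → power i ≡ x)
    index′ x (inj₁ x≡0) = Fin.zero , sym x≡0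
    index′ x (inj₂ x≢0) with log x≢0
    ... | k , k<M , e = Fin.suc (fromℕ< k<M) , trans (cong (γ ^ᶠ_) (Finₚ.toℕ-fromℕ< k<M)) (sym e)
    index : Carrier → Fin (suc M)
    index x = proj₁ (index′ x (toSum (x ≟ᶠ 0#)))
    power∘index : ∀ x → power (index x) ≡ x
    power∘index x = proj₂ (index′ x (toSum (x ≟ᶠ 0#)))
    power-injective : ∀ i j → power i ≡ power j → i ≡ j
    power-injective Fin.zero    Fin.zero    e = refl
    power-injective Fin.zero    (Fin.suc j) e = ⊥-elim (γ^≢0 (toℕ j) (sym e))
    power-injective (Fin.suc i) Fin.zero    e = ⊥-elim (γ^≢0 (toℕ i) e)
    power-injective (Fin.suc i) (Fin.suc j) e =
      cong Fin.suc (Finₚ.toℕ-injective (γ^-injective (Finₚ.toℕ<n i) (Finₚ.toℕ<n j) e))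
    index∘power : ∀ i → index (power i) ≡ i
    index∘power i = power-injective _ _ (power∘index (power i))

-- Binomial coefficients modulo a prime.

prime∤! : ∀ {p j} → Prime p → j < p → ¬ p ∣ j !
prime∤! {p} {zero}  p-prime j<p p∣1 =
  ℕₚ.<⇒≱ (ℕ.nonTrivial⇒n>1 p {{Primality.prime⇒nonTrivial p-prime}}) (Div.∣⇒≤ p∣1)
prime∤! {p} {suc j} p-prime j<p p∣[1+j]! with Primality.euclidsLemma (suc j) (j !) p-prime p∣[1+j]!
... | inj₁ p∣1+j = ℕₚ.<⇒≱ j<p (Div.∣⇒≤ p∣1+j)
... | inj₂ p∣j!  = prime∤! p-prime (ℕₚ.<-trans (ℕₚ.n<1+n j) j<p) p∣j!

-- The prime divides p! = C(p,k) k! (p-k)! but neither of the two factorials, whose arguments are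
-- smaller than `p`.
p∣pCk : ∀ {p k} → Prime p → 0 < k → k < p → p ∣ p C k
p∣pCk {p@(suc p-1)} {k} p-prime 0<k k<p with Primality.euclidsLemma (p C k) (k ! * (p ∸ k) !) p-prime
    (subst (p ∣_) (sym C*k![p∸k]!≡p!) (Div.m∣m*n (p-1 !)))
  where
  C*k![p∸k]!≡p! : (p C k) * (k ! * (p ∸ k) !) ≡ p !
  C*k![p∸k]!≡p! = trans (cong (_* (k ! * (p ∸ k) !)) (Comb.nCk≡n!/k![n-k]! (ℕₚ.<⇒≤ k<p)))
    (DivMod.m/n*n≡m {{k ℕₚ.!* (p ∸ k) !≢0}} (Comb.k![n∸k]!∣n! (ℕₚ.<⇒≤ k<p)))
... | inj₁ p∣C = p∣C
... | inj₂ p∣k![p∸k]! with Primality.euclidsLemma (k !) ((p ∸ k) !) p-prime p∣k![p∸k]!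
...   | inj₁ p∣k! = ⊥-elim (prime∤! p-prime k<p p∣k!)
...   | inj₂ p∣[p∸k]! = ⊥-elim (prime∤! p-prime (ℕₚ.∸-monoʳ-< 0<k (ℕₚ.<⇒≤ k<p)) p∣[p∸k]!)

-- Field-valued finite sums and geometric series.

module SumTo {n : ℕ} (F : FiniteField n) where
  open FieldProperties F

  sumTo-cong : ∀ k {f g : ℕ → Carrier} → (∀ i → i < k → f i ≡ g i) → sumTo k f ≡ sumTo k g
  sumTo-cong zero    e = refl
  sumTo-cong (suc k) e = cong₂ _+ᶠ_ (sumTo-cong k (λ i i<k → e i (ℕₚ.m<n⇒m<1+n i<k))) (e k (ℕₚ.n<1+n k))

  sumTo-hom : (φ : Carrier → Carrier) → φ 0# ≡ 0# → (∀ x y → φ (x +ᶠ y) ≡ φ x +ᶠ φ y) →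
              ∀ k f → φ (sumTo k f) ≡ sumTo k (φ ∘ f)
  sumTo-hom φ φ0 φ+ zero    f = φ0
  sumTo-hom φ φ0 φ+ (suc k) f = trans (φ+ _ _) (cong (_+ᶠ φ (f k)) (sumTo-hom φ φ0 φ+ k f))

  sumTo-*ˡ : ∀ c k f → c *ᶠ sumTo k f ≡ sumTo k (λ i → c *ᶠ f i)
  sumTo-*ˡ c = sumTo-hom (c *ᶠ_) (R.zeroʳ c) (R.distribˡ c)

  +ᶠ-interchange : ∀ a b c d → (a +ᶠ b) +ᶠ (c +ᶠ d) ≡ (a +ᶠ c) +ᶠ (b +ᶠ d)
  +ᶠ-interchange a b c d = begin
    (a +ᶠ b) +ᶠ (c +ᶠ d) ≡⟨ R.+-assoc a b _ ⟩
    a +ᶠ (b +ᶠ (c +ᶠ d)) ≡⟨ cong (a +ᶠ_) (R.+-assoc b c d) ⟨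
    a +ᶠ ((b +ᶠ c) +ᶠ d) ≡⟨ cong (λ z → a +ᶠ (z +ᶠ d)) (R.+-comm b c) ⟩
    a +ᶠ ((c +ᶠ b) +ᶠ d) ≡⟨ cong (a +ᶠ_) (R.+-assoc c b d) ⟩
    a +ᶠ (c +ᶠ (b +ᶠ d)) ≡⟨ R.+-assoc a c _ ⟨
    (a +ᶠ c) +ᶠ (b +ᶠ d) ∎

  sumTo-+ : ∀ k f g → sumTo k (λ i → f i +ᶠ g i) ≡ sumTo k f +ᶠ sumTo k g
  sumTo-+ zero    f g = sym (R.+-identityˡ 0#)
  sumTo-+ (suc k) f g = trans (cong (_+ᶠ (f k +ᶠ g k)) (sumTo-+ k f g)) (+ᶠ-interchange _ _ _ _)

  sumTo-0 : ∀ k → sumTo k (λ _ → 0#) ≡ 0#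
  sumTo-0 zero    = refl
  sumTo-0 (suc k) = trans (R.+-identityʳ _) (sumTo-0 k)

  sumTo-swap : ∀ a b (f : ℕ → ℕ → Carrier) →
               sumTo a (λ i → sumTo b (f i)) ≡ sumTo b (λ j → sumTo a (λ i → f i j))
  sumTo-swap zero    b f = sym (sumTo-0 b)
  sumTo-swap (suc a) b f = trans (cong (_+ᶠ sumTo b (f a)) (sumTo-swap a b f)) (sym (sumTo-+ b _ (f a)))

  sumTo-suc : ∀ k f → sumTo (suc k) f ≡ f 0 +ᶠ sumTo k (f ∘ suc)
  sumTo-suc zero    f = R.+-comm 0# (f 0)
  sumTo-suc (suc k) f = trans (cong (_+ᶠ f (suc k)) (sumTo-suc k f)) (R.+-assoc _ _ _)

  sumTo-split : ∀ a b f → sumTo (a + b) f ≡ sumTo a f +ᶠ sumTo b (λ i → f (a + i))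
  sumTo-split a zero    f = trans (cong (λ k → sumTo k f) (ℕₚ.+-identityʳ a)) (sym (R.+-identityʳ _))
  sumTo-split a (suc b) f = begin
    sumTo (a + suc b) f ≡⟨ cong (λ k → sumTo k f) (ℕₚ.+-suc a b) ⟩
    sumTo (a + b) f +ᶠ f (a + b) ≡⟨ cong (_+ᶠ f (a + b)) (sumTo-split a b f) ⟩
    sumTo a f +ᶠ sumTo b (λ i → f (a + i)) +ᶠ f (a + b) ≡⟨ R.+-assoc _ _ _ ⟩
    sumTo a f +ᶠ (sumTo b (λ i → f (a + i)) +ᶠ f (a + b)) ∎

  sumTo-blocks : ∀ a b f → sumTo (a * b) f ≡ sumTo a (λ i → sumTo b (λ j → f (i * b + j)))
  sumTo-blocks zero    b f = refl
  sumTo-blocks (suc a) b f = begin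
    sumTo (b + a * b) f ≡⟨ cong (λ k → sumTo k f) (ℕₚ.+-comm b (a * b)) ⟩
    sumTo (a * b + b) f ≡⟨ sumTo-split (a * b) b f ⟩
    sumTo (a * b) f +ᶠ sumTo b (λ j → f (a * b + j))
      ≡⟨ cong (_+ᶠ sumTo b (λ j → f (a * b + j))) (sumTo-blocks a b f) ⟩
    sumTo (suc a) (λ i → sumTo b (λ j → f (i * b + j))) ∎

  geometric : ∀ c k → c *ᶠ sumTo k (c ^ᶠ_) +ᶠ 1# ≡ sumTo k (c ^ᶠ_) +ᶠ c ^ᶠ k
  geometric c zero    = cong (_+ᶠ 1#) (R.zeroʳ c)
  geometric c (suc k) = begin
    c *ᶠ (sumTo k (c ^ᶠ_) +ᶠ c ^ᶠ k) +ᶠ 1# ≡⟨ cong (_+ᶠ 1#) (R.distribˡ c _ _) ⟩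
    c *ᶠ sumTo k (c ^ᶠ_) +ᶠ c *ᶠ c ^ᶠ k +ᶠ 1# ≡⟨ R.+-assoc _ _ _ ⟩
    c *ᶠ sumTo k (c ^ᶠ_) +ᶠ (c *ᶠ c ^ᶠ k +ᶠ 1#) ≡⟨ cong (c *ᶠ sumTo k (c ^ᶠ_) +ᶠ_) (R.+-comm _ 1#) ⟩
    c *ᶠ sumTo k (c ^ᶠ_) +ᶠ (1# +ᶠ c *ᶠ c ^ᶠ k) ≡⟨ R.+-assoc _ _ _ ⟨
    c *ᶠ sumTo k (c ^ᶠ_) +ᶠ 1# +ᶠ c *ᶠ c ^ᶠ k ≡⟨ cong (_+ᶠ c *ᶠ c ^ᶠ k) (geometric c k) ⟩
    sumTo k (c ^ᶠ_) +ᶠ c ^ᶠ k +ᶠ c *ᶠ c ^ᶠ k ∎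

  -- Multiplication by `c` only shifts the series cyclically, so c S = S, and a nonzero S could be
  -- cancelled to give c = 1.
  geometric≡0 : ∀ c k → ¬ c ≡ 1# → c ^ᶠ k ≡ 1# → sumTo k (c ^ᶠ_) ≡ 0#
  geometric≡0 c k c≢1 c^k≡1 with toSum (sumTo k (c ^ᶠ_) ≟ᶠ 0#)
  ... | inj₁ e = e
  ... | inj₂ ne = ⊥-elim (c≢1 (*-cancelˡ ne (begin
    S *ᶠ c ≡⟨ R.*-comm S c ⟩
    c *ᶠ S ≡⟨ Rₚ.+-cancelʳ 1# _ _ (trans (geometric c k) (cong (S +ᶠ_) c^k≡1)) ⟩
    S ≡⟨ R.*-identityʳ S ⟨
    S *ᶠ 1# ∎)))
    where S = sumTo k (c ^ᶠ_)

  sumTo-1 : ∀ k → sumTo k (λ _ → 1#) ≡ k Multᶠ.× 1#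
  sumTo-1 zero    = refl
  sumTo-1 (suc k) = trans (R.+-comm _ 1#) (cong (1# +ᶠ_) (sumTo-1 k))

-- Characteristic p, the Frobenius map, and transitivity of the trace.

module Frobenius {n : ℕ} (F : FiniteField n) (p d : ℕ) (p-prime : Prime p) (n≡p^d : n ≡ p ^ d) where
  open FieldProperties F
  open SumTo F

  -- The element n × 1 is the `d`-th power of p × 1 and vanishes; a field has no zero divisors.
  p×1≡0 : p Multᶠ.× 1# ≡ 0#
  p×1≡0 = go d (subst (λ k → k Multᶠ.× 1# ≡ 0#) n≡p^d n×1≡0)
    where
    go : ∀ d → (p ^ d) Multᶠ.× 1# ≡ 0# → p Multᶠ.× 1# ≡ 0#
    go zero    e = ⊥-elim (1≢0 (trans (sym (R.+-identityʳ 1#)) e))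
    go (suc d) e with toSum (p Multᶠ.× 1# ≟ᶠ 0#)
    ... | inj₁ e′ = e′
    ... | inj₂ ne = go d (x*y≡0⇒y≡0 ne (trans (sym (Multᶠ.×1-homo-* p (p ^ d))) e))

  p∣⇒×≡0 : ∀ {k} x → p ∣ k → k Multᶠ.× x ≡ 0#
  p∣⇒×≡0 x (divides c refl) = begin
    (c * p) Multᶠ.× x ≡⟨ cong ((c * p) Multᶠ.×_) (R.*-identityˡ x) ⟨
    (c * p) Multᶠ.× (1# *ᶠ x) ≡⟨ Multᶠ.×-assoc-* (c * p) 1# x ⟨
    ((c * p) Multᶠ.× 1#) *ᶠ x
      ≡⟨ cong (_*ᶠ x) (trans (Multᶠ.×1-homo-* c p) (trans (cong (c Multᶠ.× 1# *ᶠ_) p×1≡0) (R.zeroʳ _))) ⟩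
    0# *ᶠ x ≡⟨ R.zeroˡ x ⟩
    0# ∎

  frobenius : ∀ x y → (x +ᶠ y) ^ᶠ p ≡ x ^ᶠ p +ᶠ y ^ᶠ p
  frobenius x y = go p refl
    where
    open Binomial R.commutativeSemiring using (theorem; binomialTerm)
    go : ∀ p′ → p ≡ p′ → (x +ᶠ y) ^ᶠ p ≡ x ^ᶠ p +ᶠ y ^ᶠ p
    go zero refl     = ⊥-elim (Primality.¬prime[0] p-prime)
    go (suc p′) refl = begin
      (x +ᶠ y) ^ᶠ p ≡⟨ ^ᶠ≡exp _ p ⟩
      (x +ᶠ y) Expᶠ.^ p ≡⟨ theorem p x y ⟩
      t Fin.zero +ᶠ ∑ᶠ.sum (t ∘ Fin.suc) ≡⟨ cong₂ _+ᶠ_ t₀ (∑ᶠ.sum-init-last (t ∘ Fin.suc)) ⟩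
      y ^ᶠ p +ᶠ (∑ᶠ.sum (λ i → t (Fin.suc (Fin.inject₁ i))) +ᶠ t (Fin.suc (Fin.fromℕ p′)))
        ≡⟨ cong (y ^ᶠ p +ᶠ_) (cong₂ _+ᶠ_ (trans (∑ᶠ.sum-cong-≗ middle) (∑ᶠ.sum-replicate-zero p′)) tₚ) ⟩
      y ^ᶠ p +ᶠ (0# +ᶠ x ^ᶠ p) ≡⟨ cong (y ^ᶠ p +ᶠ_) (R.+-identityˡ _) ⟩
      y ^ᶠ p +ᶠ x ^ᶠ p ≡⟨ R.+-comm _ _ ⟩
      x ^ᶠ p +ᶠ y ^ᶠ p ∎
      where
      t = binomialTerm x y p
      t₀ : t Fin.zero ≡ y ^ᶠ p
      t₀ = trans (Multᶠ.×-homo-1 _) (trans (R.*-identityˡ _) (sym (^ᶠ≡exp y p)))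
      tₚ : t (Fin.suc (Fin.fromℕ p′)) ≡ x ^ᶠ p
      tₚ rewrite Finₚ.toℕ-fromℕ p′ | Comb.nCn≡1 p | ℕₚ.n∸n≡0 p′ =
        trans (Multᶠ.×-homo-1 _) (trans (R.*-identityʳ _) (sym (^ᶠ≡exp x p)))
      middle : ∀ i → t (Fin.suc (Fin.inject₁ i)) ≡ 0#
      middle i = p∣⇒×≡0 _ (p∣pCk p-prime (s≤s z≤n) (s≤s (subst (_< p′) (sym (Finₚ.toℕ-inject₁ i)) (Finₚ.toℕ<n i))))

  frobenius^ : ∀ k x y → (x +ᶠ y) ^ᶠ (p ^ k) ≡ x ^ᶠ (p ^ k) +ᶠ y ^ᶠ (p ^ k)
  frobenius^ zero    x y = trans (R.*-identityʳ _) (sym (cong₂ _+ᶠ_ (R.*-identityʳ x) (R.*-identityʳ y)))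
  frobenius^ (suc k) x y = begin
    (x +ᶠ y) ^ᶠ (p * p ^ k) ≡⟨ ^-* _ p (p ^ k) ⟩
    ((x +ᶠ y) ^ᶠ p) ^ᶠ (p ^ k) ≡⟨ cong (_^ᶠ (p ^ k)) (frobenius x y) ⟩
    (x ^ᶠ p +ᶠ y ^ᶠ p) ^ᶠ (p ^ k) ≡⟨ frobenius^ k _ _ ⟩
    (x ^ᶠ p) ^ᶠ (p ^ k) +ᶠ (y ^ᶠ p) ^ᶠ (p ^ k) ≡⟨ cong₂ _+ᶠ_ (sym (^-* x p _)) (sym (^-* y p _)) ⟩
    x ^ᶠ (p * p ^ k) +ᶠ y ^ᶠ (p * p ^ k) ∎

  1≤p^ : ∀ k → 1 ≤ p ^ k
  1≤p^ k = ℕₚ.m^n>0 p {{Primality.prime⇒nonZero p-prime}} k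

  -- Each k < m e is uniquely i e + j with j < e. Summing over i first leaves a sum of powers with
  -- common outer exponent p^j, which additivity of Frobenius pulls out.
  Tr-transitive : ∀ e m x → Tr p (m * e) x ≡ Tr p e (Tr (p ^ e) m x)
  Tr-transitive e m x = begin
    sumTo (m * e) (λ k → x ^ᶠ (p ^ k)) ≡⟨ sumTo-blocks m e _ ⟩
    sumTo m (λ i → sumTo e (λ j → x ^ᶠ (p ^ (i * e + j)))) ≡⟨ sumTo-swap m e _ ⟩
    sumTo e (λ j → sumTo m (λ i → x ^ᶠ (p ^ (i * e + j)))) ≡⟨ sumTo-cong e (λ j _ → trans
          (sumTo-cong m (λ i _ → split i j))
          (sym (sumTo-hom (_^ᶠ (p ^ j)) (0^ (1≤p^ j)) (frobenius^ j) m _))) ⟩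
    sumTo e (λ j → sumTo m (λ i → x ^ᶠ ((p ^ e) ^ i)) ^ᶠ (p ^ j)) ∎
    where
    split : ∀ i j → x ^ᶠ (p ^ (i * e + j)) ≡ (x ^ᶠ ((p ^ e) ^ i)) ^ᶠ (p ^ j)
    split i j = trans (cong (x ^ᶠ_) (trans (ℕₚ.^-distribˡ-+-* p (i * e) j)
      (cong (_* p ^ j) (trans (cong (p ^_) (ℕₚ.*-comm i e)) (sym (ℕₚ.^-*-assoc p e i)))))) (^-* x ((p ^ e) ^ i) (p ^ j))

-- The subfield of order q, whose nonzero elements are the powers of `γ ^ h`, with its trace and
-- hyperplanes.

module Subfield {n : ℕ} (F : FiniteField n) (M : ℕ) (n≡1+M : n ≡ suc M) (2≤M : 2 ≤ M)
                (γ : FiniteField.Carrier F) (γ-generates : FiniteField.IsPrimitive F γ)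
                (q m h : ℕ) (2≤q : 2 ≤ q) (1≤m : 1 ≤ m) (n≡q^m : n ≡ q ^ m) (M≡h*[q-1] : M ≡ h * (q ∸ 1))
                (frobenius-q : FieldProperties.FrobeniusAdditive F q) where
  open FieldProperties F
  open SumTo F
  open PrimitiveElement F M n≡1+M 2≤M γ γ-generates

  1≤q : 1 ≤ q
  1≤q = ℕₚ.≤-trans (s≤s z≤n) 2≤q

  q≡1+[q-1] : q ≡ suc (q ∸ 1)
  q≡1+[q-1] = sym (ℕₚ.m+[n∸m]≡n 1≤q)

  private
    instance
      q-1-nonZero : NonZero (q ∸ 1)
      q-1-nonZero = ℕ.>-nonZero (ℕₚ.m<n⇒0<n∸m 2≤q)

  1≤h : 1 ≤ h
  1≤h = ℕₚ.n≢0⇒n>0 λ h≡0 → ℕₚ.<⇒≢ (ℕₚ.≤-trans (s≤s z≤n) 2≤M) (sym (trans M≡h*[q-1] (cong (_* (q ∸ 1)) h≡0)))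

  Fq : Carrier → Set
  Fq x = InSubfield q x

  x^q≡x*x^[q-1] : ∀ x → x ^ᶠ q ≡ x *ᶠ x ^ᶠ (q ∸ 1)
  x^q≡x*x^[q-1] x = cong (x ^ᶠ_) q≡1+[q-1]

  Fq-0 : Fq 0#
  Fq-0 = 0^ 1≤q

  Fq-1 : Fq 1#
  Fq-1 = 1^ q

  Fq-+ : ∀ {x y} → Fq x → Fq y → Fq (x +ᶠ y)
  Fq-+ {x} {y} x∈ y∈ = trans (frobenius-q x y) (cong₂ _+ᶠ_ x∈ y∈)

  Fq-* : ∀ {x y} → Fq x → Fq y → Fq (x *ᶠ y)
  Fq-* {x} {y} x∈ y∈ = trans (*-^ x y q) (cong₂ _*ᶠ_ x∈ y∈)

  Fq-neg : ∀ {x} → Fq x → Fq (-ᶠ x)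
  Fq-neg {x} x∈ = Rₚ.+-cancelˡ x _ _ (begin
    x +ᶠ (-ᶠ x) ^ᶠ q ≡⟨ cong (_+ᶠ (-ᶠ x) ^ᶠ q) x∈ ⟨
    x ^ᶠ q +ᶠ (-ᶠ x) ^ᶠ q ≡⟨ frobenius-q x (-ᶠ x) ⟨
    (x -ᶠ x) ^ᶠ q ≡⟨ cong (_^ᶠ q) (R.-‿inverseʳ x) ⟩
    0# ^ᶠ q ≡⟨ Fq-0 ⟩
    0# ≡⟨ R.-‿inverseʳ x ⟨
    x -ᶠ x ∎)

  Fq-inverse : ∀ {x y} → ¬ x ≡ 0# → x *ᶠ y ≡ 1# → Fq x → Fq y
  Fq-inverse {x} {y} x≢0 xy≡1 x∈ = *-cancelˡ x≢0 (begin
    x *ᶠ y ^ᶠ q ≡⟨ cong (_*ᶠ y ^ᶠ q) x∈ ⟨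
    x ^ᶠ q *ᶠ y ^ᶠ q ≡⟨ *-^ x y q ⟨
    (x *ᶠ y) ^ᶠ q ≡⟨ cong (_^ᶠ q) xy≡1 ⟩
    1# ^ᶠ q ≡⟨ 1^ q ⟩
    1# ≡⟨ xy≡1 ⟨
    x *ᶠ y ∎)

  Fq⇒^[q-1]≡1 : ∀ {x} → ¬ x ≡ 0# → Fq x → x ^ᶠ (q ∸ 1) ≡ 1#
  Fq⇒^[q-1]≡1 {x} x≢0 x∈ = *-cancelˡ x≢0 (trans (sym (x^q≡x*x^[q-1] x)) (trans x∈ (sym (R.*-identityʳ x))))

  ^[q-1]≡1⇒Fq : ∀ {x} → x ^ᶠ (q ∸ 1) ≡ 1# → Fq x
  ^[q-1]≡1⇒Fq {x} e = trans (x^q≡x*x^[q-1] x) (trans (cong (x *ᶠ_) e) (R.*-identityʳ x))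

  Fq-γ^h : Fq (γ ^ᶠ h)
  Fq-γ^h = ^[q-1]≡1⇒Fq (trans (sym (^-* γ h (q ∸ 1))) (trans (cong (γ ^ᶠ_) (sym M≡h*[q-1])) γ^M≡1))

  Fq-γ^⇒h∣ : ∀ i → Fq (γ ^ᶠ i) → h ∣ i
  Fq-γ^⇒h∣ i γ^i∈ = Div.*-cancelʳ-∣ (q ∸ 1) (subst (_∣ i * (q ∸ 1)) M≡h*[q-1]
    (γ^-≡1⇒M∣ (i * (q ∸ 1)) (trans (^-* γ i (q ∸ 1)) (Fq⇒^[q-1]≡1 (γ^≢0 i) γ^i∈))))

  Fq-log : ∀ {x} → ¬ x ≡ 0# → Fq x → Σ ℕ (λ k → x ≡ γ ^ᶠ (h * k))
  Fq-log x≢0 x∈ with log x≢0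
  ... | i , _ , refl with Fq-γ^⇒h∣ i x∈
  ...   | divides k e = k , cong (γ ^ᶠ_) (trans e (ℕₚ.*-comm k h))

  ι : Carrier → ℤ
  ι a = δ (a ^ᶠ q -ᶠ a)

  ι-∈ : ∀ {a} → Fq a → ι a ≡ 1ℤ
  ι-∈ {a} a∈ = δ-≡0 (trans (cong (_-ᶠ a) a∈) (R.-‿inverseʳ a))

  ι-∉ : ∀ {a} → ¬ Fq a → ι a ≡ 0ℤ
  ι-∉ a∉ = δ-≢0 (a∉ ∘ x-y≡0⇒x≡y)

  ι-*-cong : ∀ a {x y} → (Fq a → x ≡ y) → ι a *ᶻ x ≡ ι a *ᶻ y
  ι-*-cong a f = δ-*-cong _ (f ∘ x-y≡0⇒x≡y)

  -- In terms of exponents, membership has period `h` and a period contains the single member i = 0.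
  -- The q - 1 periods below `M` contribute one each, and the element 0 is the last one.
  ∑-ι : ∑ ι ≡ pos q
  ∑-ι = begin
    ∑ ι ≡⟨ ∑-log ι ⟩
    ι 0# +ᶻ range M (λ i → ι (γ ^ᶠ i))
      ≡⟨ cong₂ _+ᶻ_ (ι-∈ Fq-0) (trans (cong (λ k → range k (λ i → ι (γ ^ᶠ i))) (trans M≡h*[q-1] (ℕₚ.*-comm h (q ∸ 1))))
          (range-periodic h (q ∸ 1) _ period)) ⟩
    1ℤ +ᶻ pos (q ∸ 1) *ᶻ range h (λ i → ι (γ ^ᶠ i)) ≡⟨ cong (λ z → 1ℤ +ᶻ pos (q ∸ 1) *ᶻ z) block ⟩
    1ℤ +ᶻ pos (q ∸ 1) *ᶻ 1ℤ ≡⟨ cong (1ℤ +ᶻ_) (ℤₚ.*-identityʳ (pos (q ∸ 1))) ⟩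
    pos (suc (q ∸ 1)) ≡⟨ cong pos q≡1+[q-1] ⟨
    pos q ∎
    where
    period : ∀ i → ι (γ ^ᶠ (h + i)) ≡ ι (γ ^ᶠ i)
    period i = begin
      ι (γ ^ᶠ (h + i)) ≡⟨ cong ι (^-+ γ h i) ⟩
      δ ((γ ^ᶠ h *ᶠ γ ^ᶠ i) ^ᶠ q -ᶠ γ ^ᶠ h *ᶠ γ ^ᶠ i)
        ≡⟨ cong (λ z → δ (z -ᶠ γ ^ᶠ h *ᶠ γ ^ᶠ i)) (trans (*-^ _ _ q) (cong (_*ᶠ (γ ^ᶠ i) ^ᶠ q) Fq-γ^h)) ⟩
      δ (γ ^ᶠ h *ᶠ (γ ^ᶠ i) ^ᶠ q -ᶠ γ ^ᶠ h *ᶠ γ ^ᶠ i) ≡⟨ cong δ (Rₚ.x[y-z]≈xy-xz (γ ^ᶠ h) _ _) ⟨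
      δ (γ ^ᶠ h *ᶠ ((γ ^ᶠ i) ^ᶠ q -ᶠ γ ^ᶠ i)) ≡⟨ δ-*ˡ _ (γ^≢0 h) ⟩
      ι (γ ^ᶠ i) ∎
    block : range h (λ i → ι (γ ^ᶠ i)) ≡ 1ℤ
    block = go h 1≤h ℕₚ.≤-refl
      where
      go : ∀ k → 1 ≤ k → k ≤ h → range k (λ i → ι (γ ^ᶠ i)) ≡ 1ℤ
      go (suc k) _ k<h = cong₂ _+ᶻ_ (ι-∈ Fq-1) (trans (range-cong k {g = λ _ → 0ℤ} (λ i i<k → ι-∉ (λ ∈ →
        ℕₚ.<⇒≱ (ℕₚ.≤-trans (s≤s i<k) k<h) (Div.∣⇒≤ (Fq-γ^⇒h∣ (suc i) ∈))))) (range-0 k))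

  ∑-ι-* : ∀ (g : Carrier → ℤ) c → (∀ a → ¬ a ≡ 0# → Fq a → g a ≡ c) → ∑ (λ a → ι a *ᶻ g a) ≡ g 0# +ᶻ (pos q -ᶻ 1ℤ) *ᶻ c
  ∑-ι-* g c g≡c = begin
    ∑ (λ a → ι a *ᶻ g a) ≡⟨ ∑-cong (λ a → pointwise a (toSum (a ≟ᶠ 0#))) ⟩
    ∑ (λ a → ι a *ᶻ c +ᶻ δ a *ᶻ (g 0# -ᶻ c)) ≡⟨ ∑-+ _ _ ⟩
    ∑ (λ a → ι a *ᶻ c) +ᶻ ∑ (λ a → δ a *ᶻ (g 0# -ᶻ c))
      ≡⟨ cong₂ _+ᶻ_ (trans (∑-*ʳ c ι) (cong (_*ᶻ c) ∑-ι)) (∑-δ-0 (λ _ → g 0# -ᶻ c)) ⟩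
    pos q *ᶻ c +ᶻ (g 0# -ᶻ c) ≡⟨ rearrange (pos q) c (g 0#) ⟩
    g 0# +ᶻ (pos q -ᶻ 1ℤ) *ᶻ c ∎
    where
    rearrange : ∀ q c g → q *ᶻ c +ᶻ (g -ᶻ c) ≡ g +ᶻ (q -ᶻ 1ℤ) *ᶻ c
    rearrange = solve-∀
    at-0 : ∀ g c → 1ℤ *ᶻ g ≡ 1ℤ *ᶻ c +ᶻ 1ℤ *ᶻ (g -ᶻ c)
    at-0 = solve-∀
    pointwise : ∀ a → a ≡ 0# ⊎ ¬ a ≡ 0# → ι a *ᶻ g a ≡ ι a *ᶻ c +ᶻ δ a *ᶻ (g 0# -ᶻ c)
    pointwise a (inj₁ refl) rewrite ι-∈ Fq-0 | δ-≡0 (refl {x = 0#}) = at-0 (g 0#) c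
    pointwise a (inj₂ a≢0)  rewrite δ-≢0 a≢0 = trans (ι-*-cong a (g≡c a a≢0)) (sym (ℤₚ.+-identityʳ _))

  -- Exchanging the sums leaves, for each x, the single scalar a = L x. The weight may depend on
  -- `a`, which is what lets the same lemma count collisions of `L`.
  partition : ∀ (L : Carrier → Carrier) → (∀ x → Fq (L x)) → ∀ (W : Carrier → Carrier → ℤ) →
              ∑ (λ a → ι a *ᶻ ∑ (λ x → W x a *ᶻ δ (L x -ᶠ a))) ≡ ∑ (λ x → W x (L x))
  partition L L∈ W = begin
    ∑ (λ a → ι a *ᶻ ∑ (λ x → W x a *ᶻ δ (L x -ᶠ a))) ≡⟨ ∑-cong (λ a → sym (∑-*ˡ (ι a) _)) ⟩
    ∑ (λ a → ∑ (λ x → ι a *ᶻ (W x a *ᶻ δ (L x -ᶠ a)))) ≡⟨ ∑-swap _ ⟩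
    ∑ (λ x → ∑ (λ a → ι a *ᶻ (W x a *ᶻ δ (L x -ᶠ a)))) ≡⟨ ∑-cong (λ x → ∑-cong (λ a → trans
          (cong (λ z → ι a *ᶻ (W x a *ᶻ z)) (δ-sym (L x) a))
          (rearrange (ι a) (W x a) (δ (a -ᶠ L x))))) ⟩
    ∑ (λ x → ∑ (λ a → δ (a -ᶠ L x) *ᶻ (W x a *ᶻ ι a))) ≡⟨ ∑-cong (λ x → ∑-δ-at (L x) (λ a → W x a *ᶻ ι a)) ⟩
    ∑ (λ x → W x (L x) *ᶻ ι (L x)) ≡⟨ ∑-cong (λ x → trans (cong (W x (L x) *ᶻ_) (ι-∈ (L∈ x))) (ℤₚ.*-identityʳ _)) ⟩
    ∑ (λ x → W x (L x)) ∎
    where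
    rearrange : ∀ a b c → a *ᶻ (b *ᶻ c) ≡ c *ᶻ (b *ᶻ a)
    rearrange = solve-∀

  -- Translation by a x₁ carries the fibre over 0 to the fibre over a and preserves the weight G.
  fibre : ∀ (G : Carrier → ℤ) (L : Carrier → Carrier) x₁ → (∀ x → Fq (L x)) →
          (∀ a x → Fq a → G (x +ᶠ a *ᶠ x₁) ≡ G x) →
          (∀ a x → Fq a → L (x +ᶠ a *ᶠ x₁) ≡ L x +ᶠ a) →
          ∀ c → Fq c → pos q *ᶻ ∑ (λ x → G x *ᶻ δ (L x -ᶠ c)) ≡ ∑ G
  fibre G L x₁ L∈ G-inv L-shift c c∈ = begin
    pos q *ᶻ fib c ≡⟨ cong (_*ᶻ fib c) ∑-ι ⟨
    ∑ ι *ᶻ fib c ≡⟨ ∑-*ʳ (fib c) ι ⟨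
    ∑ (λ a → ι a *ᶻ fib c) ≡⟨ ∑-cong (λ a → ι-*-cong a (λ a∈ → trans (fib≡fib0 c c∈) (sym (fib≡fib0 a a∈)))) ⟩
    ∑ (λ a → ι a *ᶻ fib a) ≡⟨ partition L L∈ (λ x _ → G x) ⟩
    ∑ G ∎
    where
    fib : Carrier → ℤ
    fib a = ∑ (λ x → G x *ᶻ δ (L x -ᶠ a))
    fib≡fib0 : ∀ a → Fq a → fib a ≡ ∑ (λ x → G x *ᶻ δ (L x))
    fib≡fib0 a a∈ = begin
      ∑ (λ x → G x *ᶻ δ (L x -ᶠ a)) ≡⟨ ∑-shift (a *ᶠ x₁) _ ⟨
      ∑ (λ x → G (x +ᶠ a *ᶠ x₁) *ᶻ δ (L (x +ᶠ a *ᶠ x₁) -ᶠ a)) ≡⟨ ∑-cong (λ x → cong₂ _*ᶻ_ (G-inv a x a∈)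
            (cong δ (trans (cong (_-ᶠ a) (L-shift a x a∈)) (x+y-y (L x) a)))) ⟩
      ∑ (λ x → G x *ᶻ δ (L x)) ∎

  fibre-0 : ∀ (G : Carrier → ℤ) (L : Carrier → Carrier) x₁ → (∀ x → Fq (L x)) →
            (∀ a x → Fq a → G (x +ᶠ a *ᶠ x₁) ≡ G x) →
            (∀ a x → Fq a → L (x +ᶠ a *ᶠ x₁) ≡ L x +ᶠ a) →
            pos q *ᶻ ∑ (λ x → G x *ᶻ δ (L x)) ≡ ∑ G
  fibre-0 G L x₁ L∈ G-inv L-shift = trans
    (cong (pos q *ᶻ_) (∑-cong (λ x → cong (λ z → G x *ᶻ δ z) (sym (-ᶠ-0 (L x))))))
    (fibre G L x₁ L∈ G-inv L-shift 0# Fq-0)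

  frobenius^i : ∀ i x y → (x +ᶠ y) ^ᶠ (q ^ i) ≡ x ^ᶠ (q ^ i) +ᶠ y ^ᶠ (q ^ i)
  frobenius^i zero    x y = trans (R.*-identityʳ _) (sym (cong₂ _+ᶠ_ (R.*-identityʳ x) (R.*-identityʳ y)))
  frobenius^i (suc i) x y = begin
    (x +ᶠ y) ^ᶠ (q * q ^ i) ≡⟨ ^-* _ q (q ^ i) ⟩
    ((x +ᶠ y) ^ᶠ q) ^ᶠ (q ^ i) ≡⟨ cong (_^ᶠ (q ^ i)) (frobenius-q x y) ⟩
    (x ^ᶠ q +ᶠ y ^ᶠ q) ^ᶠ (q ^ i) ≡⟨ frobenius^i i _ _ ⟩
    (x ^ᶠ q) ^ᶠ (q ^ i) +ᶠ (y ^ᶠ q) ^ᶠ (q ^ i) ≡⟨ cong₂ _+ᶠ_ (sym (^-* x q _)) (sym (^-* y q _)) ⟩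
    x ^ᶠ (q * q ^ i) +ᶠ y ^ᶠ (q * q ^ i) ∎

  Fq-^ : ∀ {a} → Fq a → ∀ i → a ^ᶠ (q ^ i) ≡ a
  Fq-^ {a} a∈ zero    = R.*-identityʳ a
  Fq-^ {a} a∈ (suc i) = trans (^-* a q (q ^ i)) (trans (cong (_^ᶠ (q ^ i)) a∈) (Fq-^ a∈ i))

  tr : Carrier → Carrier
  tr = Tr q m

  tr-+ : ∀ x y → tr (x +ᶠ y) ≡ tr x +ᶠ tr y
  tr-+ x y = trans (sumTo-cong m (λ i _ → frobenius^i i x y)) (sumTo-+ m _ _)

  tr-*ˡ : ∀ a x → Fq a → tr (a *ᶠ x) ≡ a *ᶠ tr x
  tr-*ˡ a x a∈ = trans (sumTo-cong m (λ i _ → trans (*-^ a x (q ^ i)) (cong (_*ᶠ x ^ᶠ (q ^ i)) (Fq-^ a∈ i))))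
                       (sym (sumTo-*ˡ a m _))

  tr-0 : tr 0# ≡ 0#
  tr-0 = trans (cong tr (sym (R.zeroˡ 0#))) (trans (tr-*ˡ 0# 0# Fq-0) (R.zeroˡ _))

  tr-neg : ∀ x → tr (-ᶠ x) ≡ -ᶠ tr x
  tr-neg x = Rₚ.+-cancelˡ (tr x) _ _ (trans (sym (tr-+ x (-ᶠ x))) (trans (cong tr (R.-‿inverseʳ x))
    (trans tr-0 (sym (R.-‿inverseʳ (tr x))))))

  tr-^q : ∀ x → tr (x ^ᶠ q) ≡ tr x
  tr-^q x = Rₚ.+-cancelˡ x _ _ (begin
    x +ᶠ tr (x ^ᶠ q) ≡⟨ cong₂ _+ᶠ_ (sym (R.*-identityʳ x)) (sumTo-cong m (λ i _ → sym (^-* x q (q ^ i)))) ⟩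
    x ^ᶠ (q ^ 0) +ᶠ sumTo m (λ i → x ^ᶠ (q ^ suc i)) ≡⟨ sumTo-suc m (λ i → x ^ᶠ (q ^ i)) ⟨
    tr x +ᶠ x ^ᶠ (q ^ m) ≡⟨ cong (tr x +ᶠ_) (trans (cong (x ^ᶠ_) (sym n≡q^m)) (x^n≡x x)) ⟩
    tr x +ᶠ x ≡⟨ R.+-comm _ _ ⟩
    x +ᶠ tr x ∎)

  tr-∈ : ∀ x → Fq (tr x)
  tr-∈ x = trans (sumTo-hom (_^ᶠ q) Fq-0 frobenius-q m _)
    (trans (sumTo-cong m (λ i _ → ^-comm x (q ^ i) q)) (tr-^q x))

  -- Were the trace zero, ∑ᵢ γ⁻ⁱ tr(γⁱ) = ∑ⱼ ∑ᵢ (γ^(qʲ-1))ⁱ would vanish, but only the term j = 0 is nonzero.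
  tr≢0 : ∃ λ x → ¬ tr x ≡ 0#
  tr≢0 with search (λ x → ¬? (tr x ≟ᶠ 0#))
  ... | yes found = found
  ... | no ¬found = ⊥-elim (M×1≢0 (begin
    sumTo M (λ _ → 1#) ≡⟨ only-first m 1≤m ℕₚ.≤-refl ⟨
    sumTo m (λ j → sumTo M (c j ^ᶠ_)) ≡⟨ sumTo-swap m M _ ⟩
    sumTo M (λ i → sumTo m (λ j → c j ^ᶠ i)) ≡⟨ sumTo-cong M (λ i _ → row i) ⟩
    sumTo M (λ _ → 0#) ≡⟨ sumTo-0 M ⟩
    0# ∎))
    where
    c : ℕ → Carrier
    -- The summand M - 1 plays the part of the exponent -1, as the order of `γ` is `M`.
    c j = γ ^ᶠ (M ∸ 1 + q ^ j)
    row : ∀ i → sumTo m (λ j → c j ^ᶠ i) ≡ 0#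
    row i = begin
      sumTo m (λ j → c j ^ᶠ i)
        ≡⟨ sumTo-cong m (λ j _ → trans (^-comm γ (M ∸ 1 + q ^ j) i) (^-+ (γ ^ᶠ i) (M ∸ 1) (q ^ j))) ⟩
      sumTo m (λ j → (γ ^ᶠ i) ^ᶠ (M ∸ 1) *ᶠ (γ ^ᶠ i) ^ᶠ (q ^ j)) ≡⟨ sumTo-*ˡ _ m _ ⟨
      (γ ^ᶠ i) ^ᶠ (M ∸ 1) *ᶠ tr (γ ^ᶠ i)
        ≡⟨ cong ((γ ^ᶠ i) ^ᶠ (M ∸ 1) *ᶠ_) (decidable-stable (_ ≟ᶠ _) (λ ne → ¬found (γ ^ᶠ i , ne))) ⟩
      (γ ^ᶠ i) ^ᶠ (M ∸ 1) *ᶠ 0# ≡⟨ R.zeroʳ _ ⟩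
      0# ∎
    c0≡1 : c 0 ≡ 1#
    c0≡1 = trans (cong (γ ^ᶠ_) (ℕₚ.m∸n+n≡m (ℕₚ.≤-trans (s≤s z≤n) 2≤M))) γ^M≡1
    c≢1 : ∀ j → 0 < j → j < m → ¬ c j ≡ 1#
    c≢1 j 0<j j<m e = ℕₚ.<⇒≱ q^j-1<M (Div.∣⇒≤ {{ℕ.>-nonZero 0<q^j-1}} (Div.∣m+n∣m⇒∣n
        (subst (M ∣_) split (γ^-≡1⇒M∣ _ e)) Div.∣-refl))
      where
      1<q^j : 1 < q ^ j
      1<q^j = ℕₚ.≤-trans 2≤q (ℕₚ.≤-trans (ℕₚ.≤-reflexive (sym (ℕₚ.*-identityʳ q)))
            (ℕₚ.^-monoʳ-≤ q {{ℕ.>-nonZero 1≤q}} 0<j))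
      0<q^j-1 : 0 < q ^ j ∸ 1
      0<q^j-1 = ℕₚ.m<n⇒0<n∸m 1<q^j
      q^j<n : q ^ j < suc M
      q^j<n = subst (q ^ j <_) (trans (sym n≡q^m) n≡1+M) (ℕₚ.^-monoʳ-< q 2≤q j<m)
      q^j-1<M : q ^ j ∸ 1 < M
      q^j-1<M = ℕₚ.∸-monoˡ-< q^j<n (ℕₚ.<⇒≤ 1<q^j)
      split : M ∸ 1 + q ^ j ≡ M + (q ^ j ∸ 1)
      split = begin
        M ∸ 1 + q ^ j ≡⟨ cong (M ∸ 1 +_) (ℕₚ.m+[n∸m]≡n (ℕₚ.<⇒≤ 1<q^j)) ⟨
        M ∸ 1 + (1 + (q ^ j ∸ 1)) ≡⟨ ℕₚ.+-assoc (M ∸ 1) 1 _ ⟨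
        M ∸ 1 + 1 + (q ^ j ∸ 1) ≡⟨ cong (_+ (q ^ j ∸ 1)) (ℕₚ.m∸n+n≡m (ℕₚ.≤-trans (s≤s z≤n) 2≤M)) ⟩
        M + (q ^ j ∸ 1) ∎
    only-first : ∀ k → 1 ≤ k → k ≤ m → sumTo k (λ j → sumTo M (c j ^ᶠ_)) ≡ sumTo M (λ _ → 1#)
    only-first (suc zero)    _ _ = trans (R.+-identityˡ _) (sumTo-cong M (λ i _ → trans (cong (_^ᶠ i) c0≡1) (1^ i)))
    only-first (suc (suc k)) _ k<m = trans
      (cong₂ _+ᶠ_ (only-first (suc k) (s≤s z≤n) (ℕₚ.<⇒≤ k<m))
                  (geometric≡0 (c (suc k)) M (c≢1 (suc k) (s≤s z≤n) k<m)
                    (trans (^-comm γ (M ∸ 1 + q ^ suc k) M) (trans (cong (_^ᶠ (M ∸ 1 + q ^ suc k)) γ^M≡1) (1^ (M ∸ 1 + q ^ suc k))))))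
      (R.+-identityʳ _)
    -- One more copy of 1 gives n × 1 = 0, so `M` copies amount to -1.
    M×1≢0 : ¬ sumTo M (λ _ → 1#) ≡ 0#
    M×1≢0 e = 1≢0 (begin
      1# ≡⟨ R.+-identityˡ 1# ⟨
      0# +ᶠ 1# ≡⟨ cong (_+ᶠ 1#) e ⟨
      sumTo (suc M) (λ _ → 1#) ≡⟨ sumTo-1 (suc M) ⟩
      suc M Multᶠ.× 1# ≡⟨ cong (Multᶠ._× 1#) n≡1+M ⟨
      n Multᶠ.× 1# ≡⟨ n×1≡0 ⟩
      0# ∎)

  Fq-scale-to-1 : ∀ {c} → ¬ c ≡ 0# → Fq c → Σ Carrier (λ d → Fq d × d *ᶠ c ≡ 1#)
  Fq-scale-to-1 {c} c≢0 c∈ = let d , cd≡1 = inverse c c≢0 in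
    d , Fq-inverse c≢0 cd≡1 c∈ , trans (R.*-comm d c) cd≡1

  tr-scale-to-1 : ∀ v {x} → ¬ tr (v *ᶠ x) ≡ 0# → Σ Carrier (λ d → Fq d × tr (v *ᶠ (d *ᶠ x)) ≡ 1#)
  tr-scale-to-1 v {x} ne = let d , d∈ , e = Fq-scale-to-1 ne (tr-∈ _) in
    d , d∈ , trans (cong tr (*-swapˡ v d x)) (trans (tr-*ˡ d _ d∈) e)

  tr-≡1 : ∀ {v} → ¬ v ≡ 0# → Σ Carrier (λ x → tr (v *ᶠ x) ≡ 1#)
  tr-≡1 {v} v≢0 = let
      x , ne = tr≢0
      v⁻¹ , vv⁻¹≡1 = inverse v v≢0
      vv⁻¹x≡x = trans (sym (R.*-assoc v v⁻¹ x)) (trans (cong (_*ᶠ x) vv⁻¹≡1) (R.*-identityˡ x))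
      d , _ , e = tr-scale-to-1 v {v⁻¹ *ᶠ x} (λ e → ne (trans (sym (cong tr vv⁻¹x≡x)) e))
    in d *ᶠ (v⁻¹ *ᶠ x) , e

  tr-nondegenerate : ∀ {v} → (∀ x → tr (v *ᶠ x) ≡ 0#) → v ≡ 0#
  tr-nondegenerate {v} e with toSum (v ≟ᶠ 0#)
  ... | inj₁ v≡0 = v≡0
  ... | inj₂ v≢0 = let x , e₁ = tr-≡1 v≢0 in ⊥-elim (1≢0 (trans (sym e₁) (e x)))

  tr-shift : ∀ v {x₁} → tr (v *ᶠ x₁) ≡ 1# → ∀ a x → Fq a → tr (v *ᶠ (x +ᶠ a *ᶠ x₁)) ≡ tr (v *ᶠ x) +ᶠ a
  tr-shift v {x₁} e a x a∈ = begin
    tr (v *ᶠ (x +ᶠ a *ᶠ x₁)) ≡⟨ cong tr (R.distribˡ v x _) ⟩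
    tr (v *ᶠ x +ᶠ v *ᶠ (a *ᶠ x₁)) ≡⟨ tr-+ _ _ ⟩
    tr (v *ᶠ x) +ᶠ tr (v *ᶠ (a *ᶠ x₁)) ≡⟨ cong (tr (v *ᶠ x) +ᶠ_) (trans (cong tr (*-swapˡ v a x₁)) (tr-*ˡ a _ a∈)) ⟩
    tr (v *ᶠ x) +ᶠ a *ᶠ tr (v *ᶠ x₁) ≡⟨ cong (λ z → tr (v *ᶠ x) +ᶠ a *ᶠ z) e ⟩
    tr (v *ᶠ x) +ᶠ a *ᶠ 1# ≡⟨ cong (tr (v *ᶠ x) +ᶠ_) (R.*-identityʳ a) ⟩
    tr (v *ᶠ x) +ᶠ a ∎

  -- All fibres of x ↦ tr(v x) are translates of the hyperplane along a vector on which the form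
  -- takes the value 1.
  hyperplane-size : ∀ {v} → ¬ v ≡ 0# → pos q *ᶻ ∑ (λ x → δ (tr (v *ᶠ x))) ≡ pos n
  hyperplane-size {v} v≢0 = let x₁ , e₁ = tr-≡1 v≢0 in begin
    pos q *ᶻ ∑ (λ x → δ (tr (v *ᶠ x))) ≡⟨ cong (pos q *ᶻ_) (∑-cong (λ x → ℤₚ.*-identityˡ _)) ⟨
    pos q *ᶻ ∑ (λ x → 1ℤ *ᶻ δ (tr (v *ᶠ x)))
      ≡⟨ fibre-0 (λ _ → 1ℤ) (λ x → tr (v *ᶠ x)) x₁ (λ x → tr-∈ _) (λ _ _ _ → refl) (tr-shift v e₁) ⟩
    ∑ (λ _ → 1ℤ) ≡⟨ ∑-1 ⟩
    pos n ∎

∸1∣^∸1 : ∀ {q} k → 1 ≤ q → Σ ℕ (λ h → q ^ k ∸ 1 ≡ h * (q ∸ 1))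
∸1∣^∸1 {suc r} k _ = let h , e = go k in h , cong (_∸ 1) e
  where
  go : ∀ k → Σ ℕ (λ h → suc r ^ k ≡ suc (h * r))
  go zero    = 0 , refl
  go (suc k) with go k
  ... | h , e = h + suc (h * r) , (begin
    suc r ^ k + r * suc r ^ k ≡⟨ cong (λ z → z + r * z) e ⟩
    suc (h * r + r * suc (h * r)) ≡⟨ cong (λ z → suc (h * r + z)) (ℕₚ.*-comm r _) ⟩
    suc (h * r + suc (h * r) * r) ≡⟨ cong suc (ℕₚ.*-distribʳ-+ r h (suc (h * r))) ⟨
    suc ((h + suc (h * r)) * r) ∎)

[m+1]*[m∸1] : ∀ {m} → 1 ≤ m → (m + 1) * (m ∸ 1) ≡ m * m ∸ 1
[m+1]*[m∸1] {suc k} _ = cong (k +_) (trans (cong (_* k) (ℕₚ.+-comm k 1)) (ℕₚ.*-comm (suc k) k))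

pos-K>2∤2 : ∀ {K} c → 3 ≤ K → ¬ pos K *ᶻ c ≡ pos 2
pos-K>2∤2 {K} c 3≤K e = ℕₚ.<⇒≱ 3≤K (Div.∣⇒≤ (divides ℤ.∣ c ∣
  (trans (sym (cong ℤ.∣_∣ e)) (trans (ℤₚ.abs-* (pos K) c) (ℕₚ.*-comm K _)))))

-- Equal squares leave x = y or x + y = 0; in the second case `K` would divide 2. This is what fixes
-- the sign of the Gauss sums.
≡1-mod-sign : ∀ {K x y} b c → 3 ≤ K → x ≡ 1ℤ +ᶻ pos K *ᶻ b → y ≡ 1ℤ +ᶻ pos K *ᶻ c → x *ᶻ x ≡ y *ᶻ y → x ≡ y
≡1-mod-sign {K} {x} {y} b c 3≤K x≡ y≡ x²≡y²
  with ℤₚ.i*j≡0⇒i≡0∨j≡0 (x -ᶻ y) {x +ᶻ y} (trans (lem x y) (trans (cong (_-ᶻ y *ᶻ y) x²≡y²) (ℤₚ.+-inverseʳ (y *ᶻ y))))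
  where
  lem : ∀ x y → (x -ᶻ y) *ᶻ (x +ᶻ y) ≡ x *ᶻ x -ᶻ y *ᶻ y
  lem = solve-∀
... | inj₁ e = ℤₚ.i-j≡0⇒i≡j x y e
... | inj₂ e = ⊥-elim (pos-K>2∤2 (-ᶻ (b +ᶻ c)) 3≤K (begin
    pos K *ᶻ -ᶻ (b +ᶻ c) ≡⟨ lem (pos K) b c ⟩
    pos 2 -ᶻ ((1ℤ +ᶻ pos K *ᶻ b) +ᶻ (1ℤ +ᶻ pos K *ᶻ c))
      ≡⟨ cong (λ z → pos 2 -ᶻ z) (trans (sym (cong₂ _+ᶻ_ x≡ y≡)) e) ⟩
    pos 2 ∎))
  where
  lem : ∀ K b c → K *ᶻ -ᶻ (b +ᶻ c) ≡ (1ℤ +ᶻ 1ℤ) -ᶻ ((1ℤ +ᶻ K *ᶻ b) +ᶻ (1ℤ +ᶻ K *ᶻ c))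
  lem = solve-∀

-- Evaluation of the sums over `K`-th powers by quadratic forms.

module Semiprimitive {n : ℕ} (F : FiniteField n) (M : ℕ) (n≡1+M : n ≡ suc M) (2≤M : 2 ≤ M)
                     (γ : FiniteField.Carrier F) (γ-generates : FiniteField.IsPrimitive F γ)
                     (p ℓ t : ℕ) (p-prime : Prime p) (1≤ℓ : 1 ≤ ℓ) (1≤t : 1 ≤ t) (n≡p^d : n ≡ p ^ (2 * t * ℓ)) where
  open FieldProperties F
  open SumTo F
  open PrimitiveElement F M n≡1+M 2≤M γ γ-generates
  open Frobenius F p (2 * t * ℓ) p-prime n≡p^d

  d P K : ℕ
  d = 2 * t * ℓ
  P = p ^ ℓ
  K = P + 1

  2≤p : 2 ≤ p
  2≤p = ℕ.nonTrivial⇒n>1 p {{Primality.prime⇒nonTrivial p-prime}}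

  1≤p : 1 ≤ p
  1≤p = ℕₚ.<⇒≤ 2≤p

  1≤P : 1 ≤ P
  1≤P = 1≤p^ ℓ

  2≤P : 2 ≤ P
  2≤P = ℕₚ.≤-trans (subst (2 ≤_) (sym (ℕₚ.*-identityʳ p)) 2≤p) (ℕₚ.^-monoʳ-≤ p {{ℕ.>-nonZero 1≤p}} 1≤ℓ)

  1≤K : 1 ≤ K
  1≤K = ℕₚ.m≤n+m 1 P

  3≤K : 3 ≤ K
  3≤K = ℕₚ.+-monoˡ-≤ 1 2≤P

  1≤2t : 1 ≤ 2 * t
  1≤2t = ℕₚ.*-mono-≤ {1} {2} (s≤s z≤n) 1≤t

  n≡P^2t : n ≡ P ^ (2 * t)
  n≡P^2t = trans n≡p^d (trans (cong (p ^_) (ℕₚ.*-comm (2 * t) ℓ)) (sym (ℕₚ.^-*-assoc p ℓ (2 * t))))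

  n≡[P*P]^t : n ≡ (P * P) ^ t
  n≡[P*P]^t = trans n≡P^2t (trans (sym (ℕₚ.^-*-assoc P 2 t)) (cong (λ z → (P * z) ^ t) (ℕₚ.*-identityʳ P)))

  private
    factor₂ : Σ ℕ (λ h → (P * P) ^ t ∸ 1 ≡ h * (P * P ∸ 1))
    factor₂ = ∸1∣^∸1 t (ℕₚ.*-mono-≤ 1≤P 1≤P)
    factor₁ : Σ ℕ (λ g → P ∸ 1 ≡ g * (p ∸ 1))
    factor₁ = ∸1∣^∸1 ℓ 1≤p

  -- The indices of the subfields: `γ` to the power `h₂`, `h₂ * K` and `h₂ * K * g₁` generates the
  -- nonzero elements of the subfields of order `P * P`, `P` and `p`. The factor `K`, from P² - 1 =
  -- K (P - 1), is what makes every nonzero element of the last two a `K`-th power.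
  h₂ g₁ : ℕ
  h₂ = proj₁ factor₂
  g₁ = proj₁ factor₁

  M≡h₂*[P*P-1] : M ≡ h₂ * (P * P ∸ 1)
  M≡h₂*[P*P-1] = trans (cong (_∸ 1) (trans (sym n≡1+M) n≡[P*P]^t)) (proj₂ factor₂)

  M≡h₂*K*[P-1] : M ≡ (h₂ * K) * (P ∸ 1)
  M≡h₂*K*[P-1] = trans M≡h₂*[P*P-1] (trans (cong (h₂ *_) (sym ([m+1]*[m∸1] 1≤P))) (sym (ℕₚ.*-assoc h₂ K (P ∸ 1))))

  M≡h₂*K*g₁*[p-1] : M ≡ (h₂ * K * g₁) * (p ∸ 1)
  M≡h₂*K*g₁*[p-1] = trans M≡h₂*K*[P-1] (trans (cong ((h₂ * K) *_) (proj₂ factor₁)) (sym (ℕₚ.*-assoc (h₂ * K) g₁ (p ∸ 1))))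

  frobenius-P : FrobeniusAdditive P
  frobenius-P = frobenius^ ℓ

  frobenius-P*P : FrobeniusAdditive (P * P)
  frobenius-P*P x y = begin
    (x +ᶠ y) ^ᶠ (P * P) ≡⟨ ^-* _ P P ⟩
    ((x +ᶠ y) ^ᶠ P) ^ᶠ P ≡⟨ cong (_^ᶠ P) (frobenius-P x y) ⟩
    (x ^ᶠ P +ᶠ y ^ᶠ P) ^ᶠ P ≡⟨ frobenius-P _ _ ⟩
    (x ^ᶠ P) ^ᶠ P +ᶠ (y ^ᶠ P) ^ᶠ P ≡⟨ cong₂ _+ᶠ_ (sym (^-* x P P)) (sym (^-* y P P)) ⟩
    x ^ᶠ (P * P) +ᶠ y ^ᶠ (P * P) ∎

  module 𝔽p = Subfield F M n≡1+M 2≤M γ γ-generates p d (h₂ * K * g₁) 2≤p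
                (ℕₚ.*-mono-≤ 1≤2t 1≤ℓ) n≡p^d M≡h₂*K*g₁*[p-1] frobenius
  module 𝔽P = Subfield F M n≡1+M 2≤M γ γ-generates P (2 * t) (h₂ * K) 2≤P
                1≤2t n≡P^2t M≡h₂*K*[P-1] frobenius-P
  module 𝔽P² = Subfield F M n≡1+M 2≤M γ γ-generates (P * P) t h₂ (ℕₚ.*-mono-≤ {1} 1≤P 2≤P)
                1≤t n≡[P*P]^t M≡h₂*[P*P-1] frobenius-P*P

  open 𝔽p using (tr; tr-+; tr-0; tr-*ˡ; tr-neg; tr-∈; tr-^q)

  M≡K*-period : M ≡ K * (h₂ * (P ∸ 1))
  M≡K*-period = trans M≡h₂*K*[P-1] (trans (cong (_* (P ∸ 1)) (ℕₚ.*-comm h₂ K)) (ℕₚ.*-assoc K h₂ (P ∸ 1)))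

  tr-^p^ : ∀ k x → tr (x ^ᶠ (p ^ k)) ≡ tr x
  tr-^p^ zero    x = cong tr (R.*-identityʳ x)
  tr-^p^ (suc k) x = trans (cong tr (^-* x p (p ^ k))) (trans (tr-^p^ k (x ^ᶠ p)) (tr-^q x))

  x^K≡x^P*x : ∀ x → x ^ᶠ K ≡ x ^ᶠ P *ᶠ x
  x^K≡x^P*x x = trans (^-+ x P 1) (cong (x ^ᶠ P *ᶠ_) (R.*-identityʳ x))

  -- Since `K` divides `M`, the sequence of `K`-th powers of `γ ^ i` runs `K` times through a period
  -- of length M / K.
  ∑-^K : ∀ (g : Carrier → ℤ) → Σ ℤ (λ B → ∑ (λ x → g (x ^ᶠ K)) ≡ g 0# +ᶻ pos K *ᶻ B)
  ∑-^K g = range (h₂ * (P ∸ 1)) (λ i → g ((γ ^ᶠ i) ^ᶠ K)) , (begin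
    ∑ (λ x → g (x ^ᶠ K)) ≡⟨ ∑-log _ ⟩
    g (0# ^ᶠ K) +ᶻ range M (λ i → g ((γ ^ᶠ i) ^ᶠ K))
      ≡⟨ cong₂ _+ᶻ_ (cong g (0^ 1≤K)) (trans (cong (λ k → range k (λ i → g ((γ ^ᶠ i) ^ᶠ K))) M≡K*-period)
          (range-periodic (h₂ * (P ∸ 1)) K (λ i → g ((γ ^ᶠ i) ^ᶠ K)) (λ i → cong g (period i)))) ⟩
    g 0# +ᶻ pos K *ᶻ range (h₂ * (P ∸ 1)) (λ i → g ((γ ^ᶠ i) ^ᶠ K)) ∎)
    where
    period : ∀ i → (γ ^ᶠ (h₂ * (P ∸ 1) + i)) ^ᶠ K ≡ (γ ^ᶠ i) ^ᶠ K
    period i = begin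
      (γ ^ᶠ (h₂ * (P ∸ 1) + i)) ^ᶠ K ≡⟨ cong (_^ᶠ K) (^-+ γ (h₂ * (P ∸ 1)) i) ⟩
      (γ ^ᶠ (h₂ * (P ∸ 1)) *ᶠ γ ^ᶠ i) ^ᶠ K ≡⟨ *-^ _ _ K ⟩
      (γ ^ᶠ (h₂ * (P ∸ 1))) ^ᶠ K *ᶠ (γ ^ᶠ i) ^ᶠ K
        ≡⟨ cong (_*ᶠ (γ ^ᶠ i) ^ᶠ K) (trans (sym (^-*′ γ K (h₂ * (P ∸ 1)))) (trans (cong (γ ^ᶠ_) (sym M≡K*-period)) γ^M≡1)) ⟩
      1# *ᶠ (γ ^ᶠ i) ^ᶠ K ≡⟨ R.*-identityˡ _ ⟩
      (γ ^ᶠ i) ^ᶠ K ∎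

  f : Carrier → Carrier → Carrier
  f v x = tr (v *ᶠ x ^ᶠ K)

  r : Carrier → Carrier → ℤ
  r v c = ∑ (λ x → δ (f v x -ᶠ c))

  -- The sum ∑ₓ ψ(v x^K) over an additive character ψ = ζ^tr: the nonzero values of f v are equidistributed by r-scale,
  -- and the p-th roots of unity other than 1 add up to -1.
  S : Carrier → ℤ
  S v = r v 0# -ᶻ r v 1#

  -- A nonzero scalar of `𝔽p` is a `K`-th power b^K, so replacing x by b x multiplies f v x by `a`
  -- and carries one fibre to the other.
  r-scale : ∀ v a → ¬ a ≡ 0# → 𝔽p.Fq a → r v a ≡ r v 1#
  r-scale v a a≢0 a∈ = begin
    r v a ≡⟨ ∑-scale (^-≢0 (h₂ * g₁ * k) γ≢0) _ ⟨
    ∑ (λ x → δ (f v (b *ᶠ x) -ᶠ a)) ≡⟨ ∑-cong (λ x → trans (cong (λ z → δ (z -ᶠ a)) (f-b x)) (δ-a x)) ⟩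
    r v 1# ∎
    where
    k = proj₁ (𝔽p.Fq-log a≢0 a∈)
    b = γ ^ᶠ (h₂ * g₁ * k)
    exponent : h₂ * K * g₁ * k ≡ (h₂ * g₁ * k) * K
    exponent = begin
      h₂ * K * g₁ * k
        ≡⟨ cong (_* k) (trans (ℕₚ.*-assoc h₂ K g₁) (trans (cong (h₂ *_) (ℕₚ.*-comm K g₁)) (sym (ℕₚ.*-assoc h₂ g₁ K)))) ⟩
      h₂ * g₁ * K * k ≡⟨ ℕₚ.*-assoc (h₂ * g₁) K k ⟩
      h₂ * g₁ * (K * k) ≡⟨ cong (h₂ * g₁ *_) (ℕₚ.*-comm K k) ⟩
      h₂ * g₁ * (k * K) ≡⟨ ℕₚ.*-assoc (h₂ * g₁) k K ⟨
      h₂ * g₁ * k * K ∎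
    a≡b^K : a ≡ b ^ᶠ K
    a≡b^K = trans (proj₂ (𝔽p.Fq-log a≢0 a∈)) (trans (cong (γ ^ᶠ_) exponent) (^-* γ (h₂ * g₁ * k) K))
    f-b : ∀ x → f v (b *ᶠ x) ≡ a *ᶠ f v x
    f-b x = begin
      tr (v *ᶠ (b *ᶠ x) ^ᶠ K) ≡⟨ cong (λ z → tr (v *ᶠ z)) (trans (*-^ b x K) (cong (_*ᶠ x ^ᶠ K) (sym a≡b^K))) ⟩
      tr (v *ᶠ (a *ᶠ x ^ᶠ K)) ≡⟨ cong tr (*-swapˡ v a _) ⟩
      tr (a *ᶠ (v *ᶠ x ^ᶠ K)) ≡⟨ tr-*ˡ a _ a∈ ⟩
      a *ᶠ f v x ∎
    δ-a : ∀ x → δ (a *ᶠ f v x -ᶠ a) ≡ δ (f v x -ᶠ 1#)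
    δ-a x = trans (cong δ (trans (cong (λ z → a *ᶠ f v x -ᶠ z) (sym (R.*-identityʳ a))) (sym (Rₚ.x[y-z]≈xy-xz a _ _))))
                  (δ-*ˡ _ a≢0)

  n≡r₀+[p-1]r₁ : ∀ v → pos n ≡ r v 0# +ᶻ (pos p -ᶻ 1ℤ) *ᶻ r v 1#
  n≡r₀+[p-1]r₁ v = begin
    pos n ≡⟨ ∑-1 ⟨
    ∑ (λ _ → 1ℤ) ≡⟨ 𝔽p.partition (f v) (λ x → tr-∈ _) (λ _ _ → 1ℤ) ⟨
    ∑ (λ a → 𝔽p.ι a *ᶻ ∑ (λ x → 1ℤ *ᶻ δ (f v x -ᶠ a)))
      ≡⟨ ∑-cong (λ a → cong (𝔽p.ι a *ᶻ_) (∑-cong (λ x → ℤₚ.*-identityˡ _))) ⟩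
    ∑ (λ a → 𝔽p.ι a *ᶻ r v a) ≡⟨ 𝔽p.∑-ι-* (r v) (r v 1#) (r-scale v) ⟩
    r v 0# +ᶻ (pos p -ᶻ 1ℤ) *ᶻ r v 1# ∎

  [p-1]S : ∀ v → (pos p -ᶻ 1ℤ) *ᶻ S v ≡ pos p *ᶻ r v 0# -ᶻ pos n
  [p-1]S v = trans (lem (pos p) (r v 0#) (r v 1#)) (cong (λ z → pos p *ᶻ r v 0# -ᶻ z) (sym (n≡r₀+[p-1]r₁ v)))
    where
    lem : ∀ p a b → (p -ᶻ 1ℤ) *ᶻ (a -ᶻ b) ≡ p *ᶻ a -ᶻ (a +ᶻ (p -ᶻ 1ℤ) *ᶻ b)
    lem = solve-∀

  -- The left side counts pairs on which the form agrees; here they are sorted by the common value.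
  collisions : ∀ v → ∑ (λ x → r v (f v x)) ≡ r v 0# *ᶻ r v 0# +ᶻ (pos p -ᶻ 1ℤ) *ᶻ (r v 1# *ᶻ r v 1#)
  collisions v = begin
    ∑ (λ x → r v (f v x)) ≡⟨ 𝔽p.partition (f v) (λ x → tr-∈ _) (λ _ a → r v a) ⟨
    ∑ (λ a → 𝔽p.ι a *ᶻ ∑ (λ x → r v a *ᶻ δ (f v x -ᶠ a))) ≡⟨ ∑-cong (λ a → cong (𝔽p.ι a *ᶻ_) (∑-*ˡ (r v a) _)) ⟩
    ∑ (λ a → 𝔽p.ι a *ᶻ (r v a *ᶻ r v a))
      ≡⟨ 𝔽p.∑-ι-* (λ a → r v a *ᶻ r v a) (r v 1# *ᶻ r v 1#) (λ a a≢0 a∈ → cong (λ z → z *ᶻ z) (r-scale v a a≢0 a∈)) ⟩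
    r v 0# *ᶻ r v 0# +ᶻ (pos p -ᶻ 1ℤ) *ᶻ (r v 1# *ᶻ r v 1#) ∎

  β : Carrier → Carrier → Carrier
  β v z = v *ᶠ z +ᶠ v ^ᶠ P *ᶠ z ^ᶠ (P * P)

  -- x ↦ tr(v x^(P+1)) is a quadratic form over 𝔽p; the radical of its polar form is the kernel of β v.
  polarization : ∀ v z y → f v (z +ᶠ y) ≡ (tr (y ^ᶠ P *ᶠ β v z) +ᶠ f v z) +ᶠ f v y
  polarization v z y = begin
    tr (v *ᶠ (z +ᶠ y) ^ᶠ K)
      ≡⟨ cong (λ w → tr (v *ᶠ w)) (trans (x^K≡x^P*x _) (cong (_*ᶠ (z +ᶠ y)) (frobenius-P z y))) ⟩
    tr (v *ᶠ ((z ^ᶠ P +ᶠ y ^ᶠ P) *ᶠ (z +ᶠ y))) ≡⟨ cong (λ w → tr (v *ᶠ w)) (expand (z ^ᶠ P) (y ^ᶠ P) z y) ⟩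
    tr (v *ᶠ (((y ^ᶠ P *ᶠ z +ᶠ z ^ᶠ P *ᶠ y) +ᶠ z ^ᶠ P *ᶠ z) +ᶠ y ^ᶠ P *ᶠ y)) ≡⟨ tr-distrib _ _ ⟩
    tr (v *ᶠ ((y ^ᶠ P *ᶠ z +ᶠ z ^ᶠ P *ᶠ y) +ᶠ z ^ᶠ P *ᶠ z)) +ᶠ tr (v *ᶠ (y ^ᶠ P *ᶠ y))
      ≡⟨ cong₂ _+ᶠ_ (trans (tr-distrib _ _) (cong₂ _+ᶠ_ polar (form z))) (form y) ⟩
    (tr (y ^ᶠ P *ᶠ β v z) +ᶠ f v z) +ᶠ f v y ∎
    where
    expand : ∀ a b c d → (a +ᶠ b) *ᶠ (c +ᶠ d) ≡ ((b *ᶠ c +ᶠ a *ᶠ d) +ᶠ a *ᶠ c) +ᶠ b *ᶠ d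
    expand a b c d = begin
      (a +ᶠ b) *ᶠ (c +ᶠ d) ≡⟨ R.distribʳ _ a b ⟩
      a *ᶠ (c +ᶠ d) +ᶠ b *ᶠ (c +ᶠ d) ≡⟨ cong₂ _+ᶠ_ (R.distribˡ a c d) (R.distribˡ b c d) ⟩
      (a *ᶠ c +ᶠ a *ᶠ d) +ᶠ (b *ᶠ c +ᶠ b *ᶠ d) ≡⟨ R.+-assoc _ _ _ ⟨
      ((a *ᶠ c +ᶠ a *ᶠ d) +ᶠ b *ᶠ c) +ᶠ b *ᶠ d
        ≡⟨ cong (_+ᶠ b *ᶠ d) (trans (R.+-comm _ _) (trans (cong (b *ᶠ c +ᶠ_) (R.+-comm _ _)) (sym (R.+-assoc _ _ _)))) ⟩
      ((b *ᶠ c +ᶠ a *ᶠ d) +ᶠ a *ᶠ c) +ᶠ b *ᶠ d ∎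
    tr-distrib : ∀ a b → tr (v *ᶠ (a +ᶠ b)) ≡ tr (v *ᶠ a) +ᶠ tr (v *ᶠ b)
    tr-distrib a b = trans (cong tr (R.distribˡ v a b)) (tr-+ _ _)
    form : ∀ x → tr (v *ᶠ (x ^ᶠ P *ᶠ x)) ≡ f v x
    form x = cong (λ w → tr (v *ᶠ w)) (sym (x^K≡x^P*x x))
    -- The trace is unchanged by the `P`-th power, which gives the second mixed term the same factor
    -- y^P as the first.
    twist : tr (v *ᶠ (z ^ᶠ P *ᶠ y)) ≡ tr (y ^ᶠ P *ᶠ (v ^ᶠ P *ᶠ z ^ᶠ (P * P)))
    twist = begin
      tr (v *ᶠ (z ^ᶠ P *ᶠ y)) ≡⟨ tr-^p^ ℓ _ ⟨
      tr ((v *ᶠ (z ^ᶠ P *ᶠ y)) ^ᶠ P)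
        ≡⟨ cong tr (trans (*-^ v _ P) (cong (v ^ᶠ P *ᶠ_) (trans (*-^ _ y P) (cong (_*ᶠ y ^ᶠ P) (sym (^-* z P P)))))) ⟩
      tr (v ^ᶠ P *ᶠ (z ^ᶠ (P * P) *ᶠ y ^ᶠ P)) ≡⟨ cong tr (trans (sym (R.*-assoc _ _ _)) (R.*-comm _ _)) ⟩
      tr (y ^ᶠ P *ᶠ (v ^ᶠ P *ᶠ z ^ᶠ (P * P))) ∎
    polar : tr (v *ᶠ (y ^ᶠ P *ᶠ z +ᶠ z ^ᶠ P *ᶠ y)) ≡ tr (y ^ᶠ P *ᶠ β v z)
    polar = begin
      tr (v *ᶠ (y ^ᶠ P *ᶠ z +ᶠ z ^ᶠ P *ᶠ y)) ≡⟨ tr-distrib _ _ ⟩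
      tr (v *ᶠ (y ^ᶠ P *ᶠ z)) +ᶠ tr (v *ᶠ (z ^ᶠ P *ᶠ y)) ≡⟨ cong₂ _+ᶠ_ (cong tr (*-swapˡ v _ z)) twist ⟩
      tr (y ^ᶠ P *ᶠ (v *ᶠ z)) +ᶠ tr (y ^ᶠ P *ᶠ (v ^ᶠ P *ᶠ z ^ᶠ (P * P))) ≡⟨ tr-+ _ _ ⟨
      tr (y ^ᶠ P *ᶠ (v *ᶠ z) +ᶠ y ^ᶠ P *ᶠ (v ^ᶠ P *ᶠ z ^ᶠ (P * P))) ≡⟨ cong tr (R.distribˡ _ _ _) ⟨
      tr (y ^ᶠ P *ᶠ β v z) ∎

  -- The factor z^P comes out of the sum: v z^K + (v z^K)^P = z^P β(v, z).
  β≡0⇒^P≡- : ∀ {v z} → β v z ≡ 0# → (v *ᶠ z ^ᶠ K) ^ᶠ P ≡ -ᶠ (v *ᶠ z ^ᶠ K)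
  β≡0⇒^P≡- {v} {z} e = Rₚ.+-cancelˡ (v *ᶠ z ^ᶠ K) _ _ (trans (begin
    v *ᶠ z ^ᶠ K +ᶠ (v *ᶠ z ^ᶠ K) ^ᶠ P ≡⟨ cong₂ _+ᶠ_ first second ⟩
    z ^ᶠ P *ᶠ (v *ᶠ z) +ᶠ z ^ᶠ P *ᶠ (v ^ᶠ P *ᶠ z ^ᶠ (P * P)) ≡⟨ R.distribˡ _ _ _ ⟨
    z ^ᶠ P *ᶠ β v z ≡⟨ cong (z ^ᶠ P *ᶠ_) e ⟩
    z ^ᶠ P *ᶠ 0# ≡⟨ R.zeroʳ _ ⟩
    0# ∎) (sym (R.-‿inverseʳ _)))
    where
    first : v *ᶠ z ^ᶠ K ≡ z ^ᶠ P *ᶠ (v *ᶠ z)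
    first = trans (cong (v *ᶠ_) (x^K≡x^P*x z)) (*-swapˡ v _ z)
    second : (v *ᶠ z ^ᶠ K) ^ᶠ P ≡ z ^ᶠ P *ᶠ (v ^ᶠ P *ᶠ z ^ᶠ (P * P))
    second = begin
      (v *ᶠ z ^ᶠ K) ^ᶠ P ≡⟨ *-^ v _ P ⟩
      v ^ᶠ P *ᶠ (z ^ᶠ K) ^ᶠ P
        ≡⟨ cong (v ^ᶠ P *ᶠ_) (trans (cong (_^ᶠ P) (trans (x^K≡x^P*x z) (R.*-comm _ z))) (trans (*-^ z _ P) (cong (z ^ᶠ P *ᶠ_) (sym (^-* z P P))))) ⟩
      v ^ᶠ P *ᶠ (z ^ᶠ P *ᶠ z ^ᶠ (P * P)) ≡⟨ *-swapˡ _ _ _ ⟩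
      z ^ᶠ P *ᶠ (v ^ᶠ P *ᶠ z ^ᶠ (P * P)) ∎

  -- θ^P = -θ makes the trace down to 𝔽_P an alternating sum with 2t terms, so tr θ = 0 even for p = 2.
  ^P≡-⇒tr≡0 : ∀ {θ} → θ ^ᶠ P ≡ -ᶠ θ → tr θ ≡ 0#
  ^P≡-⇒tr≡0 {θ} e = trans (Tr-transitive ℓ (2 * t) θ) (trans (cong (Tr p ℓ) trP≡0)
    (trans (sumTo-cong ℓ (λ i _ → 0^ (1≤p^ i))) (sumTo-0 ℓ)))
    where
    neg-^ : ∀ j → (-ᶠ θ) ^ᶠ (P ^ j) ≡ -ᶠ (θ ^ᶠ (P ^ j))
    neg-^ j = Rₚ.+-cancelˡ (θ ^ᶠ (P ^ j)) _ _ (trans (sym (𝔽P.frobenius^i j θ (-ᶠ θ)))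
      (trans (trans (cong (_^ᶠ (P ^ j)) (R.-‿inverseʳ θ)) (0^ (ℕₚ.m^n>0 P {{ℕ.>-nonZero 1≤P}} j))) (sym (R.-‿inverseʳ _))))
    pair : ∀ i → sumTo 2 (λ j → θ ^ᶠ (P ^ (i * 2 + j))) ≡ 0#
    pair i = begin
      0# +ᶠ θ ^ᶠ (P ^ (i * 2 + 0)) +ᶠ θ ^ᶠ (P ^ (i * 2 + 1))
        ≡⟨ cong₂ _+ᶠ_ (trans (R.+-identityˡ _) (cong (λ k → θ ^ᶠ (P ^ k)) (ℕₚ.+-identityʳ (i * 2))))
            (trans (cong (λ k → θ ^ᶠ (P ^ k)) (ℕₚ.+-comm (i * 2) 1)) (^-* θ P (P ^ (i * 2)))) ⟩
      θ ^ᶠ (P ^ (i * 2)) +ᶠ (θ ^ᶠ P) ^ᶠ (P ^ (i * 2))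
        ≡⟨ cong (θ ^ᶠ (P ^ (i * 2)) +ᶠ_) (trans (cong (_^ᶠ (P ^ (i * 2))) e) (neg-^ (i * 2))) ⟩
      θ ^ᶠ (P ^ (i * 2)) -ᶠ θ ^ᶠ (P ^ (i * 2)) ≡⟨ R.-‿inverseʳ _ ⟩
      0# ∎
    trP≡0 : Tr P (2 * t) θ ≡ 0#
    trP≡0 = trans (cong (λ k → sumTo k (λ i → θ ^ᶠ (P ^ i))) (ℕₚ.*-comm 2 t))
      (trans (sumTo-blocks t 2 (λ i → θ ^ᶠ (P ^ i))) (trans (sumTo-cong t (λ i _ → pair i)) (sumTo-0 t)))

  β≡0⇒f≡0 : ∀ {v z} → β v z ≡ 0# → f v z ≡ 0#
  β≡0⇒f≡0 e = ^P≡-⇒tr≡0 (β≡0⇒^P≡- e)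

  P-th-root : ∀ w → Σ Carrier (λ x → x ^ᶠ P ≡ w)
  P-th-root w = w ^ᶠ (P ^ (2 * t ∸ 1)) , (begin
    (w ^ᶠ (P ^ (2 * t ∸ 1))) ^ᶠ P ≡⟨ ^-*′ w P _ ⟨
    w ^ᶠ (P ^ suc (2 * t ∸ 1)) ≡⟨ cong (λ k → w ^ᶠ (P ^ k)) (ℕₚ.m+[n∸m]≡n 1≤2t) ⟩
    w ^ᶠ (P ^ (2 * t)) ≡⟨ cong (w ^ᶠ_) n≡P^2t ⟨
    w ^ᶠ n ≡⟨ x^n≡x w ⟩
    w ∎)

  ρ : Carrier → ℤ
  ρ v = ∑ (λ z → δ (β v z))

  -- By `polarization` the difference is additive in y up to the constant f v z. If z is in the
  -- radical, the additive part and the constant both vanish and every y counts; otherwise all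
  -- values in `𝔽p` are taken equally often.
  polar-fibre : ∀ v z → pos p *ᶻ ∑ (λ y → δ (f v (z +ᶠ y) -ᶠ f v y)) ≡ pos n +ᶻ δ (β v z) *ᶻ ((pos p -ᶻ 1ℤ) *ᶻ pos n)
  polar-fibre v z = trans (cong (pos p *ᶻ_) (∑-cong (λ y → cong δ (trans (cong (_-ᶠ f v y) (polarization v z y)) (x+y-y _ _)))))
                          (go (toSum (β v z ≟ᶠ 0#)))
    where
    L : Carrier → Carrier
    L y = tr (y ^ᶠ P *ᶠ β v z)
    go : β v z ≡ 0# ⊎ ¬ β v z ≡ 0# →
         pos p *ᶻ ∑ (λ y → δ (L y +ᶠ f v z)) ≡ pos n +ᶻ δ (β v z) *ᶻ ((pos p -ᶻ 1ℤ) *ᶻ pos n)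
    go (inj₁ e) = begin
      pos p *ᶻ ∑ (λ y → δ (L y +ᶠ f v z)) ≡⟨ cong (pos p *ᶻ_) (∑-cong (λ y → δ-≡0 (trans (cong₂ _+ᶠ_
            (trans (cong tr (trans (cong (y ^ᶠ P *ᶠ_) e) (R.zeroʳ _))) tr-0) (β≡0⇒f≡0 e)) (R.+-identityˡ 0#)))) ⟩
      pos p *ᶻ ∑ (λ _ → 1ℤ) ≡⟨ cong (pos p *ᶻ_) ∑-1 ⟩
      pos p *ᶻ pos n ≡⟨ lem (pos p) (pos n) ⟩
      pos n +ᶻ 1ℤ *ᶻ ((pos p -ᶻ 1ℤ) *ᶻ pos n) ≡⟨ cong (λ w → pos n +ᶻ w *ᶻ ((pos p -ᶻ 1ℤ) *ᶻ pos n)) (δ-≡0 e) ⟨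
      pos n +ᶻ δ (β v z) *ᶻ ((pos p -ᶻ 1ℤ) *ᶻ pos n) ∎
      where
      lem : ∀ p n → p *ᶻ n ≡ n +ᶻ 1ℤ *ᶻ ((p -ᶻ 1ℤ) *ᶻ n)
      lem = solve-∀
    go (inj₂ β≢0) = begin
      pos p *ᶻ ∑ (λ y → δ (L y +ᶠ f v z))
        ≡⟨ cong (pos p *ᶻ_) (∑-cong (λ y → trans (cong (λ w → δ (L y +ᶠ w)) (sym (Rₚ.-‿involutive (f v z)))) (sym (ℤₚ.*-identityˡ _)))) ⟩
      pos p *ᶻ ∑ (λ y → 1ℤ *ᶻ δ (L y -ᶠ -ᶠ f v z))
        ≡⟨ 𝔽p.fibre (λ _ → 1ℤ) L x₁ (λ y → tr-∈ _) (λ _ _ _ → refl) shift (-ᶠ f v z) (𝔽p.Fq-neg (tr-∈ _)) ⟩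
      ∑ (λ _ → 1ℤ) ≡⟨ ∑-1 ⟩
      pos n ≡⟨ ℤₚ.+-identityʳ _ ⟨
      pos n +ᶻ 0ℤ *ᶻ ((pos p -ᶻ 1ℤ) *ᶻ pos n) ≡⟨ cong (λ w → pos n +ᶻ w *ᶻ ((pos p -ᶻ 1ℤ) *ᶻ pos n)) (δ-≢0 β≢0) ⟨
      pos n +ᶻ δ (β v z) *ᶻ ((pos p -ᶻ 1ℤ) *ᶻ pos n) ∎
      where
      w = 𝔽p.tr-≡1 β≢0
      -- `L` depends on y through y^P, so the translation vector is the `P`-th root of one that has
      -- trace 1 against `β v z`. Scalars of `𝔽p` are fixed by the `P`-th power.
      x₁ = proj₁ (P-th-root (proj₁ w))
      shift : ∀ a y → 𝔽p.Fq a → L (y +ᶠ a *ᶠ x₁) ≡ L y +ᶠ a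
      shift a y a∈ = begin
        tr ((y +ᶠ a *ᶠ x₁) ^ᶠ P *ᶠ β v z)
          ≡⟨ cong tr (trans (cong (_*ᶠ β v z) (trans (frobenius-P y _) (cong (y ^ᶠ P +ᶠ_)
              (trans (*-^ a x₁ P) (cong₂ _*ᶠ_ (𝔽p.Fq-^ a∈ ℓ) (proj₂ (P-th-root (proj₁ w)))))))) (R.*-comm _ _)) ⟩
        tr (β v z *ᶠ (y ^ᶠ P +ᶠ a *ᶠ proj₁ w)) ≡⟨ 𝔽p.tr-shift (β v z) (proj₂ w) a (y ^ᶠ P) a∈ ⟩
        tr (β v z *ᶠ y ^ᶠ P) +ᶠ a ≡⟨ cong (λ u → tr u +ᶠ a) (R.*-comm _ _) ⟩
        L y +ᶠ a ∎

  p-1-cancel : ∀ {a b} → (pos p -ᶻ 1ℤ) *ᶻ a ≡ (pos p -ᶻ 1ℤ) *ᶻ b → a ≡ b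
  p-1-cancel {a} {b} e = ℤₚ.*-cancelˡ-≡ (pos (p ∸ 1)) a b {{ℕ.>-nonZero (ℕₚ.m<n⇒0<n∸m 2≤p)}}
    (subst (λ z → z *ᶻ a ≡ z *ᶻ b) (trans (cong (λ k → pos k -ᶻ 1ℤ) 𝔽p.q≡1+[q-1]) (lem (pos (p ∸ 1)))) e)
    where
    lem : ∀ x → (1ℤ +ᶻ x) -ᶻ 1ℤ ≡ x
    lem = solve-∀

  -- Pairs with equal form value are counted by that value and by their difference z. The first
  -- count enters through p (a² + (p-1) b²) - (a + (p-1) b)² = (p-1)(a-b)² for the fibre sizes a, b
  -- over 0 and 1; the second produces the size `ρ v` of the radical.
  S²≡nρ : ∀ v → S v *ᶻ S v ≡ pos n *ᶻ ρ v
  S²≡nρ v = p-1-cancel (begin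
    (pos p -ᶻ 1ℤ) *ᶻ (S v *ᶻ S v) ≡⟨ lem₁ (pos p) (r v 0#) (r v 1#) ⟩
    pos p *ᶻ (r v 0# *ᶻ r v 0# +ᶻ (pos p -ᶻ 1ℤ) *ᶻ (r v 1# *ᶻ r v 1#)) -ᶻ
      (r v 0# +ᶻ (pos p -ᶻ 1ℤ) *ᶻ r v 1#) *ᶻ (r v 0# +ᶻ (pos p -ᶻ 1ℤ) *ᶻ r v 1#)
        ≡⟨ cong₂ _-ᶻ_ pT (cong (λ z → z *ᶻ z) (sym (n≡r₀+[p-1]r₁ v))) ⟩
    (pos n *ᶻ pos n +ᶻ ρ v *ᶻ ((pos p -ᶻ 1ℤ) *ᶻ pos n)) -ᶻ pos n *ᶻ pos n ≡⟨ lem₂ (pos p) (pos n) (ρ v) ⟩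
    (pos p -ᶻ 1ℤ) *ᶻ (pos n *ᶻ ρ v) ∎)
    where
    lem₁ : ∀ p a b → (p -ᶻ 1ℤ) *ᶻ ((a -ᶻ b) *ᶻ (a -ᶻ b)) ≡
           p *ᶻ (a *ᶻ a +ᶻ (p -ᶻ 1ℤ) *ᶻ (b *ᶻ b)) -ᶻ (a +ᶻ (p -ᶻ 1ℤ) *ᶻ b) *ᶻ (a +ᶻ (p -ᶻ 1ℤ) *ᶻ b)
    lem₁ = solve-∀
    lem₂ : ∀ p n ρ → (n *ᶻ n +ᶻ ρ *ᶻ ((p -ᶻ 1ℤ) *ᶻ n)) -ᶻ n *ᶻ n ≡ (p -ᶻ 1ℤ) *ᶻ (n *ᶻ ρ)
    lem₂ = solve-∀
    pT : pos p *ᶻ (r v 0# *ᶻ r v 0# +ᶻ (pos p -ᶻ 1ℤ) *ᶻ (r v 1# *ᶻ r v 1#)) ≡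
         pos n *ᶻ pos n +ᶻ ρ v *ᶻ ((pos p -ᶻ 1ℤ) *ᶻ pos n)
    pT = begin
      pos p *ᶻ (r v 0# *ᶻ r v 0# +ᶻ (pos p -ᶻ 1ℤ) *ᶻ (r v 1# *ᶻ r v 1#)) ≡⟨ cong (pos p *ᶻ_) (collisions v) ⟨
      pos p *ᶻ ∑ (λ x → ∑ (λ y → δ (f v y -ᶠ f v x))) ≡⟨ cong (pos p *ᶻ_) (∑-cong (λ x → sym (∑-shift x _))) ⟩
      pos p *ᶻ ∑ (λ x → ∑ (λ z → δ (f v (z +ᶠ x) -ᶠ f v x))) ≡⟨ cong (pos p *ᶻ_) (∑-swap _) ⟩
      pos p *ᶻ ∑ (λ z → ∑ (λ x → δ (f v (z +ᶠ x) -ᶠ f v x))) ≡⟨ ∑-*ˡ (pos p) _ ⟨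
      ∑ (λ z → pos p *ᶻ ∑ (λ x → δ (f v (z +ᶠ x) -ᶠ f v x))) ≡⟨ ∑-cong (polar-fibre v) ⟩
      ∑ (λ z → pos n +ᶻ δ (β v z) *ᶻ ((pos p -ᶻ 1ℤ) *ᶻ pos n)) ≡⟨ ∑-+ _ _ ⟩
      ∑ (λ _ → pos n) +ᶻ ∑ (λ z → δ (β v z) *ᶻ ((pos p -ᶻ 1ℤ) *ᶻ pos n)) ≡⟨ cong₂ _+ᶻ_ (∑-const (pos n)) (∑-*ʳ _ _) ⟩
      pos n *ᶻ pos n +ᶻ ρ v *ᶻ ((pos p -ᶻ 1ℤ) *ᶻ pos n) ∎

  -- τ = (-1)^t √n
  τ : ℤ
  τ = (-ᶻ pos P) ℤ.^ t

  -- Modulo K = P + 1 the base -P is 1. This is the reason for building the sign (-1)^t into `τ`.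
  τ≡1 : Σ ℤ (λ b → τ ≡ 1ℤ +ᶻ pos K *ᶻ b)
  τ≡1 = go t
    where
    step : ∀ P b → (-ᶻ P) *ᶻ (1ℤ +ᶻ (P +ᶻ 1ℤ) *ᶻ b) ≡ 1ℤ +ᶻ (P +ᶻ 1ℤ) *ᶻ (-ᶻ 1ℤ -ᶻ P *ᶻ b)
    step = solve-∀
    go : ∀ t → Σ ℤ (λ b → (-ᶻ pos P) ℤ.^ t ≡ 1ℤ +ᶻ pos K *ᶻ b)
    go zero    = 0ℤ , sym (trans (cong (1ℤ +ᶻ_) (ℤₚ.*-zeroʳ (pos K))) refl)
    go (suc t) with go t
    ... | b , e = -ᶻ 1ℤ -ᶻ pos P *ᶻ b , trans (cong ((-ᶻ pos P) *ᶻ_) e) (step (pos P) b)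

  τ²≡n : τ *ᶻ τ ≡ pos n
  τ²≡n = trans (go t) (cong pos (sym n≡[P*P]^t))
    where
    rearrange : ∀ a b → (-ᶻ a *ᶻ b) *ᶻ (-ᶻ a *ᶻ b) ≡ (a *ᶻ a) *ᶻ (b *ᶻ b)
    rearrange = solve-∀
    go : ∀ t → (-ᶻ pos P) ℤ.^ t *ᶻ (-ᶻ pos P) ℤ.^ t ≡ pos ((P * P) ^ t)
    go zero    = refl
    go (suc t) = begin
      (-ᶻ pos P *ᶻ (-ᶻ pos P) ℤ.^ t) *ᶻ (-ᶻ pos P *ᶻ (-ᶻ pos P) ℤ.^ t) ≡⟨ rearrange (pos P) _ ⟩
      (pos P *ᶻ pos P) *ᶻ ((-ᶻ pos P) ℤ.^ t *ᶻ (-ᶻ pos P) ℤ.^ t) ≡⟨ cong₂ _*ᶻ_ (sym (ℤₚ.pos-* P P)) (go t) ⟩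
      pos (P * P) *ᶻ pos ((P * P) ^ t) ≡⟨ ℤₚ.pos-* (P * P) _ ⟨
      pos (P * P * (P * P) ^ t) ∎

  -- In either fibre the nonzero x come in multiples of `K`; x = 0 lies in the fibre over 0 and not
  -- in the one over 1.
  S≡1 : ∀ v → Σ ℤ (λ b → S v ≡ 1ℤ +ᶻ pos K *ᶻ b)
  S≡1 v = B₀ -ᶻ B₁ , (begin
    r v 0# -ᶻ r v 1# ≡⟨ cong₂ _-ᶻ_ e₀ e₁ ⟩
    (δ (tr (v *ᶠ 0#) -ᶠ 0#) +ᶻ pos K *ᶻ B₀) -ᶻ (δ (tr (v *ᶠ 0#) -ᶠ 1#) +ᶻ pos K *ᶻ B₁)
      ≡⟨ cong₂ (λ a b → (a +ᶻ pos K *ᶻ B₀) -ᶻ (b +ᶻ pos K *ᶻ B₁)) (δ-≡0 (trans (-ᶠ-0 _) tr-v0))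
           (δ-≢0 (λ e → 0≢1 (trans (sym tr-v0) (x-y≡0⇒x≡y e)))) ⟩
    (1ℤ +ᶻ pos K *ᶻ B₀) -ᶻ (0ℤ +ᶻ pos K *ᶻ B₁) ≡⟨ lem (pos K) B₀ B₁ ⟩
    1ℤ +ᶻ pos K *ᶻ (B₀ -ᶻ B₁) ∎)
    where
    tr-v0 : tr (v *ᶠ 0#) ≡ 0#
    tr-v0 = trans (cong tr (R.zeroʳ v)) tr-0
    B₀ = proj₁ (∑-^K (λ y → δ (tr (v *ᶠ y) -ᶠ 0#)))
    e₀ = proj₂ (∑-^K (λ y → δ (tr (v *ᶠ y) -ᶠ 0#)))
    B₁ = proj₁ (∑-^K (λ y → δ (tr (v *ᶠ y) -ᶠ 1#)))
    e₁ = proj₂ (∑-^K (λ y → δ (tr (v *ᶠ y) -ᶠ 1#)))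
    lem : ∀ K a b → (1ℤ +ᶻ K *ᶻ a) -ᶻ (0ℤ +ᶻ K *ᶻ b) ≡ 1ℤ +ᶻ K *ᶻ (a -ᶻ b)
    lem = solve-∀

  -- The v for which the radical is nonzero; they form the single coset of K-th powers with the exceptional
  -- Gaussian period.
  Special : Carrier → Set
  Special v = ¬ v ≡ 0# × ∃ λ z → ¬ z ≡ 0# × β v z ≡ 0#

  special? : Decidable Special
  special? v = ¬? (v ≟ᶠ 0#) ×-dec search (λ z → ¬? (z ≟ᶠ 0#) ×-dec (β v z ≟ᶠ 0#))

  opaque
    sp : Carrier → ℤ
    sp v = ⟦ special? v ⟧

    sp-yes : ∀ {v} → Special v → sp v ≡ 1ℤ
    sp-yes {v} = ⟦⟧-yes (special? v)

    sp-no : ∀ {v} → ¬ Special v → sp v ≡ 0ℤ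
    sp-no {v} = ⟦⟧-no (special? v)

  β-0 : ∀ v → β v 0# ≡ 0#
  β-0 v = trans (cong₂ _+ᶠ_ (R.zeroʳ v) (trans (cong (v ^ᶠ P *ᶠ_) (0^ (ℕₚ.*-mono-≤ 1≤P 1≤P))) (R.zeroʳ _))) (R.+-identityˡ 0#)

  -- Dividing by one nonzero radical element z₀ turns the equation into c = c^(P²): the radical is
  -- the line of z₀ over the subfield of order P².
  ρ-special : ∀ {v} → Special v → ρ v ≡ pos (P * P)
  ρ-special {v} (v≢0 , z₀ , z₀≢0 , e) = begin
    ∑ (λ z → δ (β v z)) ≡⟨ ∑-scale z₀≢0 _ ⟨
    ∑ (λ c → δ (β v (z₀ *ᶠ c)))
      ≡⟨ ∑-cong (λ c → trans (cong δ (β-z₀ c)) (trans (δ-*ˡ _ (*-≢0 v≢0 z₀≢0)) (δ-sym c _))) ⟩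
    ∑ 𝔽P².ι ≡⟨ 𝔽P².∑-ι ⟩
    pos (P * P) ∎
    where
    β-z₀ : ∀ c → β v (z₀ *ᶠ c) ≡ (v *ᶠ z₀) *ᶠ (c -ᶠ c ^ᶠ (P * P))
    β-z₀ c = begin
      v *ᶠ (z₀ *ᶠ c) +ᶠ v ^ᶠ P *ᶠ (z₀ *ᶠ c) ^ᶠ (P * P)
        ≡⟨ cong₂ _+ᶠ_ (sym (R.*-assoc v z₀ c)) (trans (cong (v ^ᶠ P *ᶠ_) (*-^ z₀ c (P * P))) (sym (R.*-assoc _ _ _))) ⟩
      (v *ᶠ z₀) *ᶠ c +ᶠ (v ^ᶠ P *ᶠ z₀ ^ᶠ (P * P)) *ᶠ c ^ᶠ (P * P)
        ≡⟨ cong (λ w → (v *ᶠ z₀) *ᶠ c +ᶠ w *ᶠ c ^ᶠ (P * P)) (Rₚ.+-inverseʳ-unique _ _ e) ⟩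
      (v *ᶠ z₀) *ᶠ c +ᶠ (-ᶠ (v *ᶠ z₀)) *ᶠ c ^ᶠ (P * P) ≡⟨ cong ((v *ᶠ z₀) *ᶠ c +ᶠ_) (sym (Rₚ.-‿distribˡ-* _ _)) ⟩
      (v *ᶠ z₀) *ᶠ c -ᶠ (v *ᶠ z₀) *ᶠ c ^ᶠ (P * P) ≡⟨ Rₚ.x[y-z]≈xy-xz _ _ _ ⟨
      (v *ᶠ z₀) *ᶠ (c -ᶠ c ^ᶠ (P * P)) ∎

  ρ-¬special : ∀ {v} → ¬ v ≡ 0# → ¬ Special v → ρ v ≡ 1ℤ
  ρ-¬special {v} v≢0 ¬sp = trans (∑-cong (λ z → δ-cong
    (λ e → decidable-stable (z ≟ᶠ 0#) (λ z≢0 → ¬sp (v≢0 , z , z≢0 , e))) (λ { refl → β-0 v }))) ∑-δ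

  -- The squares are known from the radical. Both candidates, `τ` and τ - τ K = -τ P, are 1 modulo
  -- `K`, like `S v`, so the signs agree. Linearity in `sp` allows the formula to be summed
  -- directly.
  S-value : ∀ {v} → ¬ v ≡ 0# → S v ≡ τ -ᶻ (τ *ᶻ pos K) *ᶻ sp v
  S-value {v} v≢0 = go (toSum (special? v))
    where
    b = proj₁ τ≡1
    lem₀ : ∀ τ K → τ ≡ τ -ᶻ (τ *ᶻ K) *ᶻ 0ℤ
    lem₀ = solve-∀
    lem₁ : ∀ τ P → τ *ᶻ τ *ᶻ (P *ᶻ P) ≡ (τ -ᶻ (τ *ᶻ (P +ᶻ 1ℤ)) *ᶻ 1ℤ) *ᶻ (τ -ᶻ (τ *ᶻ (P +ᶻ 1ℤ)) *ᶻ 1ℤ)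
    lem₁ = solve-∀
    lem₂ : ∀ τ K b → (1ℤ +ᶻ K *ᶻ b) -ᶻ (τ *ᶻ K) *ᶻ 1ℤ ≡ 1ℤ +ᶻ K *ᶻ (b -ᶻ τ)
    lem₂ = solve-∀
    τ-τK≡1 : τ -ᶻ (τ *ᶻ pos K) *ᶻ 1ℤ ≡ 1ℤ +ᶻ pos K *ᶻ (b -ᶻ τ)
    τ-τK≡1 = trans (cong (_-ᶻ (τ *ᶻ pos K) *ᶻ 1ℤ) (proj₂ τ≡1)) (lem₂ τ (pos K) b)
    go : Special v ⊎ ¬ Special v → S v ≡ τ -ᶻ (τ *ᶻ pos K) *ᶻ sp v
    go (inj₂ ¬sp) = begin
      S v ≡⟨ ≡1-mod-sign (proj₁ (S≡1 v)) b 3≤K (proj₂ (S≡1 v)) (proj₂ τ≡1) (begin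
        S v *ᶻ S v ≡⟨ S²≡nρ v ⟩
        pos n *ᶻ ρ v ≡⟨ cong₂ _*ᶻ_ (sym τ²≡n) (ρ-¬special v≢0 ¬sp) ⟩
        τ *ᶻ τ *ᶻ 1ℤ ≡⟨ ℤₚ.*-identityʳ _ ⟩
        τ *ᶻ τ ∎) ⟩
      τ ≡⟨ lem₀ τ (pos K) ⟩
      τ -ᶻ (τ *ᶻ pos K) *ᶻ 0ℤ ≡⟨ cong (λ w → τ -ᶻ (τ *ᶻ pos K) *ᶻ w) (sp-no ¬sp) ⟨
      τ -ᶻ (τ *ᶻ pos K) *ᶻ sp v ∎
    go (inj₁ isSp) = begin
      S v ≡⟨ ≡1-mod-sign (proj₁ (S≡1 v)) (b -ᶻ τ) 3≤K (proj₂ (S≡1 v)) τ-τK≡1 (begin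
        S v *ᶻ S v ≡⟨ S²≡nρ v ⟩
        pos n *ᶻ ρ v ≡⟨ cong₂ _*ᶻ_ (sym τ²≡n) (trans (ρ-special isSp) (ℤₚ.pos-* P P)) ⟩
        τ *ᶻ τ *ᶻ (pos P *ᶻ pos P) ≡⟨ lem₁ τ (pos P) ⟩
        (τ -ᶻ (τ *ᶻ pos K) *ᶻ 1ℤ) *ᶻ (τ -ᶻ (τ *ᶻ pos K) *ᶻ 1ℤ) ∎) ⟩
      τ -ᶻ (τ *ᶻ pos K) *ᶻ 1ℤ ≡⟨ cong (λ w → τ -ᶻ (τ *ᶻ pos K) *ᶻ w) (sp-yes isSp) ⟨
      τ -ᶻ (τ *ᶻ pos K) *ᶻ sp v ∎

  -- φ(y) = ∑ ψ(b y) over b ∈ 𝔽p*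
  φ : Carrier → ℤ
  φ y = pos p *ᶻ δ (tr y) -ᶻ 1ℤ

  φ-0 : φ 0# ≡ pos p -ᶻ 1ℤ
  φ-0 = cong (_-ᶻ 1ℤ) (trans (cong (pos p *ᶻ_) (δ-≡0 tr-0)) (ℤₚ.*-identityʳ (pos p)))

  ∑-φ : ∀ {c} → ¬ c ≡ 0# → ∑ (λ v → φ (c *ᶠ v)) ≡ 0ℤ
  ∑-φ {c} c≢0 = begin
    ∑ (λ v → pos p *ᶻ δ (tr (c *ᶠ v)) -ᶻ 1ℤ) ≡⟨ ∑-- _ _ ⟩
    ∑ (λ v → pos p *ᶻ δ (tr (c *ᶠ v))) -ᶻ ∑ (λ _ → 1ℤ)
      ≡⟨ cong₂ _-ᶻ_ (trans (∑-*ˡ (pos p) (λ v → δ (tr (c *ᶠ v)))) (𝔽p.hyperplane-size c≢0)) ∑-1 ⟩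
    pos n -ᶻ pos n ≡⟨ ℤₚ.+-inverseʳ (pos n) ⟩
    0ℤ ∎

  ∑-φ-^K : ∀ v → ∑ (λ x → φ (v *ᶠ x ^ᶠ K)) ≡ (pos p -ᶻ 1ℤ) *ᶻ S v
  ∑-φ-^K v = begin
    ∑ (λ x → pos p *ᶻ δ (f v x) -ᶻ 1ℤ) ≡⟨ ∑-- _ _ ⟩
    ∑ (λ x → pos p *ᶻ δ (f v x)) -ᶻ ∑ (λ _ → 1ℤ)
      ≡⟨ cong₂ _-ᶻ_ (trans (∑-*ˡ (pos p) (λ x → δ (f v x))) (cong (pos p *ᶻ_) (∑-cong (λ x → cong δ (sym (-ᶠ-0 _))))))
          ∑-1 ⟩
    pos p *ᶻ r v 0# -ᶻ pos n ≡⟨ [p-1]S v ⟨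
    (pos p -ᶻ 1ℤ) *ᶻ S v ∎

  -- Orthogonality: for fixed x ≠ 0 the sum over v of the characters of v x^K vanishes, and x = 0
  -- contributes `n` times p - 1 to the scaled sum.
  ∑-S : ∑ S ≡ pos n
  ∑-S = p-1-cancel (begin
    (pos p -ᶻ 1ℤ) *ᶻ ∑ S ≡⟨ ∑-*ˡ (pos p -ᶻ 1ℤ) S ⟨
    ∑ (λ v → (pos p -ᶻ 1ℤ) *ᶻ S v) ≡⟨ ∑-cong (λ v → sym (∑-φ-^K v)) ⟩
    ∑ (λ v → ∑ (λ x → φ (v *ᶠ x ^ᶠ K))) ≡⟨ ∑-swap _ ⟩
    ∑ (λ x → ∑ (λ v → φ (v *ᶠ x ^ᶠ K)))
      ≡⟨ ∑-cong (λ x → trans (∑-cong (λ v → cong φ (R.*-comm v _))) (column x (toSum (x ≟ᶠ 0#)))) ⟩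
    ∑ (λ x → δ x *ᶻ (pos n *ᶻ (pos p -ᶻ 1ℤ))) ≡⟨ ∑-δ-0 _ ⟩
    pos n *ᶻ (pos p -ᶻ 1ℤ) ≡⟨ ℤₚ.*-comm (pos n) _ ⟩
    (pos p -ᶻ 1ℤ) *ᶻ pos n ∎)
    where
    column : ∀ x → x ≡ 0# ⊎ ¬ x ≡ 0# → ∑ (λ v → φ (x ^ᶠ K *ᶠ v)) ≡ δ x *ᶻ (pos n *ᶻ (pos p -ᶻ 1ℤ))
    column x (inj₁ refl) = begin
      ∑ (λ v → φ (0# ^ᶠ K *ᶠ v)) ≡⟨ ∑-cong (λ v → trans (cong φ (trans (cong (_*ᶠ v) (0^ 1≤K)) (R.zeroˡ v))) φ-0) ⟩
      ∑ (λ _ → pos p -ᶻ 1ℤ) ≡⟨ ∑-const _ ⟩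
      pos n *ᶻ (pos p -ᶻ 1ℤ) ≡⟨ ℤₚ.*-identityˡ _ ⟨
      1ℤ *ᶻ (pos n *ᶻ (pos p -ᶻ 1ℤ)) ≡⟨ cong (_*ᶻ (pos n *ᶻ (pos p -ᶻ 1ℤ))) (δ-≡0 refl) ⟨
      δ 0# *ᶻ (pos n *ᶻ (pos p -ᶻ 1ℤ)) ∎
    column x (inj₂ x≢0) = trans (∑-φ (^-≢0 K x≢0)) (cong (_*ᶻ (pos n *ᶻ (pos p -ᶻ 1ℤ))) (sym (δ-≢0 x≢0)))

  S-0 : S 0# ≡ pos n
  S-0 = p-1-cancel (begin
    (pos p -ᶻ 1ℤ) *ᶻ S 0# ≡⟨ ∑-φ-^K 0# ⟨
    ∑ (λ x → φ (0# *ᶠ x ^ᶠ K)) ≡⟨ ∑-cong (λ x → trans (cong φ (R.zeroˡ _)) φ-0) ⟩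
    ∑ (λ _ → pos p -ᶻ 1ℤ) ≡⟨ ∑-const _ ⟩
    pos n *ᶻ (pos p -ᶻ 1ℤ) ≡⟨ ℤₚ.*-comm (pos n) _ ⟩
    (pos p -ᶻ 1ℤ) *ᶻ pos n ∎)

  sp-0 : sp 0# ≡ 0ℤ
  sp-0 = sp-no (λ (ne , _) → ne refl)

  pos-n : pos n ≡ 1ℤ +ᶻ pos M
  pos-n = cong pos n≡1+M

  τ-cancel : ∀ {a b} → τ *ᶻ a ≡ τ *ᶻ b → a ≡ b
  τ-cancel {a} {b} e = ℤₚ.*-cancelˡ-≡ (pos n) a b {{ℕ.>-nonZero (subst (0 <_) (sym n≡1+M) (s≤s z≤n))}} (begin
    pos n *ᶻ a ≡⟨ cong (_*ᶻ a) τ²≡n ⟨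
    τ *ᶻ τ *ᶻ a ≡⟨ ℤₚ.*-assoc τ τ a ⟩
    τ *ᶻ (τ *ᶻ a) ≡⟨ cong (τ *ᶻ_) e ⟩
    τ *ᶻ (τ *ᶻ b) ≡⟨ ℤₚ.*-assoc τ τ b ⟨
    τ *ᶻ τ *ᶻ b ≡⟨ cong (_*ᶻ b) τ²≡n ⟩
    pos n *ᶻ b ∎)

  -- Both ∑ S and S(0) are `n`, so the values at v ≠ 0 add up to 0; by `S-value` they add up to M τ
  -- - τ K ∑ sp. Existence of special elements follows without exhibiting one.
  K*#special : pos K *ᶻ ∑ sp ≡ pos M
  K*#special = τ-cancel (begin
    τ *ᶻ (pos K *ᶻ ∑ sp) ≡⟨ lem (pos n) (pos M) τ (pos K) (∑ sp) ⟩
    τ *ᶻ ((pos n -ᶻ 1ℤ)) -ᶻ (((pos n *ᶻ τ -ᶻ (τ *ᶻ pos K) *ᶻ ∑ sp) +ᶻ (pos n -ᶻ τ)) -ᶻ pos n)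
          ≡⟨ cong₂ (λ a b → τ *ᶻ (a -ᶻ 1ℤ) -ᶻ (b -ᶻ pos n)) pos-n (trans (sym ∑-S′) ∑-S) ⟩
    τ *ᶻ (1ℤ +ᶻ pos M -ᶻ 1ℤ) -ᶻ (pos n -ᶻ pos n) ≡⟨ lem′ τ (pos M) (pos n) ⟩
    τ *ᶻ pos M ∎)
    where
    lem : ∀ n M τ K s → τ *ᶻ (K *ᶻ s) ≡ τ *ᶻ (n -ᶻ 1ℤ) -ᶻ (((n *ᶻ τ -ᶻ (τ *ᶻ K) *ᶻ s) +ᶻ (n -ᶻ τ)) -ᶻ n)
    lem = solve-∀
    lem′ : ∀ τ M n → τ *ᶻ (1ℤ +ᶻ M -ᶻ 1ℤ) -ᶻ (n -ᶻ n) ≡ τ *ᶻ M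
    lem′ = solve-∀
    at-0 : ∀ n τ a → n ≡ (τ -ᶻ a *ᶻ 0ℤ) +ᶻ 1ℤ *ᶻ (n -ᶻ τ)
    at-0 = solve-∀
    pointwise : ∀ v → v ≡ 0# ⊎ ¬ v ≡ 0# → S v ≡ (τ -ᶻ (τ *ᶻ pos K) *ᶻ sp v) +ᶻ δ v *ᶻ (pos n -ᶻ τ)
    pointwise v (inj₁ refl) = trans S-0 (trans (at-0 (pos n) τ (τ *ᶻ pos K))
      (sym (cong₂ (λ a b → (τ -ᶻ (τ *ᶻ pos K) *ᶻ a) +ᶻ b *ᶻ (pos n -ᶻ τ)) sp-0 (δ-≡0 refl))))
    pointwise v (inj₂ v≢0) = trans (S-value v≢0) (trans (sym (ℤₚ.+-identityʳ _))
      (cong (λ a → (τ -ᶻ (τ *ᶻ pos K) *ᶻ sp v) +ᶻ a *ᶻ (pos n -ᶻ τ)) (sym (δ-≢0 v≢0))))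
    ∑-S′ : ∑ S ≡ (pos n *ᶻ τ -ᶻ (τ *ᶻ pos K) *ᶻ ∑ sp) +ᶻ (pos n -ᶻ τ)
    ∑-S′ = begin
      ∑ S ≡⟨ ∑-cong (λ v → pointwise v (toSum (v ≟ᶠ 0#))) ⟩
      ∑ (λ v → (τ -ᶻ (τ *ᶻ pos K) *ᶻ sp v) +ᶻ δ v *ᶻ (pos n -ᶻ τ)) ≡⟨ ∑-+ _ _ ⟩
      ∑ (λ v → τ -ᶻ (τ *ᶻ pos K) *ᶻ sp v) +ᶻ ∑ (λ v → δ v *ᶻ (pos n -ᶻ τ))
        ≡⟨ cong₂ _+ᶻ_ (trans (∑-- _ _) (cong₂ _-ᶻ_ (∑-const τ) (∑-*ˡ (τ *ᶻ pos K) sp))) (∑-δ-0 (λ _ → pos n -ᶻ τ)) ⟩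
      (pos n *ᶻ τ -ᶻ (τ *ᶻ pos K) *ᶻ ∑ sp) +ᶻ (pos n -ᶻ τ) ∎

  -- For special v the element w = v z^K satisfies w^P = -w, so the quotient of two such lies in 𝔽_P,
  -- whose nonzero elements are K-th powers.
  special-coset : ∀ {v v′} → Special v → Special v′ → Σ Carrier (λ y → ¬ y ≡ 0# × v′ ≡ v *ᶠ y ^ᶠ K)
  special-coset {v} {v′} (v≢0 , z , z≢0 , e) (v′≢0 , z′ , z′≢0 , e′) = y , y≢0 , v′≡vy^K
    where
    w  = v *ᶠ z ^ᶠ K
    w′ = v′ *ᶠ z′ ^ᶠ K
    w≢0 : ¬ w ≡ 0#
    w≢0 = *-≢0 v≢0 (^-≢0 K z≢0)
    w⁻¹ = proj₁ (inverse w w≢0)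
    c = w⁻¹ *ᶠ w′
    wc≡w′ : w *ᶠ c ≡ w′
    wc≡w′ = trans (sym (R.*-assoc _ _ w′)) (trans (cong (_*ᶠ w′) (proj₂ (inverse w w≢0))) (R.*-identityˡ w′))
    c≢0 : ¬ c ≡ 0#
    c≢0 = *-≢0ʳ (λ e₀ → *-≢0 v′≢0 (^-≢0 K z′≢0) (trans (sym wc≡w′) e₀))
    c∈ : 𝔽P.Fq c
    c∈ = *-cancelˡ w≢0 (Rₚ.-‿injective (begin
      -ᶠ (w *ᶠ c ^ᶠ P) ≡⟨ Rₚ.-‿distribˡ-* w _ ⟩
      (-ᶠ w) *ᶠ c ^ᶠ P ≡⟨ cong (_*ᶠ c ^ᶠ P) (β≡0⇒^P≡- e) ⟨
      w ^ᶠ P *ᶠ c ^ᶠ P ≡⟨ *-^ w c P ⟨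
      (w *ᶠ c) ^ᶠ P ≡⟨ cong (_^ᶠ P) wc≡w′ ⟩
      w′ ^ᶠ P ≡⟨ β≡0⇒^P≡- e′ ⟩
      -ᶠ w′ ≡⟨ cong -ᶠ_ wc≡w′ ⟨
      -ᶠ (w *ᶠ c) ∎))
    k = proj₁ (𝔽P.Fq-log c≢0 c∈)
    g = γ ^ᶠ (h₂ * k)
    c≡g^K : c ≡ g ^ᶠ K
    c≡g^K = trans (proj₂ (𝔽P.Fq-log c≢0 c∈)) (trans (cong (γ ^ᶠ_) (begin
      h₂ * K * k ≡⟨ ℕₚ.*-assoc h₂ K k ⟩
      h₂ * (K * k) ≡⟨ cong (h₂ *_) (ℕₚ.*-comm K k) ⟩
      h₂ * (k * K) ≡⟨ ℕₚ.*-assoc h₂ k K ⟨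
      h₂ * k * K ∎)) (^-* γ (h₂ * k) K))
    z′⁻¹ = proj₁ (inverse z′ z′≢0)
    y = z′⁻¹ *ᶠ (z *ᶠ g)
    z′y≡zg : z′ *ᶠ y ≡ z *ᶠ g
    z′y≡zg = trans (sym (R.*-assoc _ _ _)) (trans (cong (_*ᶠ (z *ᶠ g)) (proj₂ (inverse z′ z′≢0))) (R.*-identityˡ _))
    y≢0 : ¬ y ≡ 0#
    y≢0 = *-≢0ʳ (λ e₀ → *-≢0 z≢0 (γ^≢0 (h₂ * k)) (trans (sym z′y≡zg) e₀))
    v′≡vy^K : v′ ≡ v *ᶠ y ^ᶠ K
    v′≡vy^K = *-cancelˡ (^-≢0 K z′≢0) (begin
      z′ ^ᶠ K *ᶠ v′ ≡⟨ R.*-comm _ v′ ⟩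
      w′ ≡⟨ wc≡w′ ⟨
      v *ᶠ z ^ᶠ K *ᶠ c ≡⟨ cong (v *ᶠ z ^ᶠ K *ᶠ_) c≡g^K ⟩
      v *ᶠ z ^ᶠ K *ᶠ g ^ᶠ K ≡⟨ R.*-assoc v _ _ ⟩
      v *ᶠ (z ^ᶠ K *ᶠ g ^ᶠ K)
        ≡⟨ cong (v *ᶠ_) (trans (sym (*-^ z g K)) (trans (cong (_^ᶠ K) (sym z′y≡zg)) (*-^ z′ y K))) ⟩
      v *ᶠ (z′ ^ᶠ K *ᶠ y ^ᶠ K) ≡⟨ *-swapˡ v _ _ ⟩
      z′ ^ᶠ K *ᶠ (v *ᶠ y ^ᶠ K) ∎)

-- Integer arithmetic excluding the degenerate positions of D relative to hyperplanes.

pos-∸1 : ∀ {k} → 1 ≤ k → pos k -ᶻ 1ℤ ≡ pos (k ∸ 1)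
pos-∸1 {suc k} _ = lem (pos k)
  where
  lem : ∀ x → (1ℤ +ᶻ x) -ᶻ 1ℤ ≡ x
  lem = solve-∀

pos-∸ : ∀ {j k} → k ≤ j → pos j -ᶻ pos k ≡ pos (j ∸ k)
pos-∸ {j} {k} k≤j = trans (ℤₚ.m-n≡m⊖n j k) (ℤₚ.⊖-≥ k≤j)

pos+pos≢0 : ∀ {a b} → 1 ≤ a → ¬ pos a ≡ -ᶻ pos b
pos+pos≢0 {suc a} {zero}  _ ()
pos+pos≢0 {suc a} {suc b} _ ()

Bit : ℤ → Set
Bit ε = ε ≡ 0ℤ ⊎ ε ≡ 1ℤ

Bit⇒ℕ : ∀ {ε} → Bit ε → Σ ℕ (λ b → b ≤ 1 × ε ≡ pos b)
Bit⇒ℕ (inj₁ e) = 0 , z≤n , e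
Bit⇒ℕ (inj₂ e) = 1 , s≤s z≤n , e

module WeightArithmetic (N u q s : ℕ) (u<N : u < N) (2≤q : 2 ≤ q) (q<s : q < s) (τ : ℤ) where

  Parameters : Set
  Parameters = (τ ≡ -ᶻ pos s × ¬ u * (s + 1) ≡ s * N × N < u * (s + 1)) ⊎
               (τ ≡ pos s × (q ∸ 1) * s * N < u * ((s + q) * (s ∸ 1)))

  -- w stands for |D ∩ H| with H the hyperplane tr(v x) = 0, and ε records whether D contains the x with v x special.
  Weight : ℤ → ℤ → Set
  Weight w ε = pos N *ᶻ (pos q *ᶻ w) ≡
               pos u *ᶻ ((τ -ᶻ 1ℤ) *ᶻ (τ +ᶻ pos q)) -ᶻ pos N *ᶻ ((pos q -ᶻ 1ℤ) *ᶻ (τ *ᶻ ε))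

  Size : ℤ → Set
  Size D = pos N *ᶻ D ≡ pos u *ᶻ (τ *ᶻ τ -ᶻ 1ℤ)

  private
    1≤q : 1 ≤ q
    1≤q = ℕₚ.<⇒≤ 2≤q

    2≤s : 2 ≤ s
    2≤s = ℕₚ.≤-trans 2≤q (ℕₚ.<⇒≤ q<s)

    1≤s : 1 ≤ s
    1≤s = ℕₚ.<⇒≤ 2≤s

    1≤s-1 : 1 ≤ s ∸ 1
    1≤s-1 = ℕₚ.m<n⇒0<n∸m 2≤s

    1≤N : 1 ≤ N
    1≤N = ℕₚ.≤-trans (s≤s z≤n) u<N

    N-cancel : ∀ {a b} → pos N *ᶻ a ≡ pos N *ᶻ b → a ≡ b
    N-cancel {a} {b} = ℤₚ.*-cancelˡ-≡ (pos N) a b {{ℕ.>-nonZero 1≤N}}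

    [q-1]-cancel : ∀ {a b} → (pos q -ᶻ 1ℤ) *ᶻ a ≡ (pos q -ᶻ 1ℤ) *ᶻ b → a ≡ b
    [q-1]-cancel {a} {b} e = ℤₚ.*-cancelˡ-≡ (pos (q ∸ 1)) a b {{ℕ.>-nonZero (ℕₚ.m<n⇒0<n∸m 2≤q)}}
      (subst (λ z → z *ᶻ a ≡ z *ᶻ b) (pos-∸1 1≤q) e)

  τ≡±s : Parameters → τ ≡ -ᶻ pos s ⊎ τ ≡ pos s
  τ≡±s (inj₁ (e , _)) = inj₁ e
  τ≡±s (inj₂ (e , _)) = inj₂ e

  private
    τ-cancel : Parameters → ∀ {a b} → τ *ᶻ a ≡ τ *ᶻ b → a ≡ b
    τ-cancel P {a} {b} e with τ≡±s P
    ... | inj₂ refl = ℤₚ.*-cancelˡ-≡ (pos s) a b {{ℕ.>-nonZero 1≤s}} e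
    ... | inj₁ refl = ℤₚ.*-cancelˡ-≡ (pos s) a b {{ℕ.>-nonZero 1≤s}} (ℤₚ.neg-injective (begin
      -ᶻ (pos s *ᶻ a) ≡⟨ ℤₚ.neg-distribˡ-* (pos s) a ⟩
      -ᶻ pos s *ᶻ a ≡⟨ e ⟩
      -ᶻ pos s *ᶻ b ≡⟨ ℤₚ.neg-distribˡ-* (pos s) b ⟨
      -ᶻ (pos s *ᶻ b) ∎))

    1≤u : Parameters → 1 ≤ u
    1≤u (inj₁ (_ , _ , N<)) = ℕₚ.n≢0⇒n>0 λ u≡0 → ℕₚ.<⇒≱ N< (subst (λ u → u * (s + 1) ≤ N) (sym u≡0) z≤n)
    1≤u (inj₂ (_ , <u))     = ℕₚ.n≢0⇒n>0 λ u≡0 → ℕₚ.<⇒≱ <u (subst (λ u → u * ((s + q) * (s ∸ 1)) ≤ (q ∸ 1) * s * N) (sym u≡0) z≤n)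

    u*≢N* : ∀ k → 1 ≤ k → ¬ pos u *ᶻ pos k ≡ pos N *ᶻ pos k
    u*≢N* k 1≤k e = ℕₚ.<⇒≢ u<N (ℕₚ.*-cancelʳ-≡ u N k {{ℕ.>-nonZero 1≤k}}
      (ℤₚ.+-injective (trans (ℤₚ.pos-* u k) (trans e (sym (ℤₚ.pos-* N k))))))

    negate-factors : ∀ u N x y → u *ᶻ (-ᶻ x -ᶻ 1ℤ) ≡ N *ᶻ (-ᶻ x -ᶻ y) → u *ᶻ (x +ᶻ 1ℤ) ≡ N *ᶻ (x +ᶻ y)
    negate-factors u N x y e = ℤₚ.neg-injective (trans (lem u x 1ℤ) (trans e (sym (lem N x y))))
      where
      lem : ∀ u x y → -ᶻ (u *ᶻ (x +ᶻ y)) ≡ u *ᶻ (-ᶻ x -ᶻ y)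
      lem = solve-∀

    complement-eq : Parameters → ∀ {w D ε} → Weight w ε → Size D →
      pos q *ᶻ w ≡ pos q *ᶻ D -ᶻ pos q *ᶻ (τ *ᶻ τ) +ᶻ τ *ᶻ τ → pos u *ᶻ (τ -ᶻ 1ℤ) ≡ pos N *ᶻ (τ -ᶻ ε)
    complement-eq P {w} {D} {ε} weight size qw = τ-cancel P ([q-1]-cancel (begin
      (pos q -ᶻ 1ℤ) *ᶻ (τ *ᶻ (pos u *ᶻ (τ -ᶻ 1ℤ))) ≡⟨ lem₁ (pos N) (pos u) (pos q) τ ε ⟩
      pos q *ᶻ (pos u *ᶻ (τ *ᶻ τ -ᶻ 1ℤ)) -ᶻ (pos u *ᶻ ((τ -ᶻ 1ℤ) *ᶻ (τ +ᶻ pos q)) -ᶻ pos N *ᶻ ((pos q -ᶻ 1ℤ) *ᶻ (τ *ᶻ ε)))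
        -ᶻ pos N *ᶻ ((pos q -ᶻ 1ℤ) *ᶻ (τ *ᶻ ε))
          ≡⟨ cong₂ (λ a b → pos q *ᶻ a -ᶻ b -ᶻ pos N *ᶻ ((pos q -ᶻ 1ℤ) *ᶻ (τ *ᶻ ε))) (sym size) (trans (sym weight) (cong (pos N *ᶻ_) qw)) ⟩
      pos q *ᶻ (pos N *ᶻ D) -ᶻ pos N *ᶻ (pos q *ᶻ D -ᶻ pos q *ᶻ (τ *ᶻ τ) +ᶻ τ *ᶻ τ)
        -ᶻ pos N *ᶻ ((pos q -ᶻ 1ℤ) *ᶻ (τ *ᶻ ε)) ≡⟨ lem₂ (pos N) (pos q) τ ε D ⟩
      (pos q -ᶻ 1ℤ) *ᶻ (τ *ᶻ (pos N *ᶻ (τ -ᶻ ε))) ∎))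
      where
      lem₁ : ∀ N u q τ ε → (q -ᶻ 1ℤ) *ᶻ (τ *ᶻ (u *ᶻ (τ -ᶻ 1ℤ))) ≡
             q *ᶻ (u *ᶻ (τ *ᶻ τ -ᶻ 1ℤ)) -ᶻ (u *ᶻ ((τ -ᶻ 1ℤ) *ᶻ (τ +ᶻ q)) -ᶻ N *ᶻ ((q -ᶻ 1ℤ) *ᶻ (τ *ᶻ ε))) -ᶻ N *ᶻ ((q -ᶻ 1ℤ) *ᶻ (τ *ᶻ ε))
      lem₁ = solve-∀
      lem₂ : ∀ N q τ ε D → q *ᶻ (N *ᶻ D) -ᶻ N *ᶻ (q *ᶻ D -ᶻ q *ᶻ (τ *ᶻ τ) +ᶻ τ *ᶻ τ) -ᶻ N *ᶻ ((q -ᶻ 1ℤ) *ᶻ (τ *ᶻ ε)) ≡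
             (q -ᶻ 1ℤ) *ᶻ (τ *ᶻ (N *ᶻ (τ -ᶻ ε)))
      lem₂ = solve-∀

    contained-eq : Parameters → ∀ {D ε} → Weight D ε → Size D → pos u *ᶻ (τ -ᶻ 1ℤ) ≡ -ᶻ (pos N *ᶻ ε)
    contained-eq P {D} {ε} weight size = τ-cancel P ([q-1]-cancel (begin
      (pos q -ᶻ 1ℤ) *ᶻ (τ *ᶻ (pos u *ᶻ (τ -ᶻ 1ℤ))) ≡⟨ lem₁ (pos N) (pos u) (pos q) τ ε ⟩
      pos q *ᶻ (pos u *ᶻ (τ *ᶻ τ -ᶻ 1ℤ)) -ᶻ (pos u *ᶻ ((τ -ᶻ 1ℤ) *ᶻ (τ +ᶻ pos q)) -ᶻ pos N *ᶻ ((pos q -ᶻ 1ℤ) *ᶻ (τ *ᶻ ε)))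
        -ᶻ pos N *ᶻ ((pos q -ᶻ 1ℤ) *ᶻ (τ *ᶻ ε))
          ≡⟨ cong₂ (λ a b → pos q *ᶻ a -ᶻ b -ᶻ pos N *ᶻ ((pos q -ᶻ 1ℤ) *ᶻ (τ *ᶻ ε))) (sym size) (sym weight) ⟩
      pos q *ᶻ (pos N *ᶻ D) -ᶻ pos N *ᶻ (pos q *ᶻ D)
        -ᶻ pos N *ᶻ ((pos q -ᶻ 1ℤ) *ᶻ (τ *ᶻ ε)) ≡⟨ lem₂ (pos N) (pos q) τ ε D ⟩
      (pos q -ᶻ 1ℤ) *ᶻ (τ *ᶻ -ᶻ (pos N *ᶻ ε)) ∎))
      where
      lem₁ : ∀ N u q τ ε → (q -ᶻ 1ℤ) *ᶻ (τ *ᶻ (u *ᶻ (τ -ᶻ 1ℤ))) ≡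
             q *ᶻ (u *ᶻ (τ *ᶻ τ -ᶻ 1ℤ)) -ᶻ (u *ᶻ ((τ -ᶻ 1ℤ) *ᶻ (τ +ᶻ q)) -ᶻ N *ᶻ ((q -ᶻ 1ℤ) *ᶻ (τ *ᶻ ε))) -ᶻ N *ᶻ ((q -ᶻ 1ℤ) *ᶻ (τ *ᶻ ε))
      lem₁ = solve-∀
      lem₂ : ∀ N q τ ε D → q *ᶻ (N *ᶻ D) -ᶻ N *ᶻ (q *ᶻ D) -ᶻ N *ᶻ ((q -ᶻ 1ℤ) *ᶻ (τ *ᶻ ε)) ≡ (q -ᶻ 1ℤ) *ᶻ (τ *ᶻ -ᶻ (N *ᶻ ε))
      lem₂ = solve-∀

  -- The last equation is what `w` would satisfy if the hyperplane covered the complement; it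
  -- reduces to u (τ - 1) = N (τ - ε). For τ = -s and ε = 0 this is the excluded value u (s + 1) = s
  -- N; in the other cases u would be at least `N`.
  complement⊄hyperplane : Parameters → ∀ {w D ε} → Bit ε → Weight w ε → Size D →
    ¬ pos q *ᶻ w ≡ pos q *ᶻ D -ᶻ pos q *ᶻ (τ *ᶻ τ) +ᶻ τ *ᶻ τ
  complement⊄hyperplane P@(inj₁ (refl , u[s+1]≢sN , _)) (inj₁ refl) weight size e = u[s+1]≢sN (trans
    (ℤₚ.+-injective (trans (ℤₚ.pos-* u (s + 1)) (trans (negate-factors (pos u) (pos N) (pos s) 0ℤ (complement-eq P weight size e))
      (trans (cong (pos N *ᶻ_) (ℤₚ.+-identityʳ (pos s))) (sym (ℤₚ.pos-* N s))))))
    (ℕₚ.*-comm N s))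
  complement⊄hyperplane P@(inj₁ (refl , _)) (inj₂ refl) weight size e =
    u*≢N* (s + 1) (ℕₚ.m≤n+m 1 s) (negate-factors (pos u) (pos N) (pos s) 1ℤ (complement-eq P weight size e))
  complement⊄hyperplane P@(inj₂ (refl , _)) (inj₁ refl) weight size e =
    ℕₚ.<⇒≢ (ℕₚ.*-mono-< u<N (ℕₚ.∸-monoʳ-< (s≤s z≤n) 1≤s)) (ℤₚ.+-injective (begin
      pos (u * (s ∸ 1)) ≡⟨ ℤₚ.pos-* u (s ∸ 1) ⟩
      pos u *ᶻ pos (s ∸ 1) ≡⟨ cong (pos u *ᶻ_) (pos-∸1 1≤s) ⟨
      pos u *ᶻ (pos s -ᶻ 1ℤ) ≡⟨ complement-eq P weight size e ⟩
      pos N *ᶻ (pos s -ᶻ 0ℤ) ≡⟨ cong (pos N *ᶻ_) (ℤₚ.+-identityʳ (pos s)) ⟩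
      pos N *ᶻ pos s ≡⟨ ℤₚ.pos-* N s ⟨
      pos (N * s) ∎))
  complement⊄hyperplane P@(inj₂ (refl , _)) (inj₂ refl) weight size e =
    u*≢N* (s ∸ 1) 1≤s-1 (subst (λ z → pos u *ᶻ z ≡ pos N *ᶻ z) (pos-∸1 1≤s) (complement-eq P weight size e))

  -- Taking the weight equal to the size gives u (τ - 1) = -N ε. For τ = -s this reads u (s + 1) = N
  -- ε, against N < u (s + 1); for τ = s the left side is positive.
  ⊄hyperplane : Parameters → ∀ {D ε} → Bit ε → Size D → ¬ Weight D ε
  ⊄hyperplane P@(inj₁ (refl , _ , N<u[s+1])) bit size weight = go bit
    where
    flipped : ∀ ε → pos u *ᶻ (-ᶻ pos s -ᶻ 1ℤ) ≡ -ᶻ (pos N *ᶻ ε) → pos (u * (s + 1)) ≡ pos N *ᶻ ε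
    flipped ε e = ℤₚ.neg-injective (trans (cong -ᶻ_ (ℤₚ.pos-* u (s + 1))) (trans (lem (pos u) (pos s)) e))
      where
      lem : ∀ u s → -ᶻ (u *ᶻ (s +ᶻ 1ℤ)) ≡ u *ᶻ (-ᶻ s -ᶻ 1ℤ)
      lem = solve-∀
    go : ∀ {ε} → Bit ε → ⊥
    go _ = contra bit (flipped _ (contained-eq P weight size))
      where
      contra : ∀ {ε} → Bit ε → ¬ pos (u * (s + 1)) ≡ pos N *ᶻ ε
      contra (inj₁ refl) e = ℕₚ.<⇒≢ (ℕₚ.*-mono-≤ (1≤u P) (ℕₚ.m≤n+m 1 s)) (sym (ℤₚ.+-injective (trans e (ℤₚ.*-zeroʳ (pos N)))))
      contra (inj₂ refl) e = ℕₚ.<⇒≢ N<u[s+1] (sym (ℤₚ.+-injective (trans e (ℤₚ.*-identityʳ (pos N)))))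
  ⊄hyperplane P@(inj₂ (refl , _)) bit size weight = let b , _ , ε≡b = Bit⇒ℕ bit in
    pos+pos≢0 (ℕₚ.*-mono-≤ (1≤u P) 1≤s-1) (begin
      pos (u * (s ∸ 1)) ≡⟨ trans (ℤₚ.pos-* u (s ∸ 1)) (cong (pos u *ᶻ_) (sym (pos-∸1 1≤s))) ⟩
      pos u *ᶻ (pos s -ᶻ 1ℤ) ≡⟨ contained-eq P weight size ⟩
      -ᶻ (pos N *ᶻ _) ≡⟨ cong -ᶻ_ (trans (cong (pos N *ᶻ_) ε≡b) (sym (ℤₚ.pos-* N b))) ⟩
      -ᶻ pos (N * b) ∎)

  -- Weight zero means u (τ - 1)(τ + q) = N (q - 1) τ ε. For τ = -s the sides have opposite signs
  -- because q < s; for τ = s the lower bound on `u` in the even case is exactly the negation of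
  -- this with ε ≤ 1.
  meets-hyperplane : Parameters → ∀ {ε} → Bit ε → ¬ Weight 0ℤ ε
  meets-hyperplane P {ε} bit weight = contra P (Bit⇒ℕ bit)
    where
    eq : pos u *ᶻ ((τ -ᶻ 1ℤ) *ᶻ (τ +ᶻ pos q)) ≡ pos N *ᶻ ((pos q -ᶻ 1ℤ) *ᶻ (τ *ᶻ ε))
    eq = ℤₚ.i-j≡0⇒i≡j _ _ (trans (sym weight) (lem (pos N) (pos q)))
      where
      lem : ∀ N q → N *ᶻ (q *ᶻ 0ℤ) ≡ 0ℤ
      lem = solve-∀
    contra : Parameters → ¬ Σ ℕ (λ b → b ≤ 1 × ε ≡ pos b)
    contra (inj₁ (refl , _)) (b , _ , refl) = pos+pos≢0 (ℕₚ.*-mono-≤ (1≤u P) (ℕₚ.*-mono-≤ (ℕₚ.m≤n+m 1 s) (ℕₚ.m<n⇒0<n∸m q<s))) (begin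
      pos (u * ((s + 1) * (s ∸ q)))
        ≡⟨ trans (ℤₚ.pos-* u _) (cong (pos u *ᶻ_) (trans (ℤₚ.pos-* (s + 1) (s ∸ q)) (cong (pos (s + 1) *ᶻ_) (sym (pos-∸ (ℕₚ.<⇒≤ q<s)))))) ⟩
      pos u *ᶻ ((pos s +ᶻ 1ℤ) *ᶻ (pos s -ᶻ pos q)) ≡⟨ lem₁ (pos u) (pos s) (pos q) ⟩
      pos u *ᶻ ((-ᶻ pos s -ᶻ 1ℤ) *ᶻ (-ᶻ pos s +ᶻ pos q)) ≡⟨ eq ⟩
      pos N *ᶻ ((pos q -ᶻ 1ℤ) *ᶻ (-ᶻ pos s *ᶻ pos b)) ≡⟨ lem₂ (pos N) (pos q -ᶻ 1ℤ) (pos s) (pos b) ⟩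
      -ᶻ (pos N *ᶻ ((pos q -ᶻ 1ℤ) *ᶻ (pos s *ᶻ pos b))) ≡⟨ cong -ᶻ_ (rhs b) ⟩
      -ᶻ pos (N * ((q ∸ 1) * (s * b))) ∎)
      where
      lem₁ : ∀ u s q → u *ᶻ ((s +ᶻ 1ℤ) *ᶻ (s -ᶻ q)) ≡ u *ᶻ ((-ᶻ s -ᶻ 1ℤ) *ᶻ (-ᶻ s +ᶻ q))
      lem₁ = solve-∀
      lem₂ : ∀ N q s b → N *ᶻ (q *ᶻ (-ᶻ s *ᶻ b)) ≡ -ᶻ (N *ᶻ (q *ᶻ (s *ᶻ b)))
      lem₂ = solve-∀
      rhs : ∀ b → pos N *ᶻ ((pos q -ᶻ 1ℤ) *ᶻ (pos s *ᶻ pos b)) ≡ pos (N * ((q ∸ 1) * (s * b)))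
      rhs b = trans (cong (pos N *ᶻ_) (trans (cong₂ _*ᶻ_ (pos-∸1 1≤q) (sym (ℤₚ.pos-* s b))) (sym (ℤₚ.pos-* (q ∸ 1) _)))) (sym (ℤₚ.pos-* N _))
    contra (inj₂ (refl , <u)) (b , b≤1 , refl) = ℕₚ.<⇒≱ <u (begin-≤ (ℤₚ.+-injective (begin
      pos (u * ((s + q) * (s ∸ 1)))
        ≡⟨ trans (ℤₚ.pos-* u _) (cong (pos u *ᶻ_) (trans (ℤₚ.pos-* (s + q) (s ∸ 1)) (cong (pos (s + q) *ᶻ_) (sym (pos-∸1 1≤s))))) ⟩
      pos u *ᶻ ((pos s +ᶻ pos q) *ᶻ (pos s -ᶻ 1ℤ)) ≡⟨ cong (pos u *ᶻ_) (ℤₚ.*-comm (pos s +ᶻ pos q) (pos s -ᶻ 1ℤ)) ⟩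
      pos u *ᶻ ((pos s -ᶻ 1ℤ) *ᶻ (pos s +ᶻ pos q)) ≡⟨ eq ⟩
      pos N *ᶻ ((pos q -ᶻ 1ℤ) *ᶻ (pos s *ᶻ pos b)) ≡⟨ rearrange (pos N) (pos q -ᶻ 1ℤ) (pos s) (pos b) ⟩
      ((pos q -ᶻ 1ℤ) *ᶻ pos s *ᶻ pos N) *ᶻ pos b ≡⟨ cong (λ z → (z *ᶻ pos s *ᶻ pos N) *ᶻ pos b) (pos-∸1 1≤q) ⟩
      (pos (q ∸ 1) *ᶻ pos s *ᶻ pos N) *ᶻ pos b ≡⟨ cong (λ z → (z *ᶻ pos N) *ᶻ pos b) (ℤₚ.pos-* (q ∸ 1) s) ⟨
      (pos ((q ∸ 1) * s) *ᶻ pos N) *ᶻ pos b ≡⟨ cong (_*ᶻ pos b) (ℤₚ.pos-* ((q ∸ 1) * s) N) ⟨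
      pos ((q ∸ 1) * s * N) *ᶻ pos b ≡⟨ ℤₚ.pos-* ((q ∸ 1) * s * N) b ⟨
      pos ((q ∸ 1) * s * N * b) ∎)))
      where
      rearrange : ∀ N q s b → N *ᶻ (q *ᶻ (s *ᶻ b)) ≡ (q *ᶻ s *ᶻ N) *ᶻ b
      rearrange = solve-∀
      begin-≤ : u * ((s + q) * (s ∸ 1)) ≡ (q ∸ 1) * s * N * b → u * ((s + q) * (s ∸ 1)) ≤ (q ∸ 1) * s * N
      begin-≤ e = ℕₚ.≤-trans (ℕₚ.≤-reflexive e) (ℕₚ.≤-trans (ℕₚ.*-monoʳ-≤ ((q ∸ 1) * s * N) b≤1) (ℕₚ.≤-reflexive (ℕₚ.*-identityʳ _)))

  -- Two weights differ only through their bits, so a gap of (q - 1) τ² / q² would force τ = q (ε′ -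
  -- ε), whereas |τ| = s > q.
  weight-gap : Parameters → ∀ {w w′ ε ε′} → Bit ε → Bit ε′ → Weight w ε → Weight w′ ε′ →
    ¬ pos q *ᶻ (pos q *ᶻ (w -ᶻ w′)) ≡ pos q *ᶻ (τ *ᶻ τ) -ᶻ τ *ᶻ τ
  weight-gap P {w} {w′} {ε} {ε′} bit bit′ weight weight′ gap = contra (τ≡±s P) bit bit′ τ≡q[ε′-ε]
    where
    lem₁ : ∀ N q τ → N *ᶻ ((q -ᶻ 1ℤ) *ᶻ (τ *ᶻ τ)) ≡ N *ᶻ (q *ᶻ (τ *ᶻ τ) -ᶻ τ *ᶻ τ)
    lem₁ = solve-∀
    lem₂ : ∀ N q w w′ → N *ᶻ (q *ᶻ (q *ᶻ (w -ᶻ w′))) ≡ q *ᶻ (N *ᶻ (q *ᶻ w) -ᶻ N *ᶻ (q *ᶻ w′))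
    lem₂ = solve-∀
    lem₃ : ∀ q X N c τ ε ε′ → q *ᶻ ((X -ᶻ N *ᶻ (c *ᶻ (τ *ᶻ ε))) -ᶻ (X -ᶻ N *ᶻ (c *ᶻ (τ *ᶻ ε′)))) ≡
           N *ᶻ (c *ᶻ (τ *ᶻ (q *ᶻ (ε′ -ᶻ ε))))
    lem₃ = solve-∀
    τ≡q[ε′-ε] : τ ≡ pos q *ᶻ (ε′ -ᶻ ε)
    τ≡q[ε′-ε] = τ-cancel P ([q-1]-cancel (N-cancel (begin
      pos N *ᶻ ((pos q -ᶻ 1ℤ) *ᶻ (τ *ᶻ τ)) ≡⟨ lem₁ (pos N) (pos q) τ ⟩
      pos N *ᶻ (pos q *ᶻ (τ *ᶻ τ) -ᶻ τ *ᶻ τ) ≡⟨ cong (pos N *ᶻ_) gap ⟨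
      pos N *ᶻ (pos q *ᶻ (pos q *ᶻ (w -ᶻ w′))) ≡⟨ lem₂ (pos N) (pos q) w w′ ⟩
      pos q *ᶻ (pos N *ᶻ (pos q *ᶻ w) -ᶻ pos N *ᶻ (pos q *ᶻ w′)) ≡⟨ cong (pos q *ᶻ_) (cong₂ _-ᶻ_ weight weight′) ⟩
      pos q *ᶻ ((pos u *ᶻ ((τ -ᶻ 1ℤ) *ᶻ (τ +ᶻ pos q)) -ᶻ pos N *ᶻ ((pos q -ᶻ 1ℤ) *ᶻ (τ *ᶻ ε))) -ᶻ
                (pos u *ᶻ ((τ -ᶻ 1ℤ) *ᶻ (τ +ᶻ pos q)) -ᶻ pos N *ᶻ ((pos q -ᶻ 1ℤ) *ᶻ (τ *ᶻ ε′))))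
                      ≡⟨ lem₃ (pos q) (pos u *ᶻ ((τ -ᶻ 1ℤ) *ᶻ (τ +ᶻ pos q))) (pos N) (pos q -ᶻ 1ℤ) τ ε ε′ ⟩
      pos N *ᶻ ((pos q -ᶻ 1ℤ) *ᶻ (τ *ᶻ (pos q *ᶻ (ε′ -ᶻ ε)))) ∎)))
    ∣τ∣≡s : τ ≡ -ᶻ pos s ⊎ τ ≡ pos s → ℤ.∣ τ ∣ ≡ s
    ∣τ∣≡s (inj₁ refl) = ℤₚ.∣-i∣≡∣i∣ (pos s)
    ∣τ∣≡s (inj₂ refl) = refl
    bits : ∀ {ε ε′} → Bit ε → Bit ε′ → ℤ.∣ ε′ -ᶻ ε ∣ ≤ 1
    bits (inj₁ refl) (inj₁ refl) = z≤n
    bits (inj₁ refl) (inj₂ refl) = s≤s z≤n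
    bits (inj₂ refl) (inj₁ refl) = s≤s z≤n
    bits (inj₂ refl) (inj₂ refl) = z≤n
    contra : τ ≡ -ᶻ pos s ⊎ τ ≡ pos s → Bit ε → Bit ε′ → ¬ τ ≡ pos q *ᶻ (ε′ -ᶻ ε)
    contra ± bit bit′ e = ℕₚ.<⇒≱ q<s (subst₂ _≤_ (trans (sym (ℤₚ.abs-* (pos q) (ε′ -ᶻ ε))) (trans (cong ℤ.∣_∣ (sym e)) (∣τ∣≡s ±))) (ℕₚ.*-identityʳ q)
      (ℕₚ.*-monoʳ-≤ q (bits bit bit′)))

  -- Adding the three weights gives u (τ - 1)(τ + 4) = N τ k, where k ≤ 3 is the sum of the bits.
  -- For τ = -s the signs disagree once s > 4. For τ = s, writing s - 1 = g N turns this into A (s +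
  -- 4) = s k with A = u g.
  no-partition : Parameters → q ≡ 2 → 4 < s → (τ ≡ pos s → 8 < s × N ∣ s ∸ 1) →
    ∀ {w₁ w₂ w₃ D ε₁ ε₂ ε₃} → Bit ε₁ → Bit ε₂ → Bit ε₃ → Weight w₁ ε₁ → Weight w₂ ε₂ → Weight w₃ ε₃ → Size D →
    ¬ w₁ +ᶻ w₂ +ᶻ w₃ ≡ D
  no-partition P refl 4<s s-even {w₁} {w₂} {w₃} {D} {ε₁} {ε₂} {ε₃} bit₁ bit₂ bit₃ e₁ e₂ e₃ size sum =
    contra (τ≡±s P) (bits bit₁ bit₂ bit₃)
    where
    lem₁ : ∀ N u τ ε₁ ε₂ ε₃ → u *ᶻ ((τ -ᶻ 1ℤ) *ᶻ (τ +ᶻ (1ℤ +ᶻ 1ℤ +ᶻ 1ℤ +ᶻ 1ℤ))) ≡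
      ((u *ᶻ ((τ -ᶻ 1ℤ) *ᶻ (τ +ᶻ (1ℤ +ᶻ 1ℤ))) -ᶻ N *ᶻ (1ℤ *ᶻ (τ *ᶻ ε₁))) +ᶻ
       (u *ᶻ ((τ -ᶻ 1ℤ) *ᶻ (τ +ᶻ (1ℤ +ᶻ 1ℤ))) -ᶻ N *ᶻ (1ℤ *ᶻ (τ *ᶻ ε₂))) +ᶻ
       (u *ᶻ ((τ -ᶻ 1ℤ) *ᶻ (τ +ᶻ (1ℤ +ᶻ 1ℤ))) -ᶻ N *ᶻ (1ℤ *ᶻ (τ *ᶻ ε₃)))) -ᶻ
      (1ℤ +ᶻ 1ℤ) *ᶻ (u *ᶻ (τ *ᶻ τ -ᶻ 1ℤ)) +ᶻ N *ᶻ (τ *ᶻ (ε₁ +ᶻ ε₂ +ᶻ ε₃))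
    lem₁ = solve-∀
    lem₂ : ∀ N w₁ w₂ w₃ x → (N *ᶻ ((1ℤ +ᶻ 1ℤ) *ᶻ w₁) +ᶻ N *ᶻ ((1ℤ +ᶻ 1ℤ) *ᶻ w₂) +ᶻ N *ᶻ ((1ℤ +ᶻ 1ℤ) *ᶻ w₃)) -ᶻ
      (1ℤ +ᶻ 1ℤ) *ᶻ (N *ᶻ (w₁ +ᶻ w₂ +ᶻ w₃)) +ᶻ x ≡ x
    lem₂ = solve-∀
    eq : pos u *ᶻ ((τ -ᶻ 1ℤ) *ᶻ (τ +ᶻ pos 4)) ≡ pos N *ᶻ (τ *ᶻ (ε₁ +ᶻ ε₂ +ᶻ ε₃))
    eq = begin
      pos u *ᶻ ((τ -ᶻ 1ℤ) *ᶻ (τ +ᶻ pos 4)) ≡⟨ lem₁ (pos N) (pos u) τ ε₁ ε₂ ε₃ ⟩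
      _ ≡⟨ cong₂ (λ a b → a -ᶻ pos 2 *ᶻ b +ᶻ pos N *ᶻ (τ *ᶻ (ε₁ +ᶻ ε₂ +ᶻ ε₃)))
            (cong₂ _+ᶻ_ (cong₂ _+ᶻ_ (sym e₁) (sym e₂)) (sym e₃)) (trans (sym size) (cong (pos N *ᶻ_) (sym sum))) ⟩
      _ ≡⟨ lem₂ (pos N) w₁ w₂ w₃ _ ⟩
      pos N *ᶻ (τ *ᶻ (ε₁ +ᶻ ε₂ +ᶻ ε₃)) ∎
    bits : ∀ {ε₁ ε₂ ε₃} → Bit ε₁ → Bit ε₂ → Bit ε₃ → Σ ℕ (λ k → k ≤ 3 × ε₁ +ᶻ ε₂ +ᶻ ε₃ ≡ pos k)
    bits bit₁ bit₂ bit₃ with Bit⇒ℕ bit₁ | Bit⇒ℕ bit₂ | Bit⇒ℕ bit₃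
    ... | b₁ , l₁ , refl | b₂ , l₂ , refl | b₃ , l₃ , refl = b₁ + b₂ + b₃ , ℕₚ.+-mono-≤ (ℕₚ.+-mono-≤ l₁ l₂) l₃ , refl
    -- The equation forces A < k ≤ 3. Then A = 1 fails as s + 4 < 2 s, and A = 2, k = 3 fails as 2 s
    -- + 8 < 3 s; the latter is the source of the bound 8.
    too-small : ∀ A k → 1 ≤ A → k ≤ 3 → 8 < s → ¬ A * (s + 4) ≡ s * k
    too-small A k 1≤A k≤3 8<s e = go A k 1≤A k≤3 A<k e
      where
      A<k : A < k
      A<k = ℕₚ.≰⇒> λ k≤A → ℕₚ.<⇒≢ (ℕₚ.≤-<-trans (ℕₚ.*-monoʳ-≤ s k≤A)
        (subst (_< A * (s + 4)) (ℕₚ.*-comm A s) (ℕₚ.*-monoʳ-< A {{ℕ.>-nonZero 1≤A}} (ℕₚ.m<m+n s (s≤s (z≤n {3})))))) (sym e)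
      go : ∀ A k → 1 ≤ A → k ≤ 3 → A < k → ¬ A * (s + 4) ≡ s * k
      go 1 k _ _ 2≤k e = ℕₚ.<⇒≢ (ℕₚ.<-≤-trans (subst₂ _<_ (sym (ℕₚ.+-identityʳ (s + 4))) (trans (cong (s +_) (sym (ℕₚ.+-identityʳ s))) (ℕₚ.*-comm 2 s))
        (ℕₚ.+-monoʳ-< s 4<s)) (ℕₚ.*-monoʳ-≤ s 2≤k)) e
      go 2 3 _ _ _ e = ℕₚ.<⇒≢ (subst₂ _<_ (sym (lhs s)) (ℕₚ.*-comm 3 s) (ℕₚ.+-monoʳ-< s (ℕₚ.+-monoʳ-< s (ℕₚ.<-≤-trans 8<s (ℕₚ.≤-reflexive (sym (ℕₚ.+-identityʳ s))))))) e
        where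
        lhs : ∀ s → 2 * (s + 4) ≡ s + (s + 8)
        lhs s = begin
          (s + 4) + ((s + 4) + 0) ≡⟨ cong ((s + 4) +_) (ℕₚ.+-identityʳ (s + 4)) ⟩
          (s + 4) + (s + 4) ≡⟨ ℕₚ.+-assoc s 4 (s + 4) ⟩
          s + (4 + (s + 4)) ≡⟨ cong (s +_) (ℕₚ.+-comm 4 (s + 4)) ⟩
          s + (s + 4 + 4) ≡⟨ cong (s +_) (ℕₚ.+-assoc s 4 4) ⟩
          s + (s + 8) ∎
      go 2 (suc (suc (suc (suc k)))) _ (s≤s (s≤s (s≤s ()))) _ _
      go 2 2 _ _ (s≤s (s≤s ())) _
      go 2 1 _ _ (s≤s ()) _
      go (suc (suc (suc A))) k _ k≤3 A<k e = ℕₚ.<⇒≱ (ℕₚ.≤-trans A<k k≤3) (s≤s (s≤s (s≤s z≤n)))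
    contra : τ ≡ -ᶻ pos s ⊎ τ ≡ pos s → ¬ Σ ℕ (λ k → k ≤ 3 × ε₁ +ᶻ ε₂ +ᶻ ε₃ ≡ pos k)
    contra (inj₁ refl) (k , _ , εs) = pos+pos≢0 (ℕₚ.*-mono-≤ (1≤u P) (ℕₚ.*-mono-≤ (ℕₚ.m≤n+m 1 s) (ℕₚ.m<n⇒0<n∸m 4<s))) (begin
      pos (u * ((s + 1) * (s ∸ 4)))
        ≡⟨ trans (ℤₚ.pos-* u _) (cong (pos u *ᶻ_) (trans (ℤₚ.pos-* (s + 1) (s ∸ 4)) (cong (pos (s + 1) *ᶻ_) (sym (pos-∸ (ℕₚ.<⇒≤ 4<s)))))) ⟩
      pos u *ᶻ ((pos s +ᶻ 1ℤ) *ᶻ (pos s -ᶻ pos 4)) ≡⟨ lem₃ (pos u) (pos s) (pos 4) ⟩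
      pos u *ᶻ ((-ᶻ pos s -ᶻ 1ℤ) *ᶻ (-ᶻ pos s +ᶻ pos 4)) ≡⟨ eq ⟩
      pos N *ᶻ (-ᶻ pos s *ᶻ (ε₁ +ᶻ ε₂ +ᶻ ε₃)) ≡⟨ cong (λ z → pos N *ᶻ (-ᶻ pos s *ᶻ z)) εs ⟩
      pos N *ᶻ (-ᶻ pos s *ᶻ pos k) ≡⟨ lem₄ (pos N) (pos s) (pos k) ⟩
      -ᶻ (pos N *ᶻ (pos s *ᶻ pos k))
        ≡⟨ cong -ᶻ_ (trans (cong (pos N *ᶻ_) (sym (ℤₚ.pos-* s k))) (sym (ℤₚ.pos-* N (s * k)))) ⟩
      -ᶻ pos (N * (s * k)) ∎)
      where
      lem₃ : ∀ u s q → u *ᶻ ((s +ᶻ 1ℤ) *ᶻ (s -ᶻ q)) ≡ u *ᶻ ((-ᶻ s -ᶻ 1ℤ) *ᶻ (-ᶻ s +ᶻ q))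
      lem₃ = solve-∀
      lem₄ : ∀ N s k → N *ᶻ (-ᶻ s *ᶻ k) ≡ -ᶻ (N *ᶻ (s *ᶻ k))
      lem₄ = solve-∀
    contra (inj₂ refl) (k , k≤3 , εs) with s-even refl
    ... | 8<s , divides g s-1≡gN = too-small (u * g) k (ℕₚ.*-mono-≤ (1≤u P) 1≤g) k≤3 8<s
        (ℕₚ.*-cancelˡ-≡ (u * g * (s + 4)) (s * k) N {{ℕ.>-nonZero 1≤N}} (ℤₚ.+-injective (begin
      pos (N * (u * g * (s + 4))) ≡⟨ cong pos rearrange ⟩
      pos (u * (g * N * (s + 4))) ≡⟨ cong (λ z → pos (u * (z * (s + 4)))) s-1≡gN ⟨
      pos (u * ((s ∸ 1) * (s + 4)))
        ≡⟨ trans (ℤₚ.pos-* u _) (cong (pos u *ᶻ_) (trans (ℤₚ.pos-* (s ∸ 1) (s + 4)) (cong (_*ᶻ pos (s + 4)) (sym (pos-∸1 1≤s))))) ⟩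
      pos u *ᶻ ((pos s -ᶻ 1ℤ) *ᶻ (pos s +ᶻ pos 4)) ≡⟨ eq ⟩
      pos N *ᶻ (pos s *ᶻ (ε₁ +ᶻ ε₂ +ᶻ ε₃)) ≡⟨ cong (λ z → pos N *ᶻ (pos s *ᶻ z)) εs ⟩
      pos N *ᶻ (pos s *ᶻ pos k) ≡⟨ trans (cong (pos N *ᶻ_) (sym (ℤₚ.pos-* s k))) (sym (ℤₚ.pos-* N (s * k))) ⟩
      pos (N * (s * k)) ∎)))
      where
      1≤g : 1 ≤ g
      1≤g = ℕₚ.n≢0⇒n>0 λ { refl → ℕₚ.<⇒≢ 1≤s-1 (sym s-1≡gN) }
      rearrange : N * (u * g * (s + 4)) ≡ u * (g * N * (s + 4))
      rearrange = begin
        N * (u * g * (s + 4)) ≡⟨ ℕₚ.*-assoc N (u * g) (s + 4) ⟨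
        N * (u * g) * (s + 4) ≡⟨ cong (_* (s + 4)) (ℕₚ.*-comm N (u * g)) ⟩
        u * g * N * (s + 4) ≡⟨ cong (_* (s + 4)) (ℕₚ.*-assoc u g N) ⟩
        u * (g * N) * (s + 4) ≡⟨ ℕₚ.*-assoc u (g * N) (s + 4) ⟩
        u * (g * N * (s + 4)) ∎

-- Hyperplane sections of a set invariant under `K`-th powers and under scalars of `𝔽q`.

module InvariantSet {n : ℕ} (F : FiniteField n) (M : ℕ) (n≡1+M : n ≡ suc M) (2≤M : 2 ≤ M)
                    (γ : FiniteField.Carrier F) (γ-generates : FiniteField.IsPrimitive F γ)
                    (p ℓ t : ℕ) (p-prime : Prime p) (1≤ℓ : 1 ≤ ℓ) (1≤t : 1 ≤ t) (n≡p^d : n ≡ p ^ (2 * t * ℓ))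
                    (e m h : ℕ) (1≤e : 1 ≤ e) (1≤m : 1 ≤ m) (m*e≡d : m * e ≡ 2 * t * ℓ) (M≡h*[q-1] : M ≡ h * (p ^ e ∸ 1))
                    (D : FiniteField.Carrier F → Bool) (D-0 : D (FiniteField.0# F) ≡ false)
                    (D-^K : ∀ x y → ¬ y ≡ FiniteField.0# F →
                            D (FiniteField._*_ F x (FiniteField._^_ F y (p ^ ℓ + 1))) ≡ D x)
                    (D-Fq : ∀ a x → ¬ a ≡ FiniteField.0# F → FiniteField.InSubfield F (p ^ e) a →
                            D (FiniteField._*_ F a x) ≡ D x) where
  open FieldProperties F
  open SumTo F
  open PrimitiveElement F M n≡1+M 2≤M γ γ-generates
  open Frobenius F p (2 * t * ℓ) p-prime n≡p^d
  open Semiprimitive F M n≡1+M 2≤M γ γ-generates p ℓ t p-prime 1≤ℓ 1≤t n≡p^d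

  q : ℕ
  q = p ^ e

  2≤q : 2 ≤ q
  2≤q = ℕₚ.≤-trans (subst (2 ≤_) (sym (ℕₚ.*-identityʳ p)) 2≤p) (ℕₚ.^-monoʳ-≤ p {{ℕ.>-nonZero 1≤p}} 1≤e)

  n≡q^m : n ≡ q ^ m
  n≡q^m = trans n≡p^d (trans (cong (p ^_) (trans (sym m*e≡d) (ℕₚ.*-comm m e))) (sym (ℕₚ.^-*-assoc p e m)))

  module 𝔽q = Subfield F M n≡1+M 2≤M γ γ-generates q m h 2≤q 1≤m n≡q^m M≡h*[q-1] (frobenius^ e)

  tr-tower : ∀ x → 𝔽p.tr x ≡ Tr p e (𝔽q.tr x)
  tr-tower x = trans (cong (λ k → Tr p k x) (sym m*e≡d)) (Tr-transitive e m x)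

  Tr-0 : Tr p e 0# ≡ 0#
  Tr-0 = trans (sumTo-cong e (λ i _ → 0^ (1≤p^ i))) (sumTo-0 e)

  Fp⊆Fq : ∀ {a} → 𝔽p.Fq a → 𝔽q.Fq a
  Fp⊆Fq a∈ = 𝔽p.Fq-^ a∈ e

  opaque
    E : Carrier → ℤ
    E x = if D x then 1ℤ else 0ℤ

    E-∈ : ∀ {x} → D x ≡ true → E x ≡ 1ℤ
    E-∈ e rewrite e = refl

    E-∉ : ∀ {x} → D x ≡ false → E x ≡ 0ℤ
    E-∉ e rewrite e = refl

    E-D : ∀ {x y} → D x ≡ D y → E x ≡ E y
    E-D = cong (λ b → if b then 1ℤ else 0ℤ)

  D-≢0 : ∀ {x} → D x ≡ true → ¬ x ≡ 0#
  D-≢0 {x} x∈ refl with () ← trans (sym D-0) x∈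

  D-cases : ∀ x → D x ≡ true ⊎ D x ≡ false
  D-cases x with D x
  ... | true  = inj₁ refl
  ... | false = inj₂ refl

  E-*-cong : ∀ x {a b} → (D x ≡ true → a ≡ b) → E x *ᶻ a ≡ E x *ᶻ b
  E-*-cong x {a} {b} f with D-cases x
  ... | inj₁ x∈ = cong (E x *ᶻ_) (f x∈)
  ... | inj₂ x∉ rewrite E-∉ x∉ = refl

  #D : ℤ
  #D = ∑ E

  #D∩H : Carrier → ℤ
  #D∩H v = ∑ (λ x → E x *ᶻ δ (𝔽q.tr (v *ᶠ x)))

  -- The Fourier transform of the indicator of `D`, added up over the nonzero `𝔽p` multiples of v so
  -- as to be an integer.
  W : Carrier → ℤ
  W v = ∑ (λ x → E x *ᶻ φ (v *ᶠ x))

  W-0 : W 0# ≡ (pos p -ᶻ 1ℤ) *ᶻ #D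
  W-0 = begin
    ∑ (λ x → E x *ᶻ φ (0# *ᶠ x)) ≡⟨ ∑-cong (λ x → cong (E x *ᶻ_) (trans (cong φ (R.zeroˡ x)) φ-0)) ⟩
    ∑ (λ x → E x *ᶻ (pos p -ᶻ 1ℤ)) ≡⟨ ∑-*ʳ (pos p -ᶻ 1ℤ) E ⟩
    #D *ᶻ (pos p -ᶻ 1ℤ) ≡⟨ ℤₚ.*-comm #D _ ⟩
    (pos p -ᶻ 1ℤ) *ᶻ #D ∎

  W-scale : ∀ {a} v → ¬ a ≡ 0# → 𝔽q.Fq a → W (a *ᶠ v) ≡ W v
  W-scale {a} v a≢0 a∈ = begin
    ∑ (λ x → E x *ᶻ φ ((a *ᶠ v) *ᶠ x)) ≡⟨ ∑-cong (λ x → cong₂ _*ᶻ_ (E-D (sym (D-Fq a x a≢0 a∈)))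
          (cong φ (trans (R.*-assoc a v x) (*-swapˡ a v x)))) ⟩
    ∑ (λ x → E (a *ᶠ x) *ᶻ φ (v *ᶠ (a *ᶠ x))) ≡⟨ ∑-scale a≢0 (λ x → E x *ᶻ φ (v *ᶠ x)) ⟩
    W v ∎

  W-^K : ∀ {y} v → ¬ y ≡ 0# → ∑ (λ x → E x *ᶻ φ ((v *ᶠ x) *ᶠ y ^ᶠ K)) ≡ W v
  W-^K {y} v y≢0 = begin
    ∑ (λ x → E x *ᶻ φ ((v *ᶠ x) *ᶠ y ^ᶠ K)) ≡⟨ ∑-cong (λ x → cong₂ _*ᶻ_
        (E-D (trans (sym (D-^K x y y≢0)) (cong D (R.*-comm x _))))
        (cong φ (trans (R.*-assoc v x _) (cong (v *ᶠ_) (R.*-comm x _))))) ⟩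
    ∑ (λ x → E (y ^ᶠ K *ᶠ x) *ᶻ φ (v *ᶠ (y ^ᶠ K *ᶠ x))) ≡⟨ ∑-scale (^-≢0 K y≢0) (λ x → E x *ᶻ φ (v *ᶠ x)) ⟩
    W v ∎

  Z : Carrier → ℤ
  Z v = ∑ (λ x → E x *ᶻ sp (v *ᶠ x))

  -- Twisting the argument by y^K with y ≠ 0 does not change `W v`, since `D` absorbs `K`-th powers.
  -- Summing over all y and exchanging the sums brings in `S (v x)` for x in `D`; the row y = 0 is
  -- the correction `X₀`.
  M*W : ∀ {v} → ¬ v ≡ 0# → pos M *ᶻ W v ≡ (pos p -ᶻ 1ℤ) *ᶻ ((τ -ᶻ 1ℤ) *ᶻ #D -ᶻ τ *ᶻ (pos K *ᶻ Z v))
  M*W {v} v≢0 = begin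
    pos M *ᶻ W v ≡⟨ lem₁ (pos M) (W v) X₀ ⟩
    ((1ℤ +ᶻ pos M) *ᶻ W v +ᶻ (X₀ -ᶻ W v)) -ᶻ X₀ ≡⟨ cong (λ z → (z *ᶻ W v +ᶻ (X₀ -ᶻ W v)) -ᶻ X₀) (sym pos-n) ⟩
    (pos n *ᶻ W v +ᶻ (X₀ -ᶻ W v)) -ᶻ X₀ ≡⟨ cong (_-ᶻ X₀) (trans (sym ∑X≡by-rows) ∑X≡by-columns) ⟩
    (pos p -ᶻ 1ℤ) *ᶻ (τ *ᶻ #D -ᶻ (τ *ᶻ pos K) *ᶻ Z v) -ᶻ X₀ ≡⟨ lem₂ (pos p -ᶻ 1ℤ) τ #D (pos K) (Z v) ⟩
    (pos p -ᶻ 1ℤ) *ᶻ ((τ -ᶻ 1ℤ) *ᶻ #D -ᶻ τ *ᶻ (pos K *ᶻ Z v)) ∎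
    where
    X₀ : ℤ
    X₀ = (pos p -ᶻ 1ℤ) *ᶻ #D
    X : Carrier → ℤ
    X y = ∑ (λ x → E x *ᶻ φ ((v *ᶠ x) *ᶠ y ^ᶠ K))
    lem₁ : ∀ M W X → M *ᶻ W ≡ ((1ℤ +ᶻ M) *ᶻ W +ᶻ (X -ᶻ W)) -ᶻ X
    lem₁ = solve-∀
    lem₂ : ∀ c τ D K Z → c *ᶻ (τ *ᶻ D -ᶻ (τ *ᶻ K) *ᶻ Z) -ᶻ c *ᶻ D ≡ c *ᶻ ((τ -ᶻ 1ℤ) *ᶻ D -ᶻ τ *ᶻ (K *ᶻ Z))
    lem₂ = solve-∀
    lem₃ : ∀ X W → X ≡ W +ᶻ 1ℤ *ᶻ (X -ᶻ W)
    lem₃ = solve-∀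
    lem₄ : ∀ c E τ k s → E *ᶻ (c *ᶻ (τ -ᶻ k *ᶻ s)) ≡ c *ᶻ (τ *ᶻ E -ᶻ k *ᶻ (E *ᶻ s))
    lem₄ = solve-∀
    X-row : ∀ y → y ≡ 0# ⊎ ¬ y ≡ 0# → X y ≡ W v +ᶻ δ y *ᶻ (X₀ -ᶻ W v)
    X-row y (inj₁ refl) = begin
      X 0#
        ≡⟨ ∑-cong (λ x → cong (λ z → E x *ᶻ φ z) (trans (cong ((v *ᶠ x) *ᶠ_) (0^ 1≤K)) (trans (R.zeroʳ _) (sym (R.zeroˡ x))))) ⟩
      W 0# ≡⟨ W-0 ⟩
      X₀ ≡⟨ lem₃ X₀ (W v) ⟩
      W v +ᶻ 1ℤ *ᶻ (X₀ -ᶻ W v) ≡⟨ cong (λ z → W v +ᶻ z *ᶻ (X₀ -ᶻ W v)) (δ-≡0 refl) ⟨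
      W v +ᶻ δ 0# *ᶻ (X₀ -ᶻ W v) ∎
    X-row y (inj₂ y≢0) = trans (W-^K v y≢0) (trans (sym (ℤₚ.+-identityʳ (W v)))
      (cong (λ z → W v +ᶻ z *ᶻ (X₀ -ᶻ W v)) (sym (δ-≢0 y≢0))))
    ∑X≡by-rows : ∑ X ≡ pos n *ᶻ W v +ᶻ (X₀ -ᶻ W v)
    ∑X≡by-rows = begin
      ∑ X ≡⟨ ∑-cong (λ y → X-row y (toSum (y ≟ᶠ 0#))) ⟩
      ∑ (λ y → W v +ᶻ δ y *ᶻ (X₀ -ᶻ W v)) ≡⟨ ∑-+ _ _ ⟩
      ∑ (λ _ → W v) +ᶻ ∑ (λ y → δ y *ᶻ (X₀ -ᶻ W v)) ≡⟨ cong₂ _+ᶻ_ (∑-const (W v)) (∑-δ-0 (λ _ → X₀ -ᶻ W v)) ⟩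
      pos n *ᶻ W v +ᶻ (X₀ -ᶻ W v) ∎
    ∑X≡by-columns : ∑ X ≡ (pos p -ᶻ 1ℤ) *ᶻ (τ *ᶻ #D -ᶻ (τ *ᶻ pos K) *ᶻ Z v)
    ∑X≡by-columns = begin
      ∑ X ≡⟨ ∑-swap _ ⟩
      ∑ (λ x → ∑ (λ y → E x *ᶻ φ ((v *ᶠ x) *ᶠ y ^ᶠ K)))
        ≡⟨ ∑-cong (λ x → trans (∑-*ˡ (E x) _) (cong (E x *ᶻ_) (∑-φ-^K (v *ᶠ x)))) ⟩
      ∑ (λ x → E x *ᶻ ((pos p -ᶻ 1ℤ) *ᶻ S (v *ᶠ x))) ≡⟨ ∑-cong (λ x → trans
            (E-*-cong x (λ x∈ → cong ((pos p -ᶻ 1ℤ) *ᶻ_) (S-value (*-≢0 v≢0 (D-≢0 x∈)))))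
            (lem₄ (pos p -ᶻ 1ℤ) (E x) τ (τ *ᶻ pos K) (sp (v *ᶠ x)))) ⟩
      ∑ (λ x → (pos p -ᶻ 1ℤ) *ᶻ (τ *ᶻ E x -ᶻ (τ *ᶻ pos K) *ᶻ (E x *ᶻ sp (v *ᶠ x)))) ≡⟨ ∑-*ˡ (pos p -ᶻ 1ℤ) _ ⟩
      (pos p -ᶻ 1ℤ) *ᶻ ∑ (λ x → τ *ᶻ E x -ᶻ (τ *ᶻ pos K) *ᶻ (E x *ᶻ sp (v *ᶠ x)))
        ≡⟨ cong ((pos p -ᶻ 1ℤ) *ᶻ_) (trans (∑-- _ _)
            (cong₂ _-ᶻ_ (∑-*ˡ τ E) (∑-*ˡ (τ *ᶻ pos K) (λ x → E x *ᶻ sp (v *ᶠ x))))) ⟩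
      (pos p -ᶻ 1ℤ) *ᶻ (τ *ᶻ #D -ᶻ (τ *ᶻ pos K) *ᶻ Z v) ∎

  -- By `special-coset`, once `D` contains one x with v x special it contains all of them, so `Z v`
  -- is 0 or the full number of special elements.
  K*Z : ∀ {v} → ¬ v ≡ 0# → Σ ℤ (λ ε → Bit ε × pos K *ᶻ Z v ≡ pos M *ᶻ ε)
  K*Z {v} v≢0 = go (toSum (search (λ x → (D x Boolₚ.≟ true) ×-dec special? (v *ᶠ x))))
    where
    Meets : Set
    Meets = ∃ λ x → D x ≡ true × Special (v *ᶠ x)
    Answer : Set
    Answer = Σ ℤ (λ ε → Bit ε × pos K *ᶻ Z v ≡ pos M *ᶻ ε)
    absent : ¬ Meets → Answer
    absent ¬found = 0ℤ , inj₁ refl , trans (cong (pos K *ᶻ_) (trans (∑-cong vanish) (trans (∑-const 0ℤ) (ℤₚ.*-zeroʳ (pos n)))))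
          (trans (ℤₚ.*-zeroʳ (pos K)) (sym (ℤₚ.*-zeroʳ (pos M))))
      where
      vanish : ∀ x → E x *ᶻ sp (v *ᶠ x) ≡ 0ℤ
      vanish x = trans (E-*-cong x (λ x∈ → sp-no (λ isSp → ¬found (x , x∈ , isSp)))) (ℤₚ.*-zeroʳ (E x))
    present : Meets → Answer
    present (x₀ , x₀∈ , x₀-sp) = 1ℤ , inj₂ refl , (begin
      pos K *ᶻ Z v ≡⟨ cong (pos K *ᶻ_) (∑-cong (λ x → absorb x (toSum (special? (v *ᶠ x))))) ⟩
      pos K *ᶻ ∑ (λ x → sp (v *ᶠ x)) ≡⟨ cong (pos K *ᶻ_) (∑-scale v≢0 sp) ⟩
      pos K *ᶻ ∑ sp ≡⟨ K*#special ⟩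
      pos M ≡⟨ ℤₚ.*-identityʳ (pos M) ⟨
      pos M *ᶻ 1ℤ ∎)
      where
      special⇒∈D : ∀ x → Special (v *ᶠ x) → D x ≡ true
      special⇒∈D x isSp = let y , y≢0 , vx≡vx₀y^K = special-coset x₀-sp isSp in
        trans (cong D (*-cancelˡ v≢0 (trans vx≡vx₀y^K (R.*-assoc v x₀ (y ^ᶠ K))))) (trans (D-^K x₀ y y≢0) x₀∈)
      absorb : ∀ x → Special (v *ᶠ x) ⊎ ¬ Special (v *ᶠ x) → E x *ᶻ sp (v *ᶠ x) ≡ sp (v *ᶠ x)
      absorb x (inj₁ isSp) = trans (cong (_*ᶻ sp (v *ᶠ x)) (E-∈ (special⇒∈D x isSp))) (ℤₚ.*-identityˡ _)
      absorb x (inj₂ ¬sp)  = trans (cong (E x *ᶻ_) (sp-no ¬sp)) (trans (ℤₚ.*-zeroʳ (E x)) (sym (sp-no ¬sp)))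
    go : Meets ⊎ ¬ Meets → Answer
    go (inj₁ found)  = present found
    go (inj₂ ¬found) = absent ¬found

  -- Orthogonality over `𝔽q`: by the tower law the absolute trace of a y depends on y through its
  -- trace to `𝔽q`, and a ↦ tr(a y) is either zero on `𝔽q` or balanced there. This expresses the
  -- hyperplane condition by characters over `𝔽p`.
  ∑-ι-φ : ∀ y → ∑ (λ a → 𝔽q.ι a *ᶻ φ (a *ᶠ y)) ≡ ((pos p -ᶻ 1ℤ) *ᶻ pos q) *ᶻ δ (𝔽q.tr y)
  ∑-ι-φ y = go (toSum (𝔽q.tr y ≟ᶠ 0#))
    where
    trp-* : ∀ {a} z → 𝔽q.Fq a → 𝔽p.tr (a *ᶠ z) ≡ Tr p e (a *ᶠ 𝔽q.tr z)
    trp-* {a} z a∈ = trans (tr-tower (a *ᶠ z)) (cong (Tr p e) (𝔽q.tr-*ˡ a z a∈))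
    go : 𝔽q.tr y ≡ 0# ⊎ ¬ 𝔽q.tr y ≡ 0# →
         ∑ (λ a → 𝔽q.ι a *ᶻ φ (a *ᶠ y)) ≡ ((pos p -ᶻ 1ℤ) *ᶻ pos q) *ᶻ δ (𝔽q.tr y)
    go (inj₁ tr≡0) = begin
      ∑ (λ a → 𝔽q.ι a *ᶻ φ (a *ᶠ y)) ≡⟨ ∑-cong (λ a → 𝔽q.ι-*-cong a (λ a∈ → begin
          pos p *ᶻ δ (𝔽p.tr (a *ᶠ y)) -ᶻ 1ℤ ≡⟨ cong (λ z → pos p *ᶻ z -ᶻ 1ℤ) (δ-≡0 (trans (trp-* y a∈)
                (trans (cong (Tr p e) (trans (cong (a *ᶠ_) tr≡0) (R.zeroʳ a))) Tr-0))) ⟩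
          pos p *ᶻ 1ℤ -ᶻ 1ℤ ≡⟨ cong (_-ᶻ 1ℤ) (ℤₚ.*-identityʳ (pos p)) ⟩
          pos p -ᶻ 1ℤ ∎)) ⟩
      ∑ (λ a → 𝔽q.ι a *ᶻ (pos p -ᶻ 1ℤ)) ≡⟨ ∑-*ʳ (pos p -ᶻ 1ℤ) 𝔽q.ι ⟩
      ∑ 𝔽q.ι *ᶻ (pos p -ᶻ 1ℤ) ≡⟨ cong (_*ᶻ (pos p -ᶻ 1ℤ)) 𝔽q.∑-ι ⟩
      pos q *ᶻ (pos p -ᶻ 1ℤ) ≡⟨ lem (pos q) (pos p) ⟩
      ((pos p -ᶻ 1ℤ) *ᶻ pos q) *ᶻ 1ℤ ≡⟨ cong (((pos p -ᶻ 1ℤ) *ᶻ pos q) *ᶻ_) (δ-≡0 tr≡0) ⟨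
      ((pos p -ᶻ 1ℤ) *ᶻ pos q) *ᶻ δ (𝔽q.tr y) ∎
      where
      lem : ∀ q p → q *ᶻ (p -ᶻ 1ℤ) ≡ ((p -ᶻ 1ℤ) *ᶻ q) *ᶻ 1ℤ
      lem = solve-∀
    go (inj₂ tr≢0) = begin
      ∑ (λ a → 𝔽q.ι a *ᶻ φ (a *ᶠ y)) ≡⟨ ∑-cong (λ a → trans (lem (𝔽q.ι a) (pos p) (δ (𝔽p.tr (a *ᶠ y))))
            (cong (λ z → pos p *ᶻ (𝔽q.ι a *ᶻ δ (𝔽p.tr z)) -ᶻ 𝔽q.ι a) (R.*-comm a y))) ⟩
      ∑ (λ a → pos p *ᶻ (𝔽q.ι a *ᶻ δ (𝔽p.tr (y *ᶠ a))) -ᶻ 𝔽q.ι a) ≡⟨ ∑-- _ _ ⟩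
      ∑ (λ a → pos p *ᶻ (𝔽q.ι a *ᶻ δ (𝔽p.tr (y *ᶠ a)))) -ᶻ ∑ 𝔽q.ι ≡⟨ cong (_-ᶻ ∑ 𝔽q.ι) (trans (∑-*ˡ (pos p) _)
            (𝔽p.fibre-0 𝔽q.ι (λ a → 𝔽p.tr (y *ᶠ a)) x₁ (λ a → 𝔽p.tr-∈ _) ι-inv (𝔽p.tr-shift y tr-yx₁≡1))) ⟩
      ∑ 𝔽q.ι -ᶻ ∑ 𝔽q.ι ≡⟨ ℤₚ.+-inverseʳ (∑ 𝔽q.ι) ⟩
      0ℤ ≡⟨ ℤₚ.*-zeroʳ ((pos p -ᶻ 1ℤ) *ᶻ pos q) ⟨
      ((pos p -ᶻ 1ℤ) *ᶻ pos q) *ᶻ 0ℤ ≡⟨ cong (((pos p -ᶻ 1ℤ) *ᶻ pos q) *ᶻ_) (δ-≢0 tr≢0) ⟨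
      ((pos p -ᶻ 1ℤ) *ᶻ pos q) *ᶻ δ (𝔽q.tr y) ∎
      where
      lem : ∀ i p d → i *ᶻ (p *ᶻ d -ᶻ 1ℤ) ≡ p *ᶻ (i *ᶻ d) -ᶻ i
      lem = solve-∀
      -- A translation inside `𝔽q` is needed. With x₀ the quotient of the `𝔽q`-traces of z and y,
      -- the tower law gives y x₀ the absolute trace of z, which is nonzero; a scalar of `𝔽p`
      -- normalises it to 1.
      z = proj₁ 𝔽p.tr≢0
      scale : Σ Carrier (λ c → 𝔽q.Fq c × c *ᶠ 𝔽q.tr y ≡ 1#)
      scale = 𝔽q.Fq-scale-to-1 tr≢0 (𝔽q.tr-∈ y)
      c = proj₁ scale
      c∈ = proj₁ (proj₂ scale)
      x₀ = 𝔽q.tr z *ᶠ c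
      x₀∈ : 𝔽q.Fq x₀
      x₀∈ = 𝔽q.Fq-* (𝔽q.tr-∈ z) c∈
      tr-yx₀ : 𝔽p.tr (y *ᶠ x₀) ≡ 𝔽p.tr z
      tr-yx₀ = begin
        𝔽p.tr (y *ᶠ x₀) ≡⟨ trans (cong 𝔽p.tr (R.*-comm y x₀)) (trp-* y x₀∈) ⟩
        Tr p e (𝔽q.tr z *ᶠ c *ᶠ 𝔽q.tr y)
          ≡⟨ cong (Tr p e) (trans (R.*-assoc _ c _) (trans (cong (𝔽q.tr z *ᶠ_) (proj₂ (proj₂ scale))) (R.*-identityʳ _))) ⟩
        Tr p e (𝔽q.tr z) ≡⟨ tr-tower z ⟨
        𝔽p.tr z ∎
      unit : Σ Carrier (λ b → 𝔽p.Fq b × 𝔽p.tr (y *ᶠ (b *ᶠ x₀)) ≡ 1#)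
      unit = 𝔽p.tr-scale-to-1 y (λ e₀ → proj₂ 𝔽p.tr≢0 (trans (sym tr-yx₀) e₀))
      x₁ = proj₁ unit *ᶠ x₀
      tr-yx₁≡1 = proj₂ (proj₂ unit)
      x₁∈ : 𝔽q.Fq x₁
      x₁∈ = 𝔽q.Fq-* (Fp⊆Fq (proj₁ (proj₂ unit))) x₀∈
      ι-inv : ∀ a x → 𝔽p.Fq a → 𝔽q.ι (x +ᶠ a *ᶠ x₁) ≡ 𝔽q.ι x
      ι-inv a x a∈ = cong δ (begin
        (x +ᶠ b) ^ᶠ q -ᶠ (x +ᶠ b)
          ≡⟨ cong₂ _+ᶠ_ (trans (frobenius^ e x b) (cong (x ^ᶠ q +ᶠ_) (𝔽q.Fq-* (Fp⊆Fq a∈) x₁∈))) (trans (sym (Rₚ.-‿+-comm x b)) (R.+-comm _ _)) ⟩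
        (x ^ᶠ q +ᶠ b) +ᶠ (-ᶠ b -ᶠ x) ≡⟨ R.+-assoc _ _ _ ⟨
        ((x ^ᶠ q +ᶠ b) -ᶠ b) -ᶠ x ≡⟨ cong (_-ᶠ x) (x+y-y _ b) ⟩
        x ^ᶠ q -ᶠ x ∎)
        where b = a *ᶠ x₁

  -- After expanding the indicator of the hyperplane, the scalar a = 0 gives the size term and each
  -- of the other q - 1 scalars gives `W v`, because `D` is invariant under scalars.
  #D∩H-W : ∀ v → (pos p -ᶻ 1ℤ) *ᶻ (pos q *ᶻ #D∩H v) ≡ (pos p -ᶻ 1ℤ) *ᶻ #D +ᶻ (pos q -ᶻ 1ℤ) *ᶻ W v
  #D∩H-W v = begin
    (pos p -ᶻ 1ℤ) *ᶻ (pos q *ᶻ #D∩H v) ≡⟨ ℤₚ.*-assoc (pos p -ᶻ 1ℤ) (pos q) (#D∩H v) ⟨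
    ((pos p -ᶻ 1ℤ) *ᶻ pos q) *ᶻ #D∩H v ≡⟨ ∑-*ˡ ((pos p -ᶻ 1ℤ) *ᶻ pos q) _ ⟨
    ∑ (λ x → ((pos p -ᶻ 1ℤ) *ᶻ pos q) *ᶻ (E x *ᶻ δ (𝔽q.tr (v *ᶠ x))))
      ≡⟨ ∑-cong (λ x → trans (swap ((pos p -ᶻ 1ℤ) *ᶻ pos q) (E x) (δ (𝔽q.tr (v *ᶠ x))))
          (cong (E x *ᶻ_) (sym (∑-ι-φ (v *ᶠ x))))) ⟩
    ∑ (λ x → E x *ᶻ ∑ (λ a → 𝔽q.ι a *ᶻ φ (a *ᶠ (v *ᶠ x)))) ≡⟨ ∑-cong (λ x → sym (∑-*ˡ (E x) _)) ⟩
    ∑ (λ x → ∑ (λ a → E x *ᶻ (𝔽q.ι a *ᶻ φ (a *ᶠ (v *ᶠ x))))) ≡⟨ ∑-swap _ ⟩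
    ∑ (λ a → ∑ (λ x → E x *ᶻ (𝔽q.ι a *ᶻ φ (a *ᶠ (v *ᶠ x))))) ≡⟨ ∑-cong (λ a → trans (∑-cong (λ x → trans
          (swap (E x) (𝔽q.ι a) (φ (a *ᶠ (v *ᶠ x))))
          (cong (λ z → 𝔽q.ι a *ᶻ (E x *ᶻ φ z)) (sym (R.*-assoc a v x)))))
          (∑-*ˡ (𝔽q.ι a) _)) ⟩
    ∑ (λ a → 𝔽q.ι a *ᶻ W (a *ᶠ v)) ≡⟨ 𝔽q.∑-ι-* (λ a → W (a *ᶠ v)) (W v) (λ a → W-scale v) ⟩
    W (0# *ᶠ v) +ᶻ (pos q -ᶻ 1ℤ) *ᶻ W v ≡⟨ cong (_+ᶻ (pos q -ᶻ 1ℤ) *ᶻ W v) (trans (cong W (R.zeroˡ v)) W-0) ⟩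
    (pos p -ᶻ 1ℤ) *ᶻ #D +ᶻ (pos q -ᶻ 1ℤ) *ᶻ W v ∎
    where
    swap : ∀ a b c → a *ᶻ (b *ᶻ c) ≡ b *ᶻ (a *ᶻ c)
    swap = solve-∀

  M*q*#D∩H : ∀ {v} → ¬ v ≡ 0# → Σ ℤ (λ ε → Bit ε ×
    pos M *ᶻ (pos q *ᶻ #D∩H v) ≡ (pos M +ᶻ (pos q -ᶻ 1ℤ) *ᶻ (τ -ᶻ 1ℤ)) *ᶻ #D -ᶻ pos M *ᶻ ((pos q -ᶻ 1ℤ) *ᶻ (τ *ᶻ ε)))
  M*q*#D∩H {v} v≢0 = let ε , bit , KZ≡Mε = K*Z v≢0 in ε , bit , p-1-cancel (begin
    (pos p -ᶻ 1ℤ) *ᶻ (pos M *ᶻ (pos q *ᶻ #D∩H v)) ≡⟨ swap (pos p -ᶻ 1ℤ) (pos M) (pos q *ᶻ #D∩H v) ⟩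
    pos M *ᶻ ((pos p -ᶻ 1ℤ) *ᶻ (pos q *ᶻ #D∩H v)) ≡⟨ cong (pos M *ᶻ_) (#D∩H-W v) ⟩
    pos M *ᶻ ((pos p -ᶻ 1ℤ) *ᶻ #D +ᶻ (pos q -ᶻ 1ℤ) *ᶻ W v)
      ≡⟨ distribute (pos M) ((pos p -ᶻ 1ℤ) *ᶻ #D) (pos q -ᶻ 1ℤ) (W v) ⟩
    pos M *ᶻ ((pos p -ᶻ 1ℤ) *ᶻ #D) +ᶻ (pos q -ᶻ 1ℤ) *ᶻ (pos M *ᶻ W v)
      ≡⟨ cong (λ z → pos M *ᶻ ((pos p -ᶻ 1ℤ) *ᶻ #D) +ᶻ (pos q -ᶻ 1ℤ) *ᶻ z)
          (trans (M*W v≢0) (cong (λ z → (pos p -ᶻ 1ℤ) *ᶻ ((τ -ᶻ 1ℤ) *ᶻ #D -ᶻ τ *ᶻ z)) KZ≡Mε)) ⟩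
    pos M *ᶻ ((pos p -ᶻ 1ℤ) *ᶻ #D) +ᶻ (pos q -ᶻ 1ℤ) *ᶻ ((pos p -ᶻ 1ℤ) *ᶻ ((τ -ᶻ 1ℤ) *ᶻ #D -ᶻ τ *ᶻ (pos M *ᶻ ε)))
          ≡⟨ collect (pos M) (pos p -ᶻ 1ℤ) #D (pos q -ᶻ 1ℤ) τ ε ⟩
    (pos p -ᶻ 1ℤ) *ᶻ ((pos M +ᶻ (pos q -ᶻ 1ℤ) *ᶻ (τ -ᶻ 1ℤ)) *ᶻ #D -ᶻ pos M *ᶻ ((pos q -ᶻ 1ℤ) *ᶻ (τ *ᶻ ε))) ∎)
    where
    swap : ∀ a b c → a *ᶻ (b *ᶻ c) ≡ b *ᶻ (a *ᶻ c)
    swap = solve-∀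
    distribute : ∀ M a q W → M *ᶻ (a +ᶻ q *ᶻ W) ≡ M *ᶻ a +ᶻ q *ᶻ (M *ᶻ W)
    distribute = solve-∀
    collect : ∀ M c D q τ ε → M *ᶻ (c *ᶻ D) +ᶻ q *ᶻ (c *ᶻ ((τ -ᶻ 1ℤ) *ᶻ D -ᶻ τ *ᶻ (M *ᶻ ε))) ≡
              c *ᶻ ((M +ᶻ q *ᶻ (τ -ᶻ 1ℤ)) *ᶻ D -ᶻ M *ᶻ (q *ᶻ (τ *ᶻ ε)))
    collect = solve-∀

  tr-+ˡ : ∀ v w x → 𝔽q.tr ((v +ᶠ w) *ᶠ x) ≡ 𝔽q.tr (v *ᶠ x) +ᶠ 𝔽q.tr (w *ᶠ x)
  tr-+ˡ v w x = trans (cong 𝔽q.tr (R.distribʳ x v w)) (𝔽q.tr-+ _ _)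

  tr-*0 : ∀ v → 𝔽q.tr (v *ᶠ 0#) ≡ 0#
  tr-*0 v = trans (cong 𝔽q.tr (R.zeroʳ v)) 𝔽q.tr-0

  tr-scale : ∀ {a} v x → 𝔽q.Fq a → 𝔽q.tr (v *ᶠ (a *ᶠ x)) ≡ a *ᶠ 𝔽q.tr (v *ᶠ x)
  tr-scale {a} v x a∈ = trans (cong 𝔽q.tr (*-swapˡ v a x)) (𝔽q.tr-*ˡ a (v *ᶠ x) a∈)

  -- For x₁ with tr(v x₁) = 1, the vector x - tr(v x) x₁ lies in the first hyperplane, hence in the
  -- kernel of the second form; c is the value of that form at x₁.
  hyperplane-⊆ : ∀ {v w} → ¬ v ≡ 0# → (∀ x → 𝔽q.tr (v *ᶠ x) ≡ 0# → 𝔽q.tr (w *ᶠ x) ≡ 0#) →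
                 Σ Carrier (λ c → 𝔽q.Fq c × ∀ x → 𝔽q.tr (w *ᶠ x) ≡ c *ᶠ 𝔽q.tr (v *ᶠ x))
  hyperplane-⊆ {v} {w} v≢0 H⊆H = c , 𝔽q.tr-∈ _ , eq
    where
    x₁ = proj₁ (𝔽q.tr-≡1 v≢0)
    c = 𝔽q.tr (w *ᶠ x₁)
    eq : ∀ x → 𝔽q.tr (w *ᶠ x) ≡ c *ᶠ 𝔽q.tr (v *ᶠ x)
    eq x = x-y≡0⇒x≡y (trans (sym (begin
      𝔽q.tr (w *ᶠ (x +ᶠ (-ᶠ a) *ᶠ x₁)) ≡⟨ cong 𝔽q.tr (R.distribˡ w x _) ⟩
      𝔽q.tr (w *ᶠ x +ᶠ w *ᶠ ((-ᶠ a) *ᶠ x₁)) ≡⟨ 𝔽q.tr-+ _ _ ⟩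
      𝔽q.tr (w *ᶠ x) +ᶠ 𝔽q.tr (w *ᶠ ((-ᶠ a) *ᶠ x₁))
        ≡⟨ cong (𝔽q.tr (w *ᶠ x) +ᶠ_) (trans (tr-scale w x₁ -a∈) (trans (sym (Rₚ.-‿distribˡ-* a c)) (cong -ᶠ_ (R.*-comm a c)))) ⟩
      𝔽q.tr (w *ᶠ x) -ᶠ c *ᶠ a ∎)) (H⊆H _ (trans (𝔽q.tr-shift v (proj₂ (𝔽q.tr-≡1 v≢0)) (-ᶠ a) x -a∈) (R.-‿inverseʳ a))))
      where
      a = 𝔽q.tr (v *ᶠ x)
      -a∈ : 𝔽q.Fq (-ᶠ a)
      -a∈ = 𝔽q.Fq-neg (𝔽q.tr-∈ _)

  -- From hyperplane sections to minimality of the code.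

  module Minimality (N u s : ℕ) (u<N : u < N) (q<s : p ^ e < s) (N*#D≡u*M : pos N *ᶻ #D ≡ pos u *ᶻ pos M)
                    (parameters : WeightArithmetic.Parameters N u (p ^ e) s u<N 2≤q q<s τ)
                    (q≡2⇒4<s : p ^ e ≡ 2 → 4 < s)
                    (q≡2⇒8<s : p ^ e ≡ 2 → τ ≡ pos s → 8 < s × N ∣ s ∸ 1) where
    open WeightArithmetic N u q s u<N 2≤q q<s τ

    pos-M : pos M ≡ τ *ᶻ τ -ᶻ 1ℤ
    pos-M = trans (lem (pos M)) (cong (_-ᶻ 1ℤ) (trans (sym pos-n) (sym τ²≡n)))
      where
      lem : ∀ M → M ≡ (1ℤ +ᶻ M) -ᶻ 1ℤ
      lem = solve-∀

    size : Size #D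
    size = trans N*#D≡u*M (cong (pos u *ᶻ_) pos-M)

    -- With M = τ² - 1 the coefficient M + (q - 1)(τ - 1) of `#D` factors as (τ - 1)(τ + q); the
    -- size relation then lets `M` cancel.
    weight : ∀ {v} → ¬ v ≡ 0# → Σ ℤ (λ ε → Bit ε × Weight (#D∩H v) ε)
    weight {v} v≢0 = let ε , bit , e = M*q*#D∩H v≢0 in
      ε , bit , ℤₚ.*-cancelˡ-≡ (pos M) _ _ {{ℕ.>-nonZero (ℕₚ.≤-trans (s≤s z≤n) 2≤M)}} (begin
        pos M *ᶻ (pos N *ᶻ (pos q *ᶻ #D∩H v)) ≡⟨ swap (pos M) (pos N) (pos q *ᶻ #D∩H v) ⟩
        pos N *ᶻ (pos M *ᶻ (pos q *ᶻ #D∩H v)) ≡⟨ cong (pos N *ᶻ_) e ⟩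
        pos N *ᶻ ((pos M +ᶻ (pos q -ᶻ 1ℤ) *ᶻ (τ -ᶻ 1ℤ)) *ᶻ #D -ᶻ pos M *ᶻ ((pos q -ᶻ 1ℤ) *ᶻ (τ *ᶻ ε)))
              ≡⟨ lem₁ (pos N) (pos M +ᶻ (pos q -ᶻ 1ℤ) *ᶻ (τ -ᶻ 1ℤ)) #D (pos M) ((pos q -ᶻ 1ℤ) *ᶻ (τ *ᶻ ε)) ⟩
        (pos M +ᶻ (pos q -ᶻ 1ℤ) *ᶻ (τ -ᶻ 1ℤ)) *ᶻ (pos N *ᶻ #D) -ᶻ pos M *ᶻ (pos N *ᶻ ((pos q -ᶻ 1ℤ) *ᶻ (τ *ᶻ ε)))
              ≡⟨ cong₂ (λ a b → (a +ᶻ (pos q -ᶻ 1ℤ) *ᶻ (τ -ᶻ 1ℤ)) *ᶻ b -ᶻ pos M *ᶻ (pos N *ᶻ ((pos q -ᶻ 1ℤ) *ᶻ (τ *ᶻ ε)))) pos-M N*#D≡u*M ⟩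
        ((τ *ᶻ τ -ᶻ 1ℤ) +ᶻ (pos q -ᶻ 1ℤ) *ᶻ (τ -ᶻ 1ℤ)) *ᶻ (pos u *ᶻ pos M) -ᶻ pos M *ᶻ (pos N *ᶻ ((pos q -ᶻ 1ℤ) *ᶻ (τ *ᶻ ε)))
              ≡⟨ lem₂ (pos q) τ (pos u) (pos M) (pos N *ᶻ ((pos q -ᶻ 1ℤ) *ᶻ (τ *ᶻ ε))) ⟩
        pos M *ᶻ (pos u *ᶻ ((τ -ᶻ 1ℤ) *ᶻ (τ +ᶻ pos q)) -ᶻ pos N *ᶻ ((pos q -ᶻ 1ℤ) *ᶻ (τ *ᶻ ε))) ∎)
      where
      swap : ∀ a b c → a *ᶻ (b *ᶻ c) ≡ b *ᶻ (a *ᶻ c)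
      swap = solve-∀
      lem₁ : ∀ N x D M y → N *ᶻ (x *ᶻ D -ᶻ M *ᶻ y) ≡ x *ᶻ (N *ᶻ D) -ᶻ M *ᶻ (N *ᶻ y)
      lem₁ = solve-∀
      lem₂ : ∀ q τ u M y → ((τ *ᶻ τ -ᶻ 1ℤ) +ᶻ (q -ᶻ 1ℤ) *ᶻ (τ -ᶻ 1ℤ)) *ᶻ (u *ᶻ M) -ᶻ M *ᶻ y ≡
             M *ᶻ (u *ᶻ ((τ -ᶻ 1ℤ) *ᶻ (τ +ᶻ q)) -ᶻ y)
      lem₂ = solve-∀

    ∣H∣ : Carrier → ℤ
    ∣H∣ v = ∑ (λ x → δ (𝔽q.tr (v *ᶠ x)))

    q*∣H∣ : ∀ {v} → ¬ v ≡ 0# → pos q *ᶻ ∣H∣ v ≡ τ *ᶻ τ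
    q*∣H∣ v≢0 = trans (𝔽q.hyperplane-size v≢0) (sym τ²≡n)

    D⊄H : ∀ {v} → ¬ v ≡ 0# → ¬ (∀ x → D x ≡ true → 𝔽q.tr (v *ᶠ x) ≡ 0#)
    D⊄H {v} v≢0 D⊆H = let ε , bit , wt = weight v≢0 in
      ⊄hyperplane parameters bit size (subst (λ w → Weight w ε) (∑-cong (λ x →
        trans (E-*-cong x (λ x∈ → δ-≡0 (D⊆H x x∈))) (ℤₚ.*-identityʳ (E x)))) wt)

    Dᶜ⊄H : ∀ {v} → ¬ v ≡ 0# → ¬ (∀ x → D x ≡ false → 𝔽q.tr (v *ᶠ x) ≡ 0#)
    Dᶜ⊄H {v} v≢0 Dᶜ⊆H = let ε , bit , wt = weight v≢0 in
      complement⊄hyperplane parameters bit wt size (begin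
        pos q *ᶻ #D∩H v ≡⟨ cong (pos q *ᶻ_) (∑-cong pointwise) ⟩
        pos q *ᶻ ∑ (λ x → (E x -ᶻ 1ℤ) +ᶻ δ (𝔽q.tr (v *ᶠ x)))
          ≡⟨ cong (pos q *ᶻ_) (trans (∑-+ _ _) (cong (_+ᶻ ∣H∣ v) (trans (∑-- E _) (cong (λ z → #D -ᶻ z) ∑-1)))) ⟩
        pos q *ᶻ ((#D -ᶻ pos n) +ᶻ ∣H∣ v) ≡⟨ lem (pos q) #D (pos n) (∣H∣ v) ⟩
        pos q *ᶻ #D -ᶻ pos q *ᶻ pos n +ᶻ pos q *ᶻ ∣H∣ v
          ≡⟨ cong₂ (λ a b → pos q *ᶻ #D -ᶻ pos q *ᶻ a +ᶻ b) (sym τ²≡n) (q*∣H∣ v≢0) ⟩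
        pos q *ᶻ #D -ᶻ pos q *ᶻ (τ *ᶻ τ) +ᶻ τ *ᶻ τ ∎)
      where
      lem : ∀ q D n H → q *ᶻ ((D -ᶻ n) +ᶻ H) ≡ q *ᶻ D -ᶻ q *ᶻ n +ᶻ q *ᶻ H
      lem = solve-∀
      inside : ∀ h → 1ℤ *ᶻ h ≡ (1ℤ -ᶻ 1ℤ) +ᶻ h
      inside = solve-∀
      pointwise : ∀ x → E x *ᶻ δ (𝔽q.tr (v *ᶠ x)) ≡ (E x -ᶻ 1ℤ) +ᶻ δ (𝔽q.tr (v *ᶠ x))
      pointwise x = go (D-cases x)
        where
        go : D x ≡ true ⊎ D x ≡ false → E x *ᶻ δ (𝔽q.tr (v *ᶠ x)) ≡ (E x -ᶻ 1ℤ) +ᶻ δ (𝔽q.tr (v *ᶠ x))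
        go (inj₁ x∈) rewrite E-∈ x∈ = inside _
        go (inj₂ x∉) rewrite E-∉ x∉ | δ-≡0 (Dᶜ⊆H x x∉) = refl

    D∩H≢∅ : ∀ {v} → ¬ v ≡ 0# → Σ Carrier (λ x → D x ≡ true × 𝔽q.tr (v *ᶠ x) ≡ 0#)
    D∩H≢∅ {v} v≢0 = go (toSum (search (λ x → (D x Boolₚ.≟ true) ×-dec (𝔽q.tr (v *ᶠ x) ≟ᶠ 0#))))
      where
      Meets : Set
      Meets = Σ Carrier (λ x → D x ≡ true × 𝔽q.tr (v *ᶠ x) ≡ 0#)
      go : Meets ⊎ ¬ Meets → Meets
      go (inj₁ found)  = found
      go (inj₂ ¬found) = let ε , bit , wt = weight v≢0 in
        ⊥-elim (meets-hyperplane parameters bit (subst (λ w → Weight w ε) (trans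
          (∑-cong (λ x → trans (E-*-cong x (λ x∈ → δ-≢0 (λ e → ¬found (x , x∈ , e)))) (ℤₚ.*-zeroʳ (E x))))
          (trans (∑-const 0ℤ) (ℤₚ.*-zeroʳ (pos n)))) wt))

    -- The hyperplanes of v and v + w agree where tr(w x) = 0. Elsewhere the assumptions say that x
    -- is in `D` exactly when tr(v x) = 0, and such x miss the second hyperplane. So the sections of
    -- `D` differ in size by |H| - |H ∩ H′| = n/q - n/q², with H, H′ the hyperplanes of v and w,
    -- which `weight-gap` forbids.
    no-crossing : ∀ {v w x₁} → ¬ v ≡ 0# → ¬ v +ᶠ w ≡ 0# → 𝔽q.tr (v *ᶠ x₁) ≡ 0# → 𝔽q.tr (w *ᶠ x₁) ≡ 1# →
                  (∀ x → D x ≡ true → ¬ 𝔽q.tr (v *ᶠ x) ≡ 0# → 𝔽q.tr (w *ᶠ x) ≡ 0#) →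
                  (∀ x → D x ≡ false → 𝔽q.tr (v *ᶠ x) ≡ 0# → 𝔽q.tr (w *ᶠ x) ≡ 0#) → ⊥
    no-crossing {v} {w} {x₁} v≢0 v+w≢0 vx₁ wx₁ in-D out-D =
      let ε , bit , wt = weight v≢0
          ε′ , bit′ , wt′ = weight v+w≢0
      in weight-gap parameters bit bit′ wt wt′ (begin
        pos q *ᶻ (pos q *ᶻ (#D∩H v -ᶻ #D∩H (v +ᶠ w))) ≡⟨ cong (λ z → pos q *ᶻ (pos q *ᶻ z)) difference ⟩
        pos q *ᶻ (pos q *ᶻ (∣H∣ v -ᶻ ∣H∩H∣)) ≡⟨ lem (pos q) (∣H∣ v) ∣H∩H∣ ⟩
        pos q *ᶻ (pos q *ᶻ ∣H∣ v) -ᶻ pos q *ᶻ (pos q *ᶻ ∣H∩H∣)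
          ≡⟨ cong₂ (λ a b → pos q *ᶻ a -ᶻ pos q *ᶻ b) (q*∣H∣ v≢0) q*∣H∩H∣ ⟩
        pos q *ᶻ (τ *ᶻ τ) -ᶻ pos q *ᶻ ∣H∣ v ≡⟨ cong (λ z → pos q *ᶻ (τ *ᶻ τ) -ᶻ z) (q*∣H∣ v≢0) ⟩
        pos q *ᶻ (τ *ᶻ τ) -ᶻ τ *ᶻ τ ∎)
      where
      α β′ : Carrier → Carrier
      α  x = 𝔽q.tr (v *ᶠ x)
      β′ x = 𝔽q.tr (w *ᶠ x)
      ∣H∩H∣ : ℤ
      ∣H∩H∣ = ∑ (λ x → δ (α x) *ᶻ δ (β′ x))
      lem : ∀ q a b → q *ᶻ (q *ᶻ (a -ᶻ b)) ≡ q *ᶻ (q *ᶻ a) -ᶻ q *ᶻ (q *ᶻ b)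
      lem = solve-∀
      q*∣H∩H∣ : pos q *ᶻ ∣H∩H∣ ≡ ∣H∣ v
      q*∣H∩H∣ = 𝔽q.fibre-0 (δ ∘ α) β′ x₁ (λ x → 𝔽q.tr-∈ _) (λ a x a∈ → cong δ (begin
        𝔽q.tr (v *ᶠ (x +ᶠ a *ᶠ x₁)) ≡⟨ trans (cong 𝔽q.tr (R.distribˡ v x _)) (𝔽q.tr-+ _ _) ⟩
        α x +ᶠ 𝔽q.tr (v *ᶠ (a *ᶠ x₁))
          ≡⟨ cong (α x +ᶠ_) (trans (tr-scale v x₁ a∈) (trans (cong (a *ᶠ_) vx₁) (R.zeroʳ a))) ⟩
        α x +ᶠ 0# ≡⟨ R.+-identityʳ _ ⟩
        α x ∎)) (𝔽q.tr-shift w wx₁)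
      agree : ∀ E a → E *ᶻ a -ᶻ E *ᶻ a ≡ a -ᶻ a *ᶻ 1ℤ
      agree = solve-∀
      pointwise : ∀ x → E x *ᶻ δ (α x) -ᶻ E x *ᶻ δ (α x +ᶠ β′ x) ≡ δ (α x) -ᶻ δ (α x) *ᶻ δ (β′ x)
      pointwise x = go (toSum (β′ x ≟ᶠ 0#)) (toSum (α x ≟ᶠ 0#)) (D-cases x)
        where
        go : β′ x ≡ 0# ⊎ ¬ β′ x ≡ 0# → α x ≡ 0# ⊎ ¬ α x ≡ 0# → D x ≡ true ⊎ D x ≡ false →
             E x *ᶻ δ (α x) -ᶻ E x *ᶻ δ (α x +ᶠ β′ x) ≡ δ (α x) -ᶻ δ (α x) *ᶻ δ (β′ x)
        go (inj₁ β≡0) _ _ = trans (cong (λ z → E x *ᶻ δ (α x) -ᶻ E x *ᶻ δ z) (trans (cong (α x +ᶠ_) β≡0) (R.+-identityʳ _)))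
          (trans (agree (E x) (δ (α x))) (cong (λ z → δ (α x) -ᶻ δ (α x) *ᶻ z) (sym (δ-≡0 β≡0))))
        go (inj₂ β≢0) (inj₁ α≡0) (inj₁ x∈) = cong₂ _-ᶻ_ (trans (cong (_*ᶻ δ (α x)) (E-∈ x∈)) (ℤₚ.*-identityˡ _))
          (cong₂ _*ᶻ_ (trans (E-∈ x∈) (sym (δ-≡0 α≡0))) (cong δ (trans (cong (_+ᶠ β′ x) α≡0) (R.+-identityˡ _))))
        go (inj₂ β≢0) (inj₁ α≡0) (inj₂ x∉) = ⊥-elim (β≢0 (out-D x x∉ α≡0))
        go (inj₂ β≢0) (inj₂ α≢0) (inj₁ x∈) = ⊥-elim (β≢0 (in-D x x∈ α≢0))
        go (inj₂ β≢0) (inj₂ α≢0) (inj₂ x∉) rewrite E-∉ x∉ | δ-≢0 α≢0 = refl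
      difference : #D∩H v -ᶻ #D∩H (v +ᶠ w) ≡ ∣H∣ v -ᶻ ∣H∩H∣
      difference = begin
        #D∩H v -ᶻ #D∩H (v +ᶠ w) ≡⟨ ∑-- _ _ ⟨
        ∑ (λ x → E x *ᶻ δ (α x) -ᶻ E x *ᶻ δ (𝔽q.tr ((v +ᶠ w) *ᶠ x)))
          ≡⟨ ∑-cong (λ x → trans (cong (λ z → E x *ᶻ δ (α x) -ᶻ E x *ᶻ δ z) (tr-+ˡ v w x)) (pointwise x)) ⟩
        ∑ (λ x → δ (α x) -ᶻ δ (α x) *ᶻ δ (β′ x)) ≡⟨ ∑-- _ _ ⟩
        ∣H∣ v -ᶻ ∣H∩H∣ ∎

    binary-≢0⇒1 : q ≡ 2 → ∀ {a} → 𝔽q.Fq a → ¬ a ≡ 0# → a ≡ 1#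
    binary-≢0⇒1 q≡2 {a} a∈ a≢0 = trans (sym (R.*-identityʳ a))
      (subst (λ k → a ^ᶠ (k ∸ 1) ≡ 1#) q≡2 (𝔽q.Fq⇒^[q-1]≡1 a≢0 a∈))

    -- Otherwise the pair of traces on `D` would only be (0,1), (1,0) or (1,1), so exactly one of
    -- the forms of v, w and v + w vanishes at each point, and their three hyperplanes partition
    -- `D`.
    binary-trace-on-D∩H : q ≡ 2 → ∀ {v w} → ¬ v ≡ 0# → ¬ (∀ x → D x ≡ true → 𝔽q.tr (v *ᶠ x) ≡ 0# → ¬ 𝔽q.tr (w *ᶠ x) ≡ 0#)
    binary-trace-on-D∩H q≡2 {v} {w} v≢0 w≢0-on-D∩H =
      let x₀ , x₀∈ , vx₀≡0 = D∩H≢∅ v≢0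
          wx₀≢0 = w≢0-on-D∩H x₀ x₀∈ vx₀≡0
          ε₁ , bit₁ , wt₁ = weight v≢0
          ε₂ , bit₂ , wt₂ = weight {w} (λ { refl → wx₀≢0 (trans (cong 𝔽q.tr (R.zeroˡ x₀)) 𝔽q.tr-0) })
          ε₃ , bit₃ , wt₃ = weight {v +ᶠ w} (λ v+w≡0 → wx₀≢0 (trans (sym (trans (tr-+ˡ v w x₀)
                              (trans (cong (_+ᶠ 𝔽q.tr (w *ᶠ x₀)) vx₀≡0) (R.+-identityˡ _))))
                              (trans (cong (λ z → 𝔽q.tr (z *ᶠ x₀)) v+w≡0) (trans (cong 𝔽q.tr (R.zeroˡ x₀)) 𝔽q.tr-0))))
      in no-partition parameters q≡2 (q≡2⇒4<s q≡2) (q≡2⇒8<s q≡2) bit₁ bit₂ bit₃ wt₁ wt₂ wt₃ size (begin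
        #D∩H v +ᶻ #D∩H w +ᶻ #D∩H (v +ᶠ w)
          ≡⟨ trans (∑-+ _ _) (cong (_+ᶻ #D∩H (v +ᶠ w)) (∑-+ _ _)) ⟨
        ∑ (λ x → E x *ᶻ δ (𝔽q.tr (v *ᶠ x)) +ᶻ E x *ᶻ δ (𝔽q.tr (w *ᶠ x)) +ᶻ E x *ᶻ δ (𝔽q.tr ((v +ᶠ w) *ᶠ x)))
          ≡⟨ ∑-cong (λ x → trans (factor (E x) _ _ _) (trans (E-*-cong x (once x)) (ℤₚ.*-identityʳ (E x)))) ⟩
        #D ∎)
      where
      factor : ∀ E a b c → E *ᶻ a +ᶻ E *ᶻ b +ᶻ E *ᶻ c ≡ E *ᶻ (a +ᶻ b +ᶻ c)
      factor = solve-∀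
      once : ∀ x → D x ≡ true → δ (𝔽q.tr (v *ᶠ x)) +ᶻ δ (𝔽q.tr (w *ᶠ x)) +ᶻ δ (𝔽q.tr ((v +ᶠ w) *ᶠ x)) ≡ 1ℤ
      once x x∈ = trans (cong (λ z → δ a +ᶻ δ b +ᶻ δ z) (tr-+ˡ v w x)) (go (toSum (a ≟ᶠ 0#)) (toSum (b ≟ᶠ 0#)))
        where
        a = 𝔽q.tr (v *ᶠ x)
        b = 𝔽q.tr (w *ᶠ x)
        go : a ≡ 0# ⊎ ¬ a ≡ 0# → b ≡ 0# ⊎ ¬ b ≡ 0# → δ a +ᶻ δ b +ᶻ δ (a +ᶠ b) ≡ 1ℤ
        go (inj₁ a≡0) (inj₁ b≡0) = ⊥-elim (w≢0-on-D∩H x x∈ a≡0 b≡0)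
        go (inj₁ a≡0) (inj₂ b≢0) rewrite δ-≡0 a≡0 | δ-≢0 b≢0
          | δ-≢0 (λ a+b≡0 → b≢0 (trans (sym (trans (cong (_+ᶠ b) a≡0) (R.+-identityˡ b))) a+b≡0)) = refl
        go (inj₂ a≢0) (inj₁ b≡0) rewrite δ-≢0 a≢0 | δ-≡0 b≡0
          | δ-≢0 (λ a+b≡0 → a≢0 (trans (sym (trans (cong (a +ᶠ_) b≡0) (R.+-identityʳ a))) a+b≡0)) = refl
        go (inj₂ a≢0) (inj₂ b≢0) rewrite δ-≢0 a≢0 | δ-≢0 b≢0
          | δ-≡0 (decidable-stable (a +ᶠ b ≟ᶠ 0#) (λ a+b≢0 → 1≢0 (Rₚ.+-cancelˡ 1# 1# 0# (begin
              1# +ᶠ 1# ≡⟨ cong₂ _+ᶠ_ (binary-≢0⇒1 q≡2 (𝔽q.tr-∈ _) a≢0) (binary-≢0⇒1 q≡2 (𝔽q.tr-∈ _) b≢0) ⟨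
              a +ᶠ b ≡⟨ binary-≢0⇒1 q≡2 (𝔽q.Fq-+ (𝔽q.tr-∈ _) (𝔽q.tr-∈ _)) a+b≢0 ⟩
              1# ≡⟨ R.+-identityʳ 1# ⟨
              1# +ᶠ 0# ∎)))) = refl

    𝟙D : Carrier → Carrier
    𝟙D x = if D x then 1# else 0#

    c : Carrier → Carrier → Carrier → Carrier
    c u′ v x = u′ *ᶠ 𝟙D x +ᶠ 𝔽q.tr (v *ᶠ x)

    c-∈ : ∀ u′ v {x} → D x ≡ true → c u′ v x ≡ u′ +ᶠ 𝔽q.tr (v *ᶠ x)
    c-∈ u′ v {x} x∈ = cong (_+ᶠ 𝔽q.tr (v *ᶠ x)) (trans (cong (λ b → u′ *ᶠ (if b then 1# else 0#)) x∈) (R.*-identityʳ u′))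

    c-∉ : ∀ u′ v {x} → D x ≡ false → c u′ v x ≡ 𝔽q.tr (v *ᶠ x)
    c-∉ u′ v {x} x∉ = trans (cong (_+ᶠ 𝔽q.tr (v *ᶠ x)) (trans (cong (λ b → u′ *ᶠ (if b then 1# else 0#)) x∉) (R.zeroʳ u′))) (R.+-identityˡ _)

    c-0 : ∀ v x → c 0# v x ≡ 𝔽q.tr (v *ᶠ x)
    c-0 v x = trans (cong (_+ᶠ 𝔽q.tr (v *ᶠ x)) (R.zeroˡ _)) (R.+-identityˡ _)

    Multiple : Carrier → Carrier → Carrier → Carrier → Set
    Multiple u₁ v₁ u₂ v₂ = Σ Carrier (λ a → 𝔽q.Fq a × (∀ x → ¬ x ≡ 0# → c u₂ v₂ x ≡ a *ᶠ c u₁ v₁ x))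

    binary? : q ≡ 2 ⊎ 3 ≤ q
    binary? with ℕₚ.m≤n⇒m<n∨m≡n 2≤q
    ... | inj₁ 2<q = inj₂ 2<q
    ... | inj₂ 2≡q = inj₁ (sym 2≡q)

    γ^h≢1 : 3 ≤ q → ¬ γ ^ᶠ h ≡ 1#
    γ^h≢1 3≤q e = ℕₚ.<⇒≱ (ℕₚ.<-≤-trans (ℕₚ.m<m*n h 2 {{ℕ.>-nonZero 𝔽q.1≤h}} (s≤s (s≤s z≤n)))
      (ℕₚ.≤-trans (ℕₚ.*-monoʳ-≤ h (ℕₚ.∸-monoˡ-≤ 1 3≤q)) (ℕₚ.≤-reflexive (sym M≡h*[q-1]))))
      (Div.∣⇒≤ {{ℕ.>-nonZero 𝔽q.1≤h}} (γ^-≡1⇒M∣ h e))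

    -- A section of `D` is nonempty and closed under nonzero scalars. For q ≥ 3 a scalar other than
    -- 1 multiplies the constant trace value, which must therefore be 0. For q = 2 no such scalar
    -- exists and the partition argument takes over.
    constant-on-D∩H⇒0 : ∀ {v w u₂} → ¬ v ≡ 0# →
      (∀ x → D x ≡ true → 𝔽q.tr (v *ᶠ x) ≡ 0# → u₂ +ᶠ 𝔽q.tr (w *ᶠ x) ≡ 0#) → u₂ ≡ 0#
    constant-on-D∩H⇒0 {v} {w} {u₂} v≢0 constant = decidable-stable (u₂ ≟ᶠ 0#) (go binary?)
      where
      go : q ≡ 2 ⊎ 3 ≤ q → ¬ ¬ u₂ ≡ 0#
      go (inj₁ q≡2) u₂≢0 = binary-trace-on-D∩H q≡2 v≢0 (λ x x∈ vx≡0 wx≡0 →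
        u₂≢0 (trans (sym (trans (cong (u₂ +ᶠ_) wx≡0) (R.+-identityʳ u₂))) (constant x x∈ vx≡0)))
      go (inj₂ 3≤q) u₂≢0 = u₂≢0 (trans (sym (trans (cong (u₂ +ᶠ_) b≡0) (R.+-identityʳ u₂))) (constant x x∈ vx≡0))
        where
        x = proj₁ (D∩H≢∅ v≢0)
        x∈ = proj₁ (proj₂ (D∩H≢∅ v≢0))
        vx≡0 = proj₂ (proj₂ (D∩H≢∅ v≢0))
        g = γ ^ᶠ h
        b = 𝔽q.tr (w *ᶠ x)
        gb≡b : g *ᶠ b ≡ b
        gb≡b = Rₚ.+-cancelˡ u₂ _ _ (begin
          u₂ +ᶠ g *ᶠ b ≡⟨ cong (u₂ +ᶠ_) (tr-scale w x 𝔽q.Fq-γ^h) ⟨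
          u₂ +ᶠ 𝔽q.tr (w *ᶠ (g *ᶠ x)) ≡⟨ constant (g *ᶠ x) (trans (D-Fq g x (γ^≢0 h) 𝔽q.Fq-γ^h) x∈)
                (trans (tr-scale v x 𝔽q.Fq-γ^h) (trans (cong (g *ᶠ_) vx≡0) (R.zeroʳ g))) ⟩
          0# ≡⟨ constant x x∈ vx≡0 ⟨
          u₂ +ᶠ b ∎)
        b≡0 : b ≡ 0#
        b≡0 = decidable-stable (b ≟ᶠ 0#) (λ b≢0 → γ^h≢1 3≤q (*-cancelˡ b≢0 (trans (R.*-comm b g) (trans gb≡b (sym (R.*-identityʳ b))))))

    module _ {u₁ v₁ u₂ v₂ : Carrier} (u₁∈ : 𝔽q.Fq u₁) (u₂∈ : 𝔽q.Fq u₂)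
             (supp⊆ : ∀ x → ¬ x ≡ 0# → ¬ c u₂ v₂ x ≡ 0# → ¬ c u₁ v₁ x ≡ 0#) where

      zeros : ∀ {x} → ¬ x ≡ 0# → c u₁ v₁ x ≡ 0# → c u₂ v₂ x ≡ 0#
      zeros x≢0 e = decidable-stable (_ ≟ᶠ 0#) (λ ne → supp⊆ _ x≢0 ne e)

      multiple-of-trace : u₁ ≡ 0# → ¬ v₁ ≡ 0# → Multiple u₁ v₁ u₂ v₂
      multiple-of-trace refl v₁≢0 = let a , a∈ , eq = hyperplane-⊆ v₁≢0 H⊆H in
        a , a∈ , λ x _ → trans (c₂≡tr x) (trans (eq x) (cong (a *ᶠ_) (sym (c-0 v₁ x))))
        where
        u₂≡0 : u₂ ≡ 0#
        u₂≡0 = constant-on-D∩H⇒0 v₁≢0 (λ x x∈ v₁x≡0 →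
          trans (sym (c-∈ u₂ v₂ x∈)) (zeros (D-≢0 x∈) (trans (c-0 v₁ x) v₁x≡0)))
        c₂≡tr : ∀ x → c u₂ v₂ x ≡ 𝔽q.tr (v₂ *ᶠ x)
        c₂≡tr x = trans (cong (λ z → c z v₂ x) u₂≡0) (c-0 v₂ x)
        H⊆H : ∀ x → 𝔽q.tr (v₁ *ᶠ x) ≡ 0# → 𝔽q.tr (v₂ *ᶠ x) ≡ 0#
        H⊆H x v₁x≡0 = go (toSum (x ≟ᶠ 0#))
          where
          go : x ≡ 0# ⊎ ¬ x ≡ 0# → 𝔽q.tr (v₂ *ᶠ x) ≡ 0#
          go (inj₁ refl) = tr-*0 v₂
          go (inj₂ x≢0)  = trans (sym (c₂≡tr x)) (zeros x≢0 (trans (c-0 v₁ x) v₁x≡0))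

      -- With a = u₂/u₁ the codeword c₂ - a c₁ is the trace form of w = v₂ - a v₁, which vanishes wherever c₁ does.
      multiple-of-mixed : ¬ u₁ ≡ 0# → Multiple u₁ v₁ u₂ v₂
      multiple-of-mixed u₁≢0 = a , a∈ , λ x _ → trans (c₂-split x) (trans (cong (a *ᶠ c u₁ v₁ x +ᶠ_)
          (trans (cong (λ z → 𝔽q.tr (z *ᶠ x)) w≡0) (trans (cong 𝔽q.tr (R.zeroˡ x)) 𝔽q.tr-0))) (R.+-identityʳ _))
        where
        u₁⁻¹ = proj₁ (inverse u₁ u₁≢0)
        a = u₁⁻¹ *ᶠ u₂
        w = v₂ -ᶠ a *ᶠ v₁
        a∈ : 𝔽q.Fq a
        a∈ = 𝔽q.Fq-* (𝔽q.Fq-inverse u₁≢0 (proj₂ (inverse u₁ u₁≢0)) u₁∈) u₂∈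
        au₁≡u₂ : a *ᶠ u₁ ≡ u₂
        au₁≡u₂ = trans (R.*-comm a u₁) (trans (sym (R.*-assoc u₁ u₁⁻¹ u₂)) (trans (cong (_*ᶠ u₂) (proj₂ (inverse u₁ u₁≢0))) (R.*-identityˡ u₂)))
        tr-v₂ : ∀ x → 𝔽q.tr (v₂ *ᶠ x) ≡ a *ᶠ 𝔽q.tr (v₁ *ᶠ x) +ᶠ 𝔽q.tr (w *ᶠ x)
        tr-v₂ x = begin
          𝔽q.tr (v₂ *ᶠ x) ≡⟨ cong (λ z → 𝔽q.tr (z *ᶠ x)) (trans (R.+-comm _ _) (x-y+y v₂ (a *ᶠ v₁))) ⟨
          𝔽q.tr ((a *ᶠ v₁ +ᶠ w) *ᶠ x) ≡⟨ tr-+ˡ (a *ᶠ v₁) w x ⟩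
          𝔽q.tr (a *ᶠ v₁ *ᶠ x) +ᶠ 𝔽q.tr (w *ᶠ x)
            ≡⟨ cong (_+ᶠ 𝔽q.tr (w *ᶠ x)) (trans (cong 𝔽q.tr (R.*-assoc a v₁ x)) (𝔽q.tr-*ˡ a _ a∈)) ⟩
          a *ᶠ 𝔽q.tr (v₁ *ᶠ x) +ᶠ 𝔽q.tr (w *ᶠ x) ∎
        c₂-split : ∀ x → c u₂ v₂ x ≡ a *ᶠ c u₁ v₁ x +ᶠ 𝔽q.tr (w *ᶠ x)
        c₂-split x = begin
          u₂ *ᶠ 𝟙D x +ᶠ 𝔽q.tr (v₂ *ᶠ x)
            ≡⟨ cong₂ _+ᶠ_ (trans (cong (_*ᶠ 𝟙D x) (sym au₁≡u₂)) (R.*-assoc a u₁ _)) (tr-v₂ x) ⟩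
          a *ᶠ (u₁ *ᶠ 𝟙D x) +ᶠ (a *ᶠ 𝔽q.tr (v₁ *ᶠ x) +ᶠ 𝔽q.tr (w *ᶠ x)) ≡⟨ R.+-assoc _ _ _ ⟨
          a *ᶠ (u₁ *ᶠ 𝟙D x) +ᶠ a *ᶠ 𝔽q.tr (v₁ *ᶠ x) +ᶠ 𝔽q.tr (w *ᶠ x)
            ≡⟨ cong (_+ᶠ 𝔽q.tr (w *ᶠ x)) (R.distribˡ a _ _) ⟨
          a *ᶠ c u₁ v₁ x +ᶠ 𝔽q.tr (w *ᶠ x) ∎
        tr-w≡0 : ∀ {x} → ¬ x ≡ 0# → c u₁ v₁ x ≡ 0# → 𝔽q.tr (w *ᶠ x) ≡ 0#
        tr-w≡0 {x} x≢0 e = begin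
          𝔽q.tr (w *ᶠ x) ≡⟨ R.+-identityˡ _ ⟨
          0# +ᶠ 𝔽q.tr (w *ᶠ x) ≡⟨ cong (_+ᶠ 𝔽q.tr (w *ᶠ x)) (trans (cong (a *ᶠ_) e) (R.zeroʳ a)) ⟨
          a *ᶠ c u₁ v₁ x +ᶠ 𝔽q.tr (w *ᶠ x) ≡⟨ c₂-split x ⟨
          c u₂ v₂ x ≡⟨ zeros x≢0 e ⟩
          0# ∎
        out-D : ∀ x → D x ≡ false → 𝔽q.tr (v₁ *ᶠ x) ≡ 0# → 𝔽q.tr (w *ᶠ x) ≡ 0#
        out-D x x∉ v₁x≡0 = go (toSum (x ≟ᶠ 0#))
          where
          go : x ≡ 0# ⊎ ¬ x ≡ 0# → 𝔽q.tr (w *ᶠ x) ≡ 0#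
          go (inj₁ refl) = tr-*0 w
          go (inj₂ x≢0)  = tr-w≡0 x≢0 (trans (c-∉ u₁ v₁ x∉) v₁x≡0)
        -- The multiple of x by g = -u₁ / tr(v₁ x) is still in `D`, and c₁ vanishes there; tr(w x)
        -- is then zero up to the scalar g.
        in-D : ∀ x → D x ≡ true → ¬ 𝔽q.tr (v₁ *ᶠ x) ≡ 0# → 𝔽q.tr (w *ᶠ x) ≡ 0#
        in-D x x∈ v₁x≢0 = x*y≡0⇒y≡0 g≢0 (trans (sym (tr-scale w x g∈)) (tr-w≡0 (*-≢0 g≢0 (D-≢0 x∈)) (begin
          c u₁ v₁ (g *ᶠ x) ≡⟨ c-∈ u₁ v₁ (trans (D-Fq g x g≢0 g∈) x∈) ⟩
          u₁ +ᶠ 𝔽q.tr (v₁ *ᶠ (g *ᶠ x)) ≡⟨ cong (u₁ +ᶠ_) (trans (tr-scale v₁ x g∈) gb≡-u₁) ⟩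
          u₁ -ᶠ u₁ ≡⟨ R.-‿inverseʳ u₁ ⟩
          0# ∎)))
          where
          scale = 𝔽q.Fq-scale-to-1 v₁x≢0 (𝔽q.tr-∈ _)
          g = (-ᶠ u₁) *ᶠ proj₁ scale
          g∈ : 𝔽q.Fq g
          g∈ = 𝔽q.Fq-* (𝔽q.Fq-neg u₁∈) (proj₁ (proj₂ scale))
          gb≡-u₁ : g *ᶠ 𝔽q.tr (v₁ *ᶠ x) ≡ -ᶠ u₁
          gb≡-u₁ = trans (R.*-assoc _ _ _) (trans (cong ((-ᶠ u₁) *ᶠ_) (proj₂ (proj₂ scale))) (R.*-identityʳ _))
          g≢0 : ¬ g ≡ 0#
          g≢0 g≡0 = u₁≢0 (Rₚ.-‿injective (trans (sym gb≡-u₁) (trans (trans (cong (_*ᶠ 𝔽q.tr (v₁ *ᶠ x)) g≡0) (R.zeroˡ _)) (sym Rₚ.-0#≈0#))))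
        Crossing : Set
        Crossing = ∃ λ x → 𝔽q.tr (v₁ *ᶠ x) ≡ 0# × ¬ 𝔽q.tr (w *ᶠ x) ≡ 0#
        -- A scalar multiple of the crossing point lies in the hyperplane of v₁ and has trace 1
        -- against w: the direction of translation that `no-crossing` requires.
        crossing⇒⊥ : ¬ v₁ ≡ 0# → ¬ Crossing
        crossing⇒⊥ v₁≢0 (x , v₁x≡0 , wx≢0) = no-crossing v₁≢0 v₁+w≢0 v₁x₁≡0 (proj₂ (proj₂ scale)) in-D out-D
          where
          scale = 𝔽q.tr-scale-to-1 w wx≢0
          v₁x₁≡0 : 𝔽q.tr (v₁ *ᶠ (proj₁ scale *ᶠ x)) ≡ 0#
          v₁x₁≡0 = trans (tr-scale v₁ x (proj₁ (proj₂ scale))) (trans (cong (proj₁ scale *ᶠ_) v₁x≡0) (R.zeroʳ _))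
          v₁+w≢0 : ¬ v₁ +ᶠ w ≡ 0#
          v₁+w≢0 e = wx≢0 (begin
            𝔽q.tr (w *ᶠ x) ≡⟨ trans (cong (_+ᶠ 𝔽q.tr (w *ᶠ x)) v₁x≡0) (R.+-identityˡ _) ⟨
            𝔽q.tr (v₁ *ᶠ x) +ᶠ 𝔽q.tr (w *ᶠ x) ≡⟨ tr-+ˡ v₁ w x ⟨
            𝔽q.tr ((v₁ +ᶠ w) *ᶠ x) ≡⟨ cong (λ z → 𝔽q.tr (z *ᶠ x)) e ⟩
            𝔽q.tr (0# *ᶠ x) ≡⟨ trans (cong 𝔽q.tr (R.zeroˡ x)) 𝔽q.tr-0 ⟩
            0# ∎)
        -- Now the form of w is a nonzero multiple of that of v₁, so `in-D` contradicts itself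
        -- wherever tr(v₁ x) ≠ 0: all of `D` would lie in one hyperplane.
        parallel⇒⊥ : ¬ v₁ ≡ 0# → ¬ w ≡ 0# → ¬ Crossing → ⊥
        parallel⇒⊥ v₁≢0 w≢0 ¬crossing = D⊄H v₁≢0 (λ x x∈ → decidable-stable (_ ≟ᶠ 0#) (λ v₁x≢0 →
            *-≢0 b≢0 v₁x≢0 (trans (sym (tr-w x)) (in-D x x∈ v₁x≢0))))
          where
          proportional = hyperplane-⊆ {w = w} v₁≢0 (λ x v₁x≡0 → decidable-stable (_ ≟ᶠ 0#) (λ wx≢0 → ¬crossing (x , v₁x≡0 , wx≢0)))
          b = proj₁ proportional
          tr-w = proj₂ (proj₂ proportional)
          b≢0 : ¬ b ≡ 0#
          b≢0 b≡0 = w≢0 (𝔽q.tr-nondegenerate (λ x → trans (tr-w x) (trans (cong (_*ᶠ 𝔽q.tr (v₁ *ᶠ x)) b≡0) (R.zeroˡ _))))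
        w≡0 : w ≡ 0#
        w≡0 = decidable-stable (w ≟ᶠ 0#) (λ w≢0 → contra w≢0 (toSum (v₁ ≟ᶠ 0#)))
          where
          contra : ¬ w ≡ 0# → v₁ ≡ 0# ⊎ ¬ v₁ ≡ 0# → ⊥
          -- For v₁ = 0 the word c₁ vanishes everywhere off `D`, so the complement of `D` would lie
          -- in the hyperplane of w.
          contra w≢0 (inj₁ v₁≡0) = Dᶜ⊄H w≢0 (λ x x∉ → out-D x x∉
            (trans (cong (λ z → 𝔽q.tr (z *ᶠ x)) v₁≡0) (trans (cong 𝔽q.tr (R.zeroˡ x)) 𝔽q.tr-0)))
          contra w≢0 (inj₂ v₁≢0) = parallel⇒⊥ v₁≢0 w≢0 (crossing⇒⊥ v₁≢0)

      multiple : Multiple u₁ v₁ u₂ v₂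
      multiple = go (toSum (u₁ ≟ᶠ 0#)) (toSum (v₁ ≟ᶠ 0#))
        where
        go : u₁ ≡ 0# ⊎ ¬ u₁ ≡ 0# → v₁ ≡ 0# ⊎ ¬ v₁ ≡ 0# → Multiple u₁ v₁ u₂ v₂
        go (inj₂ u₁≢0) _           = multiple-of-mixed u₁≢0
        go (inj₁ u₁≡0) (inj₂ v₁≢0) = multiple-of-trace u₁≡0 v₁≢0
        go (inj₁ refl) (inj₁ refl) = 0# , 𝔽q.Fq-0 , λ x x≢0 → trans (zeros x≢0
          (trans (c-0 0# x) (trans (cong 𝔽q.tr (R.zeroˡ x)) 𝔽q.tr-0))) (sym (R.zeroˡ _))

-- The boolean set D read as a condition on exponents modulo N.

≡true-cong : ∀ {a b} → (a ≡ true → b ≡ true) → (b ≡ true → a ≡ true) → a ≡ b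
≡true-cong {true}  {b}     f g = sym (f refl)
≡true-cong {false} {true}  f g = g refl
≡true-cong {false} {false} f g = refl

∧-true : ∀ {a b} → a ∧ b ≡ true → a ≡ true × b ≡ true
∧-true {true} e = refl , e

∨-true : ∀ {a b} → a ∨ b ≡ true → a ≡ true ⊎ b ≡ true
∨-true {true}  e = inj₁ refl
∨-true {false} e = inj₂ e

isYes-true⁻ : {A : Set} (d : Dec A) → ⌊ d ⌋ ≡ true → A
isYes-true⁻ (yes a) _ = a

isYes-true⁺ : {A : Set} (d : Dec A) → A → ⌊ d ⌋ ≡ true
isYes-true⁺ (yes _) _ = refl
isYes-true⁺ (no ¬a) a = ⊥-elim (¬a a)

anyBelow⁻ : ∀ k f → anyBelow k f ≡ true → ∃ λ i → i < k × f i ≡ true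
anyBelow⁻ (suc k) f e with ∨-true {anyBelow k f} e
... | inj₂ fk = k , ℕₚ.n<1+n k , fk
... | inj₁ e′ = let i , i<k , fi = anyBelow⁻ k f e′ in i , ℕₚ.m<n⇒m<1+n i<k , fi

anyBelow⁺ : ∀ {k i} f → i < k → f i ≡ true → anyBelow k f ≡ true
anyBelow⁺ {suc k} {i} f i<1+k fi with ℕₚ.m≤n⇒m<n∨m≡n (ℕ.s≤s⁻¹ i<1+k)
... | inj₁ i<k  = trans (cong (_∨ f k) (anyBelow⁺ f i<k fi)) refl
... | inj₂ refl = trans (cong (anyBelow k f ∨_) fi) (Boolₚ.∨-zeroʳ (anyBelow k f))

prepend : ∀ {k} → Bool → (Fin k → Bool) → Fin (suc k) → Bool
prepend b f Fin.zero    = b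
prepend b f (Fin.suc j) = f j

-- The recursion behind anyFin is a local function of its where block; checking anyFin-suc makes unification
-- solve anyFinLoop to that function, with the enclosing arguments w and g as parameters.
mutual
  anyFinLoop : (w : ℕ) → (Fin w → Bool) → (k : ℕ) → (Fin k → Bool) → Bool
  anyFinLoop = _

  anyFin-suc : ∀ k b (f : Fin k → Bool) → anyFin (suc k) (prepend b f) ≡ b ∨ anyFinLoop (suc k) (prepend b f) k f
  anyFin-suc k b f with suc k | prepend b f
  ... | w | g = refl

anyFin⁻ : ∀ k f → anyFin k f ≡ true → ∃ λ j → f j ≡ true
anyFin⁻ k f = go k f
  where
  go : ∀ j h → anyFinLoop k f j h ≡ true → ∃ λ i → h i ≡ true
  go (suc j) h e with ∨-true {h Fin.zero} e
  ... | inj₁ h0 = Fin.zero , h0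
  ... | inj₂ e′ = let i , hi = go j (h ∘ Fin.suc) e′ in Fin.suc i , hi

anyFin⁺ : ∀ k f j → f j ≡ true → anyFin k f ≡ true
anyFin⁺ k f = go k f
  where
  go : ∀ j h i → h i ≡ true → anyFinLoop k f j h ≡ true
  go (suc j) h Fin.zero    hi = cong (_∨ anyFinLoop k f j (h ∘ Fin.suc)) hi
  go (suc j) h (Fin.suc i) hi = trans (cong (h Fin.zero ∨_) (go j (h ∘ Fin.suc) i hi)) (Boolₚ.∨-zeroʳ (h Fin.zero))

range-indicator : ∀ {N} (J : Subset N) (g : ℕ → ℤ) → (∀ j → j ∈ J → g (toℕ j) ≡ 1ℤ) →
                  (∀ j → ¬ j ∈ J → g (toℕ j) ≡ 0ℤ) → range N g ≡ pos ∣ J ∣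
range-indicator []          g g∈ g∉ = refl
range-indicator (true ∷ J)  g g∈ g∉ = cong₂ _+ᶻ_ (g∈ Fin.zero here)
  (range-indicator J (g ∘ suc) (λ j j∈ → g∈ (Fin.suc j) (there j∈)) (λ j j∉ → g∉ (Fin.suc j) (λ { (there j∈) → j∉ j∈ })))
range-indicator (false ∷ J) g g∈ g∉ = trans (cong₂ _+ᶻ_ (g∉ Fin.zero (λ ()))
  (range-indicator J (g ∘ suc) (λ j j∈ → g∈ (Fin.suc j) (there j∈)) (λ j j∉ → g∉ (Fin.suc j) (λ { (there j∈) → j∉ j∈ }))))
  (ℤₚ.+-identityˡ _)

toℕ-mod : ∀ i N .{{_ : NonZero N}} → toℕ (i mod N) ≡ i % N
toℕ-mod i N = Finₚ.toℕ-fromℕ< (DivMod.m%n<n i N)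

mod-cong : ∀ {i j N} .{{_ : NonZero N}} → i % N ≡ j % N → i mod N ≡ j mod N
mod-cong {i} {j} {N} e = Finₚ.toℕ-injective (trans (toℕ-mod i N) (trans e (sym (toℕ-mod j N))))

[i%N+h]%N : ∀ i h N .{{_ : NonZero N}} → (i % N + h) % N ≡ (i + h) % N
[i%N+h]%N i h N = begin
  (i % N + h) % N ≡⟨ DivMod.%-remove-+ʳ (i % N + h) (Div.n∣m*n (i / N)) ⟨
  (i % N + h + i / N * N) % N ≡⟨ cong (_% N) (trans (ℕₚ.+-assoc (i % N) h _) (cong (i % N +_) (ℕₚ.+-comm h _))) ⟩
  (i % N + (i / N * N + h)) % N ≡⟨ cong (_% N) (ℕₚ.+-assoc (i % N) (i / N * N) h) ⟨
  (i % N + i / N * N + h) % N ≡⟨ cong (λ k → (k + h) % N) (DivMod.m≡m%n+[m/n]*n i N) ⟨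
  (i + h) % N ∎

module CyclotomicSet {n : ℕ} (F : FiniteField n) (M : ℕ) (n≡1+M : n ≡ suc M) (2≤M : 2 ≤ M)
                     (γ : FiniteField.Carrier F) (γ-generates : FiniteField.IsPrimitive F γ)
                     (N : ℕ) .{{_ : NonZero N}} (N∣M : N ∣ M) (J : Subset N) where
  open FieldProperties F
  open PrimitiveElement F M n≡1+M 2≤M γ γ-generates

  private instance
    M-nonZero : NonZero M
    M-nonZero = ℕ.>-nonZero (ℕₚ.≤-trans (s≤s z≤n) 2≤M)

  D : Carrier → Bool
  D = inD F γ N J

  n∸1≡M : n ∸ 1 ≡ M
  n∸1≡M = cong (_∸ 1) n≡1+M

  eqb⁻ : ∀ {x y} → eqb x y ≡ true → x ≡ y
  eqb⁻ e = from-injective (isYes-true⁻ (_ Finₚ.≟ _) e)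

  eqb⁺ : ∀ {x y} → x ≡ y → eqb x y ≡ true
  eqb⁺ {x} {y} e = isYes-true⁺ (_ Finₚ.≟ _) (cong (Inverse.from enum) e)

  D⁻ : ∀ {x} → D x ≡ true → Σ (Fin N) λ j → j ∈ J × Σ ℕ λ k → x ≡ γ ^ᶠ (k * N + toℕ j)
  D⁻ {x} x∈ = let
      j , ej = anyFin⁻ N _ x∈
      j∈ , below = ∧-true ej
      k , _ , ek = anyBelow⁻ ((n ∸ 1) / N) _ below
    in j , isYes-true⁻ (j ∈? J) j∈ , k , eqb⁻ ek

  D⁺ : ∀ {x} j k → j ∈ J → k < M / N → x ≡ γ ^ᶠ (k * N + toℕ j) → D x ≡ true
  D⁺ j k j∈ k< e = anyFin⁺ N _ j (trans (cong₂ _∧_ (isYes-true⁺ (j ∈? J) j∈)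
    (anyBelow⁺ _ (subst (λ z → k < z / N) (sym n∸1≡M) k<) (eqb⁺ e))) refl)

  D-0 : D 0# ≡ false
  D-0 = Boolₚ.¬-not (λ 0∈ → let j , _ , k , e = D⁻ 0∈ in γ^≢0 (k * N + toℕ j) (sym e))

  -- Exponents are determined modulo `M`, hence modulo its divisor `N`; this makes the cyclotomic
  -- classes disjoint.
  γ^-% : ∀ {i j} → γ ^ᶠ i ≡ γ ^ᶠ j → i % N ≡ j % N
  γ^-% {i} {j} e = begin
    i % N ≡⟨ DivMod.m∣n⇒o%n%m≡o%m N M i N∣M ⟨
    i % M % N ≡⟨ cong (_% N) (γ^-injective (DivMod.m%n<n i M) (DivMod.m%n<n j M)
                      (trans (γ^-mod M γ^M≡1 i) (trans e (sym (γ^-mod M γ^M≡1 j))))) ⟩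
    j % M % N ≡⟨ DivMod.m∣n⇒o%n%m≡o%m N M j N∣M ⟩
    j % N ∎

  D-γ⁻ : ∀ i → D (γ ^ᶠ i) ≡ true → (i mod N) ∈ J
  D-γ⁻ i i∈ = let j , j∈ , k , e = D⁻ i∈ in subst (_∈ J) (sym (Finₚ.toℕ-injective (begin
    toℕ (i mod N) ≡⟨ toℕ-mod i N ⟩
    i % N ≡⟨ γ^-% e ⟩
    (k * N + toℕ j) % N ≡⟨ DivMod.%-remove-+ˡ (toℕ j) (Div.n∣m*n k) ⟩
    toℕ j % N ≡⟨ DivMod.m<n⇒m%n≡m (Finₚ.toℕ<n j) ⟩
    toℕ j ∎))) j∈

  -- The search defining `D` is bounded by M / N, so the exponent is first reduced modulo `M`, which
  -- keeps its residue modulo `N`.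
  D-γ⁺ : ∀ i → (i mod N) ∈ J → D (γ ^ᶠ i) ≡ true
  D-γ⁺ i i∈ = D⁺ (i mod N) (i % M / N) i∈ k<
    (trans (sym (γ^-mod M γ^M≡1 i)) (cong (γ ^ᶠ_) (begin
      i % M ≡⟨ DivMod.m≡m%n+[m/n]*n (i % M) N ⟩
      i % M % N + i % M / N * N ≡⟨ ℕₚ.+-comm (i % M % N) _ ⟩
      i % M / N * N + i % M % N
        ≡⟨ cong (i % M / N * N +_) (trans (DivMod.m∣n⇒o%n%m≡o%m N M i N∣M) (sym (toℕ-mod i N))) ⟩
      i % M / N * N + toℕ (i mod N) ∎)))
    where
    k< : i % M / N < M / N
    k< = DivMod.m<n*o⇒m/o<n (subst (i % M <_) (sym (DivMod.m/n*n≡m N∣M)) (DivMod.m%n<n i M))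

  D-γ-cong : ∀ i j → i % N ≡ j % N → D (γ ^ᶠ i) ≡ D (γ ^ᶠ j)
  D-γ-cong i j e = ≡true-cong (λ i∈ → D-γ⁺ j (subst (_∈ J) (mod-cong e) (D-γ⁻ i i∈)))
                              (λ j∈ → D-γ⁺ i (subst (_∈ J) (mod-cong (sym e)) (D-γ⁻ j j∈)))

  D-^K : ∀ {K} → N ∣ K → ∀ x y → ¬ y ≡ 0# → D (x *ᶠ y ^ᶠ K) ≡ D x
  D-^K {K} N∣K x y y≢0 = go (toSum (x ≟ᶠ 0#))
    where
    go : x ≡ 0# ⊎ ¬ x ≡ 0# → D (x *ᶠ y ^ᶠ K) ≡ D x
    go (inj₁ refl) = cong D (R.zeroˡ _)
    go (inj₂ x≢0)  = let
        i , _ , x≡ = log x≢0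
        k , _ , y≡ = log y≢0
      in begin
        D (x *ᶠ y ^ᶠ K) ≡⟨ cong D (cong₂ (λ a b → a *ᶠ b ^ᶠ K) x≡ y≡) ⟩
        D (γ ^ᶠ i *ᶠ (γ ^ᶠ k) ^ᶠ K) ≡⟨ cong D (trans (cong (γ ^ᶠ i *ᶠ_) (sym (^-* γ k K))) (sym (^-+ γ i (k * K)))) ⟩
        D (γ ^ᶠ (i + k * K)) ≡⟨ D-γ-cong (i + k * K) i (DivMod.%-remove-+ʳ i (Div.∣-trans N∣K (Div.n∣m*n k))) ⟩
        D (γ ^ᶠ i) ≡⟨ cong D x≡ ⟨
        D x ∎

  D-γ^h : ∀ {h} → (∀ j → j ∈ J → ((toℕ j + h) mod N) ∈ J) → ∀ k x → D x ≡ true → D (γ ^ᶠ (h * k) *ᶠ x) ≡ true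
  D-γ^h {h} J+h k x x∈ = let i , _ , x≡ = log x≢0 in
    trans (cong D (trans (cong (γ ^ᶠ (h * k) *ᶠ_) x≡) (trans (R.*-comm _ _) (sym (^-+ γ i (h * k))))))
          (D-γ⁺ (i + h * k) (go i k (D-γ⁻ i (trans (cong D (sym x≡)) x∈))))
    where
    x≢0 : ¬ x ≡ 0#
    x≢0 refl with () ← trans (sym D-0) x∈
    go : ∀ i k → (i mod N) ∈ J → ((i + h * k) mod N) ∈ J
    go i zero    i∈ = subst (λ z → (z mod N) ∈ J) (sym (trans (cong (i +_) (ℕₚ.*-zeroʳ h)) (ℕₚ.+-identityʳ i))) i∈
    go i (suc k) i∈ = subst (_∈ J) (mod-cong (begin
      (toℕ ((i + h * k) mod N) + h) % N ≡⟨ cong (λ z → (z + h) % N) (toℕ-mod (i + h * k) N) ⟩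
      ((i + h * k) % N + h) % N ≡⟨ [i%N+h]%N (i + h * k) h N ⟩
      (i + h * k + h) % N
        ≡⟨ cong (_% N) (trans (ℕₚ.+-assoc i (h * k) h) (cong (i +_) (trans (ℕₚ.+-comm (h * k) h) (sym (ℕₚ.*-suc h k))))) ⟩
      (i + h * suc k) % N ∎)) (J+h _ (go i k i∈))

  -- Along the powers of `γ` membership has period `N`, with |J| members in each of the M / N
  -- periods.
  N*#D : ∀ (E : Carrier → ℤ) → (∀ {x} → D x ≡ true → E x ≡ 1ℤ) → (∀ {x} → D x ≡ false → E x ≡ 0ℤ) →
         pos N *ᶻ ∑ E ≡ pos ∣ J ∣ *ᶻ pos M
  N*#D E E-∈ E-∉ = begin
    pos N *ᶻ ∑ E ≡⟨ cong (pos N *ᶻ_) (trans (∑-log E) (trans (cong (_+ᶻ range M g) (E-∉ D-0)) (ℤₚ.+-identityˡ _))) ⟩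
    pos N *ᶻ range M g ≡⟨ cong (λ k → pos N *ᶻ range k g) (DivMod.m/n*n≡m N∣M) ⟨
    pos N *ᶻ range (M / N * N) g ≡⟨ cong (pos N *ᶻ_) (range-periodic N (M / N) g period) ⟩
    pos N *ᶻ (pos (M / N) *ᶻ range N g) ≡⟨ cong (λ z → pos N *ᶻ (pos (M / N) *ᶻ z)) (range-indicator J g g∈ g∉) ⟩
    pos N *ᶻ (pos (M / N) *ᶻ pos ∣ J ∣) ≡⟨ rearrange (pos N) (pos (M / N)) (pos ∣ J ∣) ⟩
    pos ∣ J ∣ *ᶻ (pos (M / N) *ᶻ pos N)
      ≡⟨ cong (pos ∣ J ∣ *ᶻ_) (trans (sym (ℤₚ.pos-* (M / N) N)) (cong pos (DivMod.m/n*n≡m N∣M))) ⟩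
    pos ∣ J ∣ *ᶻ pos M ∎
    where
    g : ℕ → ℤ
    g i = E (γ ^ᶠ i)
    rearrange : ∀ a b c → a *ᶻ (b *ᶻ c) ≡ c *ᶻ (b *ᶻ a)
    rearrange = solve-∀
    E-cong : ∀ {x y} → D x ≡ D y → E x ≡ E y
    E-cong {x} {y} e with D x in x∈
    ... | true  = trans (E-∈ x∈) (sym (E-∈ (sym e)))
    ... | false = trans (E-∉ x∈) (sym (E-∉ (sym e)))
    period : ∀ i → g (N + i) ≡ g i
    period i = E-cong (D-γ-cong (N + i) i (DivMod.%-remove-+ˡ i Div.∣-refl))
    toℕ-mod-id : ∀ (j : Fin N) → toℕ j mod N ≡ j
    toℕ-mod-id j = Finₚ.toℕ-injective (trans (toℕ-mod (toℕ j) N) (DivMod.m<n⇒m%n≡m (Finₚ.toℕ<n j)))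
    g∈ : ∀ j → j ∈ J → g (toℕ j) ≡ 1ℤ
    g∈ j j∈ = E-∈ (D-γ⁺ (toℕ j) (subst (_∈ J) (sym (toℕ-mod-id j)) j∈))
    g∉ : ∀ j → ¬ j ∈ J → g (toℕ j) ≡ 0ℤ
    g∉ j j∉ = E-∉ (Boolₚ.¬-not (λ j∈ → j∉ (subst (_∈ J) (toℕ-mod-id j) (D-γ⁻ (toℕ j) j∈))))

-- The hypotheses of the theorem as conditions on τ, s and D.

neg-power-parity : ∀ P t → (t % 2 ≡ 0 → (-ᶻ pos P) ℤ.^ t ≡ pos (P ^ t)) × (t % 2 ≡ 1 → (-ᶻ pos P) ℤ.^ t ≡ -ᶻ pos (P ^ t))
neg-power-parity P zero          = (λ _ → refl) , (λ ())
neg-power-parity P (suc zero)    = (λ ()) , (λ _ → trans (ℤₚ.*-identityʳ _) (cong (λ k → -ᶻ pos k) (sym (ℕₚ.*-identityʳ P))))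
neg-power-parity P (suc (suc t)) = (λ e → step (pos (P ^ t)) (proj₁ IH e) pos-step) ,
  (λ e → step (-ᶻ pos (P ^ t)) (proj₂ IH e) (trans (neg (pos P) (pos (P ^ t))) (cong -ᶻ_ pos-step)))
  where
  IH = neg-power-parity P t
  square : ∀ P x → -ᶻ P *ᶻ (-ᶻ P *ᶻ x) ≡ P *ᶻ (P *ᶻ x)
  square = solve-∀
  neg : ∀ P x → P *ᶻ (P *ᶻ (-ᶻ x)) ≡ -ᶻ (P *ᶻ (P *ᶻ x))
  neg = solve-∀
  pos-step : pos P *ᶻ (pos P *ᶻ pos (P ^ t)) ≡ pos (P ^ suc (suc t))
  pos-step = trans (cong (pos P *ᶻ_) (sym (ℤₚ.pos-* P _))) (sym (ℤₚ.pos-* P _))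
  step : ∀ x {y} → (-ᶻ pos P) ℤ.^ t ≡ x → pos P *ᶻ (pos P *ᶻ x) ≡ y → (-ᶻ pos P) ℤ.^ suc (suc t) ≡ y
  step x e e′ = trans (cong (λ z → -ᶻ pos P *ᶻ (-ᶻ pos P *ᶻ z)) e) (trans (square (pos P) x) e′)

square-injective : ∀ {a b} → a * a ≡ b * b → a ≡ b
square-injective {a} {b} e with ℕₚ.<-cmp a b
... | tri< a<b _ _ = ⊥-elim (ℕₚ.<⇒≢ (ℕₚ.*-mono-< a<b a<b) e)
... | tri≈ _ a≡b _ = a≡b
... | tri> _ _ b<a = ⊥-elim (ℕₚ.<⇒≢ (ℕₚ.*-mono-< b<a b<a) (sym e))

∣J∣<N : ∀ {N} {J : Subset N} → ¬ J ≡ ⊤ → ∣ J ∣ < N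
∣J∣<N {N} {J} J≢⊤ = ℕₚ.≤∧≢⇒< (Subsetₚ.∣p∣≤n J) (λ e → J≢⊤ (Subsetₚ.∣p∣≡n⇒p≡⊤ e))

theorem6 : (p e q m : ℕ) → Prime p → 1 ≤ e → q ≡ p ^ e → 4 ≤ m →
    ¬ (m ≡ 4 × q ≡ 2) → 2 ∣ e * m →
    (F : FiniteField (q ^ m)) → (γ : FiniteField.Carrier F) → FiniteField.IsPrimitive F γ →
    (N : ℕ) .{{_ : NonZero N}} .{{_ : NonZero (q ∸ 1)}} →
    N ∣ q ^ m ∸ 1 → ¬ (N ≡ 1) → ¬ (N ≡ q ^ m ∸ 1) →
    (ℓ₁ : ℕ) → 1 ≤ ℓ₁ → N ∣ p ^ ℓ₁ + 1 → (∀ l → 1 ≤ l → N ∣ p ^ l + 1 → ℓ₁ ≤ l) →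
    (t : ℕ) → e * m ≡ 2 * ℓ₁ * t →
    (J : Subset N) → ¬ (J ≡ ⊤) → (u : ℕ) → ∣ J ∣ ≡ u →
    (q % 2 ≡ 1 → N ∣ (q ^ m ∸ 1) / 2 ×
    (∀ j → (j ∈ J) ⇔ (((toℕ j + (q ^ m ∸ 1) / 2) mod N) ∈ J))) →
    (∀ j → j ∈ J → ((toℕ j + (q ^ m ∸ 1) / (q ∸ 1)) mod N) ∈ J) →
    (s : ℕ) → s * s ≡ q ^ m →
    ((t % 2 ≡ 1 × ¬ (u * (s + 1) ≡ s * N) × N < u * (s + 1)) ⊎
    (t % 2 ≡ 0 × (q ∸ 1) * s * N < u * ((s + q) * (s ∸ 1)))) →
    IsMinimalCodeMD F q m γ N J
theorem6 p e _ m p-prime 1≤e refl 4≤m m≢4∨q≢2 2∣em F γ γ-generates N N∣M N≢1 N≢M ℓ 1≤ℓ N∣K ℓ-minimal t em≡2ℓt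
         J J≢⊤ _ refl q-odd J+h s s²≡n conditions u₁ v₁ u₂ v₂ u₁∈ u₂∈ supp⊆ =
  Min.multiple u₁∈ u₂∈ supp⊆
  where
  q n M h u P : ℕ
  q = p ^ e
  n = q ^ m
  M = n ∸ 1
  h = M / (q ∸ 1)
  u = ∣ J ∣
  P = p ^ ℓ

  2≤p : 2 ≤ p
  2≤p = ℕ.nonTrivial⇒n>1 p {{Primality.prime⇒nonTrivial p-prime}}

  1≤p : 1 ≤ p
  1≤p = ℕₚ.<⇒≤ 2≤p

  2≤q : 2 ≤ q
  2≤q = ℕₚ.≤-trans (subst (2 ≤_) (sym (ℕₚ.*-identityʳ p)) 2≤p) (ℕₚ.^-monoʳ-≤ p {{ℕ.>-nonZero 1≤p}} 1≤e)

  1≤q : 1 ≤ q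
  1≤q = ℕₚ.<⇒≤ 2≤q

  1≤m : 1 ≤ m
  1≤m = ℕₚ.≤-trans (s≤s z≤n) 4≤m

  q^4≤n : q ^ 4 ≤ n
  q^4≤n = ℕₚ.^-monoʳ-≤ q {{ℕ.>-nonZero 1≤q}} 4≤m

  16≤n : 16 ≤ n
  16≤n = ℕₚ.≤-trans (ℕₚ.^-monoˡ-≤ 4 2≤q) q^4≤n

  n≡1+M : n ≡ suc M
  n≡1+M = sym (ℕₚ.m+[n∸m]≡n (ℕₚ.≤-trans (s≤s z≤n) 16≤n))

  2≤M : 2 ≤ M
  2≤M = ℕₚ.≤-trans (s≤s (s≤s z≤n)) (ℕₚ.∸-monoˡ-≤ 1 16≤n)

  1≤t : 1 ≤ t
  1≤t = ℕₚ.n≢0⇒n>0 λ t≡0 → ℕₚ.<⇒≢ (ℕₚ.*-mono-≤ 1≤e 1≤m) (sym (trans em≡2ℓt (trans (cong (2 * ℓ *_) t≡0) (ℕₚ.*-zeroʳ (2 * ℓ)))))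

  m*e≡2tℓ : m * e ≡ 2 * t * ℓ
  m*e≡2tℓ = begin
    m * e ≡⟨ ℕₚ.*-comm m e ⟩
    e * m ≡⟨ em≡2ℓt ⟩
    2 * ℓ * t ≡⟨ ℕₚ.*-assoc 2 ℓ t ⟩
    2 * (ℓ * t) ≡⟨ cong (2 *_) (ℕₚ.*-comm ℓ t) ⟩
    2 * (t * ℓ) ≡⟨ ℕₚ.*-assoc 2 t ℓ ⟨
    2 * t * ℓ ∎

  n≡p^2tℓ : n ≡ p ^ (2 * t * ℓ)
  n≡p^2tℓ = trans (ℕₚ.^-*-assoc p e m) (cong (p ^_) (trans (ℕₚ.*-comm e m) m*e≡2tℓ))

  M≡h*[q-1] : M ≡ h * (q ∸ 1)
  M≡h*[q-1] = let g , e = ∸1∣^∸1 m 1≤q in sym (DivMod.m/n*n≡m (divides g e))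

  module C = CyclotomicSet F M n≡1+M 2≤M γ γ-generates N N∣M J
  module Frob = Frobenius F p (2 * t * ℓ) p-prime n≡p^2tℓ
  module 𝔽q = Subfield F M n≡1+M 2≤M γ γ-generates q m h 2≤q 1≤m refl M≡h*[q-1] (Frob.frobenius^ e)
  open FieldProperties F

  D-Fq⇒ : ∀ a x → ¬ a ≡ 0# → 𝔽q.Fq a → C.D x ≡ true → C.D (a *ᶠ x) ≡ true
  D-Fq⇒ a x a≢0 a∈ x∈ = let k , a≡ = 𝔽q.Fq-log a≢0 a∈ in
    trans (cong (λ z → C.D (z *ᶠ x)) a≡) (C.D-γ^h J+h k x x∈)

  -- Invariance of `J` is assumed in one direction; the other follows by applying it to the inverse
  -- scalar.
  D-Fq : ∀ a x → ¬ a ≡ 0# → 𝔽q.Fq a → C.D (a *ᶠ x) ≡ C.D x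
  D-Fq a x a≢0 a∈ = ≡true-cong (λ ax∈ → trans (cong C.D (sym a⁻¹ax≡x)) (D-Fq⇒ a⁻¹ (a *ᶠ x) a⁻¹≢0 a⁻¹∈ ax∈))
                               (D-Fq⇒ a x a≢0 a∈)
    where
    a⁻¹ = proj₁ (inverse a a≢0)
    aa⁻¹≡1 = proj₂ (inverse a a≢0)
    a⁻¹∈ = 𝔽q.Fq-inverse a≢0 aa⁻¹≡1 a∈
    a⁻¹≢0 : ¬ a⁻¹ ≡ 0#
    a⁻¹≢0 = *-≢0ʳ (λ e → 1≢0 (trans (sym aa⁻¹≡1) e))
    a⁻¹ax≡x : a⁻¹ *ᶠ (a *ᶠ x) ≡ x
    a⁻¹ax≡x = trans (*-swapˡ a⁻¹ a x) (trans (sym (R.*-assoc a a⁻¹ x)) (trans (cong (_*ᶠ x) aa⁻¹≡1) (R.*-identityˡ x)))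

  module I = InvariantSet F M n≡1+M 2≤M γ γ-generates p ℓ t p-prime 1≤ℓ 1≤t n≡p^2tℓ e m h 1≤e 1≤m m*e≡2tℓ M≡h*[q-1]
               C.D C.D-0 (C.D-^K N∣K) D-Fq
  module S = Semiprimitive F M n≡1+M 2≤M γ γ-generates p ℓ t p-prime 1≤ℓ 1≤t n≡p^2tℓ

  s≡P^t : s ≡ P ^ t
  s≡P^t = square-injective (begin
    s * s ≡⟨ s²≡n ⟩
    n ≡⟨ S.n≡P^2t ⟩
    P ^ (2 * t) ≡⟨ cong (λ k → P ^ (t + k)) (ℕₚ.+-identityʳ t) ⟩
    P ^ (t + t) ≡⟨ ℕₚ.^-distribˡ-+-* P t t ⟩
    P ^ t * P ^ t ∎)

  -- This uses `4 ≤ m`: s² = q^m is at least q⁴ and so exceeds q².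
  q<s : q < s
  q<s = ℕₚ.≰⇒> λ s≤q → ℕₚ.<⇒≱ (ℕₚ.<-≤-trans (ℕₚ.^-monoʳ-< q 2≤q {2} {4} (s≤s (s≤s (s≤s z≤n)))) q^4≤n)
    (ℕₚ.≤-trans (ℕₚ.≤-reflexive (sym s²≡n)) (ℕₚ.≤-trans (ℕₚ.*-mono-≤ s≤q s≤q) (ℕₚ.≤-reflexive (cong (q *_) (sym (ℕₚ.*-identityʳ q))))))

  1≤s : 1 ≤ s
  1≤s = ℕₚ.≤-trans 1≤q (ℕₚ.<⇒≤ q<s)

  open WeightArithmetic N u q s (∣J∣<N J≢⊤) I.2≤q q<s S.τ using (Parameters)

  even⇒τ≡s : t % 2 ≡ 0 → S.τ ≡ pos s
  even⇒τ≡s t-even = trans (proj₁ (neg-power-parity P t) t-even) (cong pos (sym s≡P^t))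

  odd⇒τ≡-s : t % 2 ≡ 1 → S.τ ≡ -ᶻ pos s
  odd⇒τ≡-s t-odd = trans (proj₂ (neg-power-parity P t) t-odd) (cong (λ k → -ᶻ pos k) (sym s≡P^t))

  parameters : Parameters
  parameters = Sum.map (λ (t-odd , u[s+1]≢sN , N<) → odd⇒τ≡-s t-odd , u[s+1]≢sN , N<)
                       (λ (t-even , <u) → even⇒τ≡s t-even , <u) conditions

  -- Excluding (m, q) = (4, 2), where s = 4, leaves m ≥ 5 and s² ≥ 32.
  4<s : q ≡ 2 → 4 < s
  4<s q≡2 = ℕₚ.≰⇒> λ s≤4 → ℕₚ.<⇒≱ (ℕₚ.<-≤-trans (ℕₚ.m≤m+n 17 15) 32≤s²) (ℕₚ.*-mono-≤ s≤4 s≤4)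
    where
    5≤m : 5 ≤ m
    5≤m = ℕₚ.≤∧≢⇒< 4≤m (λ 4≡m → m≢4∨q≢2 (sym 4≡m , q≡2))
    32≤s² : 32 ≤ s * s
    32≤s² = subst (32 ≤_) (trans (cong (_^ m) (sym q≡2)) (sym s²≡n)) (ℕₚ.^-monoʳ-≤ 2 5≤m)

  -- Here `τ` = s, and `τ` is 1 modulo `K`, a multiple of `N`.
  N∣s∸1 : S.τ ≡ pos s → N ∣ s ∸ 1
  N∣s∸1 τ≡s = Div.∣-trans N∣K (divides ℤ.∣ b ∣ (begin
    s ∸ 1 ≡⟨ cong ℤ.∣_∣ (pos-∸1 1≤s) ⟨
    ℤ.∣ pos s -ᶻ 1ℤ ∣ ≡⟨ cong (λ z → ℤ.∣ z -ᶻ 1ℤ ∣) (trans (sym τ≡s) τ≡1+Kb) ⟩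
    ℤ.∣ 1ℤ +ᶻ pos K *ᶻ b -ᶻ 1ℤ ∣ ≡⟨ cong ℤ.∣_∣ (lem (pos K *ᶻ b)) ⟩
    ℤ.∣ pos K *ᶻ b ∣ ≡⟨ ℤₚ.abs-* (pos K) b ⟩
    K * ℤ.∣ b ∣ ≡⟨ ℕₚ.*-comm K _ ⟩
    ℤ.∣ b ∣ * K ∎))
    where
    K = P + 1
    b = proj₁ S.τ≡1
    τ≡1+Kb = proj₂ S.τ≡1
    lem : ∀ x → 1ℤ +ᶻ x -ᶻ 1ℤ ≡ x
    lem = solve-∀

  -- Here t is even, so s > 4 is the square of P^(t/2).
  8<s : q ≡ 2 → S.τ ≡ pos s → 8 < s
  8<s q≡2 τ≡s = subst (8 <_) (sym s≡r*r) (ℕₚ.*-mono-≤ 3≤r 3≤r)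
    where
    r = P ^ (t / 2)
    t-even : t % 2 ≡ 0
    t-even = Sum.[ (λ (t-odd , _) → ⊥-elim (pos+pos≢0 1≤s (trans (sym τ≡s) (odd⇒τ≡-s t-odd)))) , proj₁ ]′ conditions
    t≡2[t/2] : t ≡ t / 2 + t / 2
    t≡2[t/2] = begin
      t ≡⟨ DivMod.m≡m%n+[m/n]*n t 2 ⟩
      t % 2 + t / 2 * 2 ≡⟨ cong (_+ t / 2 * 2) t-even ⟩
      t / 2 * 2 ≡⟨ ℕₚ.*-comm (t / 2) 2 ⟩
      t / 2 + (t / 2 + 0) ≡⟨ cong (t / 2 +_) (ℕₚ.+-identityʳ (t / 2)) ⟩
      t / 2 + t / 2 ∎
    s≡r*r : s ≡ r * r
    s≡r*r = trans s≡P^t (trans (cong (P ^_) t≡2[t/2]) (ℕₚ.^-distribˡ-+-* P (t / 2) (t / 2)))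
    3≤r : 3 ≤ r
    3≤r = ℕₚ.≰⇒> λ r≤2 → ℕₚ.<⇒≱ (subst (4 <_) s≡r*r (4<s q≡2)) (ℕₚ.*-mono-≤ r≤2 r≤2)

  module Min = I.Minimality N u s (∣J∣<N J≢⊤) q<s (C.N*#D I.E I.E-∈ I.E-∉) parameters 4<s
                 (λ q≡2 τ≡s → 8<s q≡2 τ≡s , N∣s∸1 τ≡s)
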